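{- Let $k\ge 1$ and $r\ge 2$ be integers, let $n_0=kr(k+r-2)+2r-1$, and let $H$ be an $r$-graph consisting of exactly $k$ pairwise disjoint (independent) edges. If $n\ge n_0$, then $$\phi_H^r(n)=\begin{cases}\left\lfloor \frac1k\binom{n}{r}\right\rfloor+k-1, & \text{if } \binom{n}{r}\equiv k-1\pmod k,\\[2pt] \left\lfloor \frac1k\binom{n}{r}\right\rfloor+k-2, & \text{otherwise.}\end{cases}$$ Furthermore, an $r$-graph $G$ on $n$ vertices is an extremal graph of $H$ if and only if either $G\in\mathcal{K}^r_{n,k}$, or $\binom{n}{r}\equiv k-2\pmod k$ and $G=K_n^r$.
   Context: An $r$-graph is an $r$-uniform hypergraph. For $r$-graphs $G$ and $H$, an $H$-decomposition of $G$ is a partition of the edge set $E(G)$ into parts such that each part is either a single edge or its edges form an $r$-graph isomorphic to $H$. $\phi_H^r(G)$ is the minimum number of parts in an $H$-decomposition of $G$, and $\phi_H^r(n)=\max\{\phi_H^r(G): G \text{ an } r\text{ -graph on } n \text{ vertices}\}$. An $r$-graph $G$ on $n$ vertices with $\phi_H^r(G)=\phi_H^r(n)$ is called an extremal graph of $H$. $K_n^r$ denotes the complete $r$-graph on $n$ vertices. For positive integers $n\ge r$ and $k$, let $\ell$ be the unique integer with $0\le \ell\le k-1$ such that $\binom{n}{r}-\ell\equiv k-1\pmod k$; $\mathcal{K}^r_{n,k}$ denotes the family of all $r$-graphs obtained from $K_n^r$ by deleting $\ell$ edges. -}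

module Defs where

open import Data.Nat using (ℕ; zero; suc; _+_; _*_; _∸_; _≤_; _<_; _≥_; NonZero)
open import Data.Nat.DivMod using (_/_; _%_)
open import Data.Nat.Combinatorics using (_C_)
open import Data.Bool using (Bool; true; false)
open import Data.Fin using (Fin)
open import Data.Fin.Subset using (Subset; _∈_; _∉_; ∣_∣)
open import Data.List using (List; length; concat; [_])
open import Data.List.Membership.Propositional renaming (_∈_ to _∈ₗ_; _∉_ to _∉ₗ_)
open import Data.List.Relation.Unary.Unique.Propositional using (Unique)
open import Data.List.Relation.Unary.All using (All)
open import Data.List.Relation.Unary.AllPairs using (AllPairs)
open import Data.Product using (Σ; ∃; ∃-syntax; _×_; _,_)
open import Data.Sum using (_⊎_)
open import Function using (Injective)
open import Function.Bundles using (_⇔_)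
open import Relation.Binary.PropositionalEquality using (_≡_)
open import Relation.Nullary using (yes; no)
open import Data.Nat using (_≟_)

record RGraph (r n : ℕ) : Set where
  field
    edge   : Subset n → Bool
    uniform : ∀ s → edge s ≡ true → ∣ s ∣ ≡ r
open RGraph public

IsEdge : ∀ {r n} → RGraph r n → Subset n → Set
IsEdge G s = edge G s ≡ true

Disjoint : ∀ {n} → Subset n → Subset n → Set
Disjoint s t = ∀ v → v ∈ s → v ∉ t

IsImage : ∀ {m n} → (Fin m → Fin n) → Subset m → Subset n → Set
IsImage f e s = ∀ v → (v ∈ s ⇔ (∃[ i ] (i ∈ e × f i ≡ v)))

FormsCopyOf : ∀ {r m n} → RGraph r m → List (Subset n) → Set
FormsCopyOf {m = m} {n = n} H P =
  Σ (Fin m → Fin n) λ f → Injective _≡_ _≡_ f ×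
    (∀ s → (s ∈ₗ P ⇔ (∃[ e ] (IsEdge H e × IsImage f e s))))

AllowedPart : ∀ {r m n} → RGraph r m → List (Subset n) → Set
AllowedPart H P = (∃[ e ] P ≡ [ e ]) ⊎ FormsCopyOf H P

record Decomposition {r m n} (H : RGraph r m) (G : RGraph r n) : Set where
  field
    parts    : List (List (Subset n))
    allowed  : All (AllowedPart H) parts
    distinct : Unique (concat parts)
    covers   : ∀ s → (s ∈ₗ concat parts ⇔ IsEdge G s)
open Decomposition public

IsPhi : ∀ {r m n} → RGraph r m → RGraph r n → ℕ → Set
IsPhi H G t = (Σ (Decomposition H G) λ D → length (parts D) ≡ t)
            × (∀ (D : Decomposition H G) → t ≤ length (parts D))

IsPhiN : ∀ {r m} → RGraph r m → ℕ → ℕ → Set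
IsPhiN {r} H n t = (Σ (RGraph r n) λ G → IsPhi H G t)
                 × (∀ (G : RGraph r n) t' → IsPhi H G t' → t' ≤ t)

Extremal : ∀ {r m n} → RGraph r m → RGraph r n → Set
Extremal {n = n} H G = ∃[ t ] (IsPhiN H n t × IsPhi H G t)

KDisjointEdges : ∀ {r m} → ℕ → RGraph r m → Set
KDisjointEdges {m = m} k H =
  Σ (List (Subset m)) λ Es → length Es ≡ k × Unique Es × AllPairs Disjoint Es
    × (∀ s → (s ∈ₗ Es ⇔ IsEdge H s))
    × (∀ (v : Fin m) → ∃[ e ] (e ∈ₗ Es × v ∈ e))

IsComplete : ∀ {r n} → RGraph r n → Set
IsComplete {r} G = ∀ s → (IsEdge G s ⇔ ∣ s ∣ ≡ r)

-- the family 𝒦^r_{n,k}: K_n^r minus ℓ edges, where 0 ≤ ℓ ≤ k-1 and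
-- C(n,r) - ℓ ≡ k-1 (mod k), i.e. C(n,r) ≡ ℓ + (k-1) (mod k)
InFamilyK : ∀ {r n} (k : ℕ) .{{_ : NonZero k}} → RGraph r n → Set
InFamilyK {r} {n} k G =
  Σ ℕ λ ℓ → ℓ < k × ℓ ≤ n C r × (n C r) % k ≡ (ℓ + (k ∸ 1)) % k ×
    Σ (List (Subset n)) λ L → length L ≡ ℓ × Unique L × All (λ s → ∣ s ∣ ≡ r) L
      × (∀ s → (IsEdge G s ⇔ (∣ s ∣ ≡ r × s ∉ₗ L)))

n₀ : ℕ → ℕ → ℕ
n₀ k r = k * r * (k + r ∸ 2) + 2 * r ∸ 1

phiValue : (n r k : ℕ) .{{_ : NonZero k}} → ℕ
phiValue n r k with (n C r) % k ≟ (k ∸ 1)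
... | yes _ = (n C r) / k + (k ∸ 1)
... | no _  = (n C r) / k + (k ∸ 2)

{-# OPTIONS --safe #-}
module Submission where

-- Let N = C(n,r), let G have e edges, and put q = k(k+r-2)+1 = kr+(k-1)², so that qr ≤ n.
-- A decomposition with a copies of H and b single edges has e = ka + b, hence at least
-- ⌊e/k⌋ + (e mod k) parts, and maximising this over e ≤ N gives the stated values of φ
-- and e. It remains to decompose G well.
--
-- Averaging: a family F of r-sets with at most s pairwise disjoint members satisfies q|F| ≤ sN.
-- Applied to the r-sets meeting a fixed edge f, their number c(f) satisfies q c(f) ≤ rN.
-- If c(f) ≤ ⌊e/k⌋ for all edges f, the Hajnal–Szemerédi theorem, applied to the graph of
-- intersecting pairs of edges, splits all but e mod k edges into k-matchings, so the lower bound
-- is attained. Otherwise e < k c(f) for some f. Remove k-matchings greedily; the averaging bound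
-- with s = k-1 controls the l leftover edges, and
-- qk(a+l) = qe + (k-1)ql < krN + (k-1)²N = qN,
-- so there are fewer than N/k parts, which is below the maximum.

open import Defs
open import Data.Bool using (Bool; true; false)
import Data.Bool.Properties as Bool
open import Data.Empty using (⊥; ⊥-elim)
open import Data.Fin as Fin using (Fin; zero; suc)
import Data.Fin.Properties as Fin
open import Data.Fin.Subset as Subset using (Subset; _─_; _-_; ∣_∣)
  renaming (_∈_ to _∈ˢ_; _∉_ to _∉ˢ_; _⊆_ to _⊆ˢ_)
import Data.Fin.Subset.Properties as Subset
open import Data.List using (List; []; _∷_; _++_; map; length; filter; concat; [_]; take; drop; upTo)
open import Data.List.Properties using (map-++; map-∘; length-map; length-++; ++-assoc; take++drop≡id;
  length-take; length-drop; length-upTo; concat-++; concat-map-[_])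
import Data.List.Membership.DecPropositional as DecMembership
open import Data.List.Membership.Propositional using (_∈_; _∉_; find; lose)
open import Data.List.Membership.Propositional.Properties hiding (∈-tabulate⁺; ∈-tabulate⁻)
open import Data.List.Membership.Propositional.Properties.WithK using (unique∧set⇒bag)
open import Data.List.Relation.Binary.BagAndSetEquality using (∼bag⇒↭)
import Data.List.Relation.Binary.Disjoint.Propositional as DisjointLists
open import Data.List.Relation.Binary.Permutation.Propositional using (_↭_; ↭-sym; ↭⇒↭ₛ)
import Data.List.Relation.Binary.Permutation.Propositional.Properties as Perm
import Data.List.Relation.Binary.Permutation.Setoid.Properties as PermS
open import Data.List.Relation.Unary.All as All using (All; []; _∷_; all?)
import Data.List.Relation.Unary.All.Properties as All
open import Data.List.Relation.Unary.AllPairs as AllPairs using (AllPairs; []; _∷_)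
import Data.List.Relation.Unary.AllPairs.Properties as AllPairsₚ
open import Data.List.Relation.Unary.Any using (Any; here; there; any?)
open import Data.List.Relation.Unary.Unique.Propositional using (Unique)
import Data.List.Relation.Unary.Unique.Propositional.Properties as Unique
open import Data.Nat
open import Data.Nat.Combinatorics using (_C_; nCk≡nC[n∸k]; nCn≡1; k>n⇒nCk≡0; nCk+nC[k+1]≡[n+1]C[k+1])
open import Data.Nat.Divisibility using (n∣m*n)
open import Data.Nat.DivMod hiding (result)
open import Data.Nat.ListAction using (sum)
open import Data.Nat.ListAction.Properties using (sum-++; sum-↭)
open import Data.Nat.Properties
open import Data.Nat.Solver using (module +-*-Solver)
open import Data.Product using (Σ; ∃-syntax; _×_; _,_; proj₁; proj₂)
open import Data.Sum using (_⊎_; inj₁; inj₂; [_,_]′)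
open import Data.Vec using ([]; _∷_; here; there; tabulate)
import Data.Vec.Properties as Vec
open import Function using (Injective; _∘_; id; case_of_)
open import Function.Bundles using (_⇔_; mk⇔; Equivalence)
open import Relation.Binary.Definitions using (DecidableEquality)
open import Relation.Binary.PropositionalEquality hiding ([_])
open import Relation.Nullary
open import Relation.Nullary.Decidable using (_×-dec_; ¬?; _→-dec_; decidable-stable)
open import Relation.Unary using () renaming (Decidable to Decidable₁)

-- The averaging inequality is what a random choice of q pairwise disjoint r-sets would give: each
-- of them is uniformly distributed, and at most s of them lie in F. Here it is obtained by
-- counting. The two summands of q mirror the final estimate: kr comes from the r-sets that meet f,
-- and (k-1)² from the leftover edges, each of which adds k-1 to k times the number of parts. The
-- estimate is strict because e < k c(f), so a graph of the second kind is never extremal, and being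
-- extremal depends on e alone. A merely proper colouring could waste edges in every class; an
-- equitable one, with ⌊e/k⌋ classes of exactly k edges, leaves only e mod k single edges. It is
-- constructed by the method of Kierstead and Kostochka. A surplus vertex has to be carried to a
-- deficient class by a chain of moves of single vertices. When no chain exists, a swap along a solo
-- edge, combined with an equitable colouring by fewer colours, either completes the colouring or
-- makes more classes accessible.

private variable
  A₁ A₂ P₁ P₂ : Set
  n : ℕ

-- Sums and counting over lists

⟦_⟧ : Dec P₁ → ℕ
⟦ yes _ ⟧ = 1
⟦ no _  ⟧ = 0

⟦⟧-yes : (d : Dec P₁) → P₁ → ⟦ d ⟧ ≡ 1
⟦⟧-yes (yes _) _ = refl
⟦⟧-yes (no ¬p) p = contradiction p ¬p

⟦⟧-no : (d : Dec P₁) → ¬ P₁ → ⟦ d ⟧ ≡ 0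
⟦⟧-no (yes p) ¬p = contradiction p ¬p
⟦⟧-no (no _)  _  = refl

⟦⟧-mono : (d : Dec P₁) (e : Dec P₂) → (P₁ → P₂) → ⟦ d ⟧ ≤ ⟦ e ⟧
⟦⟧-mono (yes p) e f = ≤-reflexive (sym (⟦⟧-yes e (f p)))
⟦⟧-mono (no _)  e f = z≤n

⟦⟧-cong : (d : Dec P₁) (e : Dec P₂) → (P₁ → P₂) → (P₂ → P₁) → ⟦ d ⟧ ≡ ⟦ e ⟧
⟦⟧-cong d e f g = ≤-antisym (⟦⟧-mono d e f) (⟦⟧-mono e d g)

⟦⟧≤1 : (d : Dec P₁) → ⟦ d ⟧ ≤ 1
⟦⟧≤1 (yes _) = ≤-refl
⟦⟧≤1 (no _)  = z≤n

⟦⟧-× : (d : Dec P₁) (e : Dec P₂) → ⟦ d ×-dec e ⟧ ≡ ⟦ d ⟧ * ⟦ e ⟧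
⟦⟧-× (yes _) (yes _) = refl
⟦⟧-× (yes _) (no _)  = refl
⟦⟧-× (no _)  e       = refl

⟦⟧*-mono : (d : Dec P₁) {m n : ℕ} → (P₁ → m ≤ n) → ⟦ d ⟧ * m ≤ ⟦ d ⟧ * n
⟦⟧*-mono (yes p) f = +-monoˡ-≤ 0 (f p)
⟦⟧*-mono (no _)  f = z≤n

∑ : List A₁ → (A₁ → ℕ) → ℕ
∑ xs f = sum (map f xs)

∑-cong : (xs : List A₁) {f g : A₁ → ℕ} → (∀ {x} → x ∈ xs → f x ≡ g x) → ∑ xs f ≡ ∑ xs g
∑-cong []       eq = refl
∑-cong (x ∷ xs) eq = cong₂ _+_ (eq (here refl)) (∑-cong xs (eq ∘ there))

∑-mono : (xs : List A₁) {f g : A₁ → ℕ} → (∀ {x} → x ∈ xs → f x ≤ g x) → ∑ xs f ≤ ∑ xs g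
∑-mono []       le = z≤n
∑-mono (x ∷ xs) le = +-mono-≤ (le (here refl)) (∑-mono xs (le ∘ there))

interchange : ∀ a b c d → (a + b) + (c + d) ≡ (a + c) + (b + d)
interchange a b c d = trans (+-assoc a b (c + d))
  (trans (cong (a +_) (trans (sym (+-assoc b c d)) (trans (cong (_+ d) (+-comm b c)) (+-assoc c b d))))
         (sym (+-assoc a c (b + d))))

∑-+ : (xs : List A₁) (f g : A₁ → ℕ) → ∑ xs (λ x → f x + g x) ≡ ∑ xs f + ∑ xs g
∑-+ []       f g = refl
∑-+ (x ∷ xs) f g = trans (cong (f x + g x +_) (∑-+ xs f g)) (interchange (f x) (g x) _ _)

∑-*ˡ : (a : ℕ) (xs : List A₁) (f : A₁ → ℕ) → ∑ xs (λ x → a * f x) ≡ a * ∑ xs f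
∑-*ˡ a []       f = sym (*-zeroʳ a)
∑-*ˡ a (x ∷ xs) f = trans (cong (a * f x +_) (∑-*ˡ a xs f)) (sym (*-distribˡ-+ a (f x) _))

∑-*ʳ : (a : ℕ) (xs : List A₁) (f : A₁ → ℕ) → ∑ xs (λ x → f x * a) ≡ ∑ xs f * a
∑-*ʳ a xs f = trans (∑-cong xs (λ {x} _ → *-comm (f x) a)) (trans (∑-*ˡ a xs f) (*-comm a _))

∑-const : (xs : List A₁) (a : ℕ) → ∑ xs (λ _ → a) ≡ length xs * a
∑-const []       a = refl
∑-const (x ∷ xs) a = cong (a +_) (∑-const xs a)

∑-swap : (xs : List A₁) (ys : List A₂) (f : A₁ → A₂ → ℕ) →
         ∑ xs (λ x → ∑ ys (f x)) ≡ ∑ ys (λ y → ∑ xs (λ x → f x y))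
∑-swap []       ys f = sym (trans (∑-const ys 0) (*-zeroʳ (length ys)))
∑-swap (x ∷ xs) ys f = trans (cong (∑ ys (f x) +_) (∑-swap xs ys f)) (sym (∑-+ ys (f x) _))

∑-++ : (xs ys : List A₁) (f : A₁ → ℕ) → ∑ (xs ++ ys) f ≡ ∑ xs f + ∑ ys f
∑-++ xs ys f = trans (cong sum (map-++ f xs ys)) (sum-++ (map f xs) (map f ys))

∑-↭ : {xs ys : List A₁} (f : A₁ → ℕ) → xs ↭ ys → ∑ xs f ≡ ∑ ys f
∑-↭ f p = sum-↭ (Perm.map⁺ f p)

≤∑ : {xs : List A₁} (f : A₁ → ℕ) {x : A₁} → x ∈ xs → f x ≤ ∑ xs f
≤∑ {xs = y ∷ xs} f (here refl) = m≤m+n (f y) _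
≤∑ {xs = y ∷ xs} f (there p)   = ≤-trans (≤∑ f p) (m≤n+m _ (f y))

+≤∑ : {xs : List A₁} (f : A₁ → ℕ) {x y : A₁} → x ∈ xs → y ∈ xs → x ≢ y → f x + f y ≤ ∑ xs f
+≤∑ f (here refl) (here refl) x≢y = contradiction refl x≢y
+≤∑ f (here refl) (there q)   x≢y = +-monoʳ-≤ _ (≤∑ f q)
+≤∑ f {x} {y} (there p) (here refl) x≢y = ≤-trans (≤-reflexive (+-comm (f x) (f y))) (+-monoʳ-≤ _ (≤∑ f p))
+≤∑ f (there p)   (there q)   x≢y = ≤-trans (+≤∑ f p q x≢y) (m≤n+m _ _)

unique-⇔⇒↭ : {xs ys : List A₁} → Unique xs → Unique ys →
             (∀ {x} → x ∈ xs → x ∈ ys) → (∀ {x} → x ∈ ys → x ∈ xs) → xs ↭ ys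
unique-⇔⇒↭ u v f g = ∼bag⇒↭ (unique∧set⇒bag u v (mk⇔ f g))

length-filter-∑ : {P : A₁ → Set} (P? : Decidable₁ P) (xs : List A₁) →
                  length (filter P? xs) ≡ ∑ xs (λ x → ⟦ P? x ⟧)
length-filter-∑ P? []       = refl
length-filter-∑ P? (x ∷ xs) with P? x
... | yes _ = cong suc (length-filter-∑ P? xs)
... | no _  = length-filter-∑ P? xs

module _ (_≟_ : DecidableEquality A₁) where
  open DecMembership _≟_ using (_∈?_)

  ∑-indicator : {xs : List A₁} → Unique xs → ∀ y → ∑ xs (λ x → ⟦ y ≟ x ⟧) ≡ ⟦ y ∈? xs ⟧
  ∑-indicator {[]}     []       y = refl
  ∑-indicator {x ∷ xs} (x∉ ∷ u) y = trans (cong (⟦ y ≟ x ⟧ +_) (∑-indicator u y)) (split (y ≟ x))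
    where
    split : (d : Dec (y ≡ x)) → ⟦ d ⟧ + ⟦ y ∈? xs ⟧ ≡ ⟦ y ∈? (x ∷ xs) ⟧
    split (no y≢x) = ⟦⟧-cong (y ∈? xs) (y ∈? (x ∷ xs)) there
      λ { (here p) → contradiction p y≢x ; (there p) → p }
    split (yes refl) = trans (cong suc (⟦⟧-no (y ∈? xs) λ p → All.lookup x∉ p refl))
      (sym (⟦⟧-yes (y ∈? (y ∷ xs)) (here refl)))

  ⊆⇒length≤ : {xs ys : List A₁} → Unique xs → (∀ {x} → x ∈ xs → x ∈ ys) → length xs ≤ length ys
  ⊆⇒length≤ {xs} {ys} u f = begin
    length xs                              ≡⟨ *-identityʳ _ ⟨
    length xs * 1                          ≡⟨ ∑-const xs 1 ⟨
    ∑ xs (λ _ → 1)                         ≤⟨ ∑-mono xs (λ x∈ → ≤-trans (≤-reflexive (sym (⟦⟧-yes (_ ≟ _) refl))) (≤∑ (λ y → ⟦ y ≟ _ ⟧) (f x∈))) ⟩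
    ∑ xs (λ x → ∑ ys (λ y → ⟦ y ≟ x ⟧))    ≡⟨ ∑-swap xs ys _ ⟩
    ∑ ys (λ y → ∑ xs (λ x → ⟦ y ≟ x ⟧))    ≤⟨ ∑-mono ys (λ {y} _ → ≤-trans (≤-reflexive (∑-indicator u y)) (⟦⟧≤1 (y ∈? xs))) ⟩
    ∑ ys (λ _ → 1)                         ≡⟨ ∑-const ys 1 ⟩
    length ys * 1                          ≡⟨ *-identityʳ _ ⟩
    length ys                              ∎
    where open ≤-Reasoning

∑-filter : {P : A₁ → Set} (P? : Decidable₁ P) (xs : List A₁) (f : A₁ → ℕ) →
           ∑ (filter P? xs) f ≡ ∑ xs (λ x → ⟦ P? x ⟧ * f x)
∑-filter P? []       f = refl
∑-filter P? (x ∷ xs) f with P? x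
... | yes _ = cong₂ _+_ (sym (+-identityʳ (f x))) (∑-filter P? xs f)
... | no _  = ∑-filter P? xs f

-- Both exceptional values are added, so that no subtraction occurs. It is applied to the indicators
-- of a colour class before and after one vertex is recoloured.
∑-exchange : {xs : List A₁} → Unique xs → (f g : A₁ → ℕ) {x : A₁} → x ∈ xs →
             (∀ {y} → y ∈ xs → y ≢ x → f y ≡ g y) → ∑ xs f + g x ≡ ∑ xs g + f x
∑-exchange {xs = x ∷ xs} (x∉ ∷ u) f g (here refl) eq = begin
  f x + ∑ xs f + g x   ≡⟨ cong (λ s → f x + s + g x) (∑-cong xs λ y∈ → eq (there y∈) λ { refl → All.lookup x∉ y∈ refl }) ⟩
  f x + ∑ xs g + g x   ≡⟨ +-assoc (f x) _ _ ⟩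
  f x + (∑ xs g + g x) ≡⟨ +-comm (f x) _ ⟩
  ∑ xs g + g x + f x   ≡⟨ cong (_+ f x) (+-comm _ (g x)) ⟩
  g x + ∑ xs g + f x   ∎
  where open ≡-Reasoning
∑-exchange {xs = x ∷ xs} (x∉ ∷ u) f g {y} (there y∈) eq = begin
  f x + ∑ xs f + g y   ≡⟨ +-assoc (f x) _ _ ⟩
  f x + (∑ xs f + g y) ≡⟨ cong₂ _+_ (eq (here refl) λ { refl → All.lookup x∉ y∈ refl })
                                    (∑-exchange u f g y∈ λ z∈ → eq (there z∈)) ⟩
  g x + (∑ xs g + f y) ≡⟨ +-assoc (g x) _ _ ⟨
  g x + ∑ xs g + f y   ∎
  where open ≡-Reasoning

∑-⟦⟧≤1 : {P : A₁ → Set} (P? : Decidable₁ P) {xs : List A₁} →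
         AllPairs (λ x y → P x → P y → ⊥) xs → ∑ xs (λ x → ⟦ P? x ⟧) ≤ 1
∑-⟦⟧≤1 P? [] = z≤n
∑-⟦⟧≤1 P? {x ∷ xs} (px ∷ ps) with P? x
... | no _  = ∑-⟦⟧≤1 P? ps
... | yes p = ≤-reflexive (cong suc (trans (∑-cong xs λ {y} y∈ → ⟦⟧-no (P? y) (All.lookup px y∈ p))
                (trans (∑-const xs 0) (*-zeroʳ (length xs)))))

partition-⊎ : {P Q : A₁ → Set} {xs : List A₁} → (∀ {x} → x ∈ xs → P x ⊎ Q x) →
              (∀ {x} → x ∈ xs → P x) ⊎ (∃[ x ] (x ∈ xs × Q x))
partition-⊎ {xs = []}     f = inj₁ λ ()
partition-⊎ {P = P} {Q} {x ∷ xs} f with f (here refl) | partition-⊎ {P = P} {Q} (f ∘ there)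
... | inj₂ q | _             = inj₂ (x , here refl , q)
... | inj₁ _ | inj₂ (y , y∈ , q) = inj₂ (y , there y∈ , q)
... | inj₁ p | inj₁ ps       = inj₁ λ { (here refl) → p ; (there x∈) → ps x∈ }

-- The bookkeeping for recolouring one vertex: `w`, `x` and `m` are indicators of the old, the new
-- and the deficient colour, and the surplus passes from the old colour to the new one.
exchange-count : ∀ a b k m w x → a + w ≡ b + x → b + m ≡ k + w → a + m ≡ k + x
exchange-count a b k m w x p q = +-cancelʳ-≡ w _ _ (begin
  a + m + w ≡⟨ swapʳ a m w ⟩
  a + w + m ≡⟨ cong (_+ m) p ⟩
  b + x + m ≡⟨ swapʳ b x m ⟩
  b + m + x ≡⟨ cong (_+ x) q ⟩
  k + w + x ≡⟨ swapʳ k w x ⟩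
  k + x + w ∎)
  where
  open ≡-Reasoning
  swapʳ : ∀ a b d → a + b + d ≡ a + d + b
  swapʳ a b d = trans (+-assoc a b d) (trans (cong (a +_) (+-comm b d)) (sym (+-assoc a d b)))

-- Equitable colourings

record Graph (X : Set) : Set₁ where
  field
    Adj  : X → X → Set
    adj? : ∀ x y → Dec (Adj x y)
    symm : ∀ {x y} → Adj x y → Adj y x
    irr  : ∀ {x} → ¬ Adj x x

module Colouring {X : Set} (_≟ˣ_ : DecidableEquality X) (k : ℕ) where

  open DecMembership _≟_ using (_∈?_; _∉?_)

  _[_↦_] : (X → ℕ) → X → ℕ → X → ℕ
  (c [ x ↦ i ]) y with y ≟ˣ x
  ... | yes _ = i
  ... | no _  = c y

  update-same : ∀ c x {i} → (c [ x ↦ i ]) x ≡ i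
  update-same c x with x ≟ˣ x
  ... | yes _  = refl
  ... | no x≢x = contradiction refl x≢x

  update-other : ∀ c {x i y} → y ≢ x → (c [ x ↦ i ]) y ≡ c y
  update-other c {x} {y = y} y≢x with y ≟ˣ x
  ... | yes y≡x = contradiction y≡x y≢x
  ... | no _    = refl

  module _ (G : Graph X) where
    open Graph G

    degree : List X → X → ℕ
    degree xs x = ∑ xs λ y → ⟦ adj? x y ⟧

    -- The colours form an arbitrary list, because the induction colours part of the vertices with a
    -- subset of the colours and then merges the result with an older colouring.
    record Equitable (cs : List ℕ) (xs : List X) : Set where
      field
        col    : X → ℕ
        col∈   : ∀ {x} → x ∈ xs → col x ∈ cs
        proper : ∀ {x y} → x ∈ xs → y ∈ xs → Adj x y → col x ≢ col y
        count  : ∀ {i} → i ∈ cs → ∑ xs (λ x → ⟦ col x ≟ i ⟧) ≡ k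

    HasEquitable : List ℕ → Set
    HasEquitable cs = ∀ {xs} → Unique xs → length xs ≡ length cs * k →
      (∀ {x} → x ∈ xs → degree xs x < length cs) → Equitable cs xs

    -- Neighbours by colour

    module Neighbours (xs : List X) where

      nb : (X → ℕ) → ℕ → X → ℕ
      nb c i x = ∑ xs λ v → ⟦ adj? x v ⟧ * ⟦ c v ≟ i ⟧

      Free : (X → ℕ) → X → ℕ → Set
      Free c x i = All (λ v → Adj x v → c v ≢ i) xs

      free? : ∀ c x i → Dec (Free c x i)
      free? c x i = all? (λ v → adj? x v →-dec ¬? (c v ≟ i)) xs

      ¬Free⇒neighbour : ∀ {c : X → ℕ} {x i} → ¬ Free c x i → ∃[ v ] (v ∈ xs × Adj x v × c v ≡ i)
      ¬Free⇒neighbour {c} {x} {i} ¬free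
        with find (All.¬All⇒Any¬ (λ v → adj? x v →-dec ¬? (c v ≟ i)) xs ¬free)
      ... | v , v∈ , ¬v with adj? x v | c v ≟ i
      ...   | no ¬a | _       = contradiction (λ a → contradiction a ¬a) ¬v
      ...   | yes a | no c≢   = contradiction (λ _ → c≢) ¬v
      ...   | yes a | yes c≡i = v , v∈ , a , c≡i

      nb-term : ∀ {c : X → ℕ} {x i v} → Adj x v → c v ≡ i → 1 ≤ ⟦ adj? x v ⟧ * ⟦ c v ≟ i ⟧
      nb-term {c} {x} {i} {v} a eq =
        ≤-reflexive (sym (cong₂ _*_ (⟦⟧-yes (adj? x v) a) (⟦⟧-yes (c v ≟ i) eq)))

      ¬Free⇒nb : ∀ {c : X → ℕ} {x i} → ¬ Free c x i → 1 ≤ nb c i x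
      ¬Free⇒nb {c} {x} {i} ¬free =
        let v , v∈ , a , eq = ¬Free⇒neighbour {c} ¬free
        in ≤-trans (nb-term {c} a eq) (≤∑ (λ u → ⟦ adj? x u ⟧ * ⟦ c u ≟ i ⟧) v∈)

      ∑nb : ∀ c {L} → Unique L → ∀ x →
            ∑ L (λ i → nb c i x) ≡ ∑ xs (λ v → ⟦ adj? x v ⟧ * ⟦ c v ∈? L ⟧)
      ∑nb c {L} u x = begin
        ∑ L (λ i → nb c i x)                                    ≡⟨ ∑-swap L xs _ ⟩
        ∑ xs (λ v → ∑ L λ i → ⟦ adj? x v ⟧ * ⟦ c v ≟ i ⟧)       ≡⟨ ∑-cong xs (λ {v} _ → ∑-*ˡ ⟦ adj? x v ⟧ L _) ⟩
        ∑ xs (λ v → ⟦ adj? x v ⟧ * ∑ L λ i → ⟦ c v ≟ i ⟧)       ≡⟨ ∑-cong xs (λ {v} _ → cong (⟦ adj? x v ⟧ *_) (∑-indicator _≟_ u (c v))) ⟩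
        ∑ xs (λ v → ⟦ adj? x v ⟧ * ⟦ c v ∈? L ⟧)                ∎
        where open ≡-Reasoning

      ∑nb≤degree : ∀ c {L} → Unique L → ∀ x → ∑ L (λ i → nb c i x) ≤ degree xs x
      ∑nb≤degree c {L} u x = ≤-trans (≤-reflexive (∑nb c u x))
        (∑-mono xs λ {v} _ → ≤-trans (*-monoʳ-≤ ⟦ adj? x v ⟧ (⟦⟧≤1 (c v ∈? L))) (≤-reflexive (*-identityʳ _)))

      -- Pigeonhole: if no colour of `L` were free, each would account for a separate neighbour of
      -- `x`.
      free-colour : ∀ c {L} → Unique L → ∀ x → degree xs x < length L → ∃[ i ] (i ∈ L × Free c x i)
      free-colour c {L} u x deg< with any? (free? c x) L
      ... | yes p = find p
      ... | no ¬p = contradiction (≤-trans many (∑nb≤degree c u x)) (<⇒≱ deg<)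
        where
        many : length L ≤ ∑ L (λ i → nb c i x)
        many = begin
          length L               ≡⟨ *-identityʳ _ ⟨
          length L * 1           ≡⟨ ∑-const L 1 ⟨
          ∑ L (λ _ → 1)          ≤⟨ ∑-mono L (λ i∈ → ¬Free⇒nb {c} λ fr → ¬p (lose i∈ fr)) ⟩
          ∑ L (λ i → nb c i x)   ∎
          where open ≤-Reasoning

    -- Colour classes, moves between them and accessible colours

    module Classes (xs : List X) where
      open Neighbours xs

      cnt : (X → ℕ) → ℕ → ℕ
      cnt c i = ∑ xs λ x → ⟦ c x ≟ i ⟧

      -- The auxiliary digraph on the colours: an edge from `i` to `j` means that some vertex of
      -- class `i` can be moved to class `j`.
      Edge : (X → ℕ) → ℕ → ℕ → Set
      Edge c i j = Any (λ x → c x ≡ i × Free c x j) xs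

      edge? : ∀ c i j → Dec (Edge c i j)
      edge? c i j = any? (λ x → (c x ≟ i) ×-dec free? c x j) xs

      cnt-update : Unique xs → ∀ c {x} i j → x ∈ xs →
                   cnt (c [ x ↦ i ]) j + ⟦ c x ≟ j ⟧ ≡ cnt c j + ⟦ i ≟ j ⟧
      cnt-update u c {x} i j x∈ = trans
        (∑-exchange u (λ y → ⟦ (c [ x ↦ i ]) y ≟ j ⟧) (λ y → ⟦ c y ≟ j ⟧) x∈
          λ _ y≢x → cong (λ a → ⟦ a ≟ j ⟧) (update-other c y≢x))
        (cong (λ a → cnt c j + ⟦ a ≟ j ⟧) (update-same c x))

      -- The class of i⁻ lacks one vertex and that of i⁺ has one too many; if i⁻ = i⁺, the
      -- colouring is equitable.
      record NearEquitable (cs : List ℕ) (i⁻ i⁺ : ℕ) (c : X → ℕ) : Set where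
        field
          i⁻∈    : i⁻ ∈ cs
          i⁺∈    : i⁺ ∈ cs
          col∈   : ∀ {x} → x ∈ xs → c x ∈ cs
          proper : ∀ {x y} → x ∈ xs → y ∈ xs → Adj x y → c x ≢ c y
          count  : ∀ {i} → i ∈ cs → cnt c i + ⟦ i⁻ ≟ i ⟧ ≡ k + ⟦ i⁺ ≟ i ⟧

      -- Paths are simple, so that a move along the first edge does not disturb the later ones. The
      -- list omits the starting colour.
      data Path (c : X → ℕ) (i⁻ : ℕ) : ℕ → List ℕ → Set where
        end  : Path c i⁻ i⁻ []
        step : ∀ {i j js} → Edge c i j → i ∉ j ∷ js → Path c i⁻ j js → Path c i⁻ i (j ∷ js)

      -- Sets of accessible colours, each added with an edge to one already present.
      data Acc (c : X → ℕ) (i⁻ : ℕ) : List ℕ → Set where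
        base : Acc c i⁻ (i⁻ ∷ [])
        add  : ∀ {i j S} → i ∉ S → j ∈ S → Edge c i j → Acc c i⁻ S → Acc c i⁻ (i ∷ S)

      acc-unique : ∀ {c i⁻ S} → Acc c i⁻ S → Unique S
      acc-unique base            = [] ∷ []
      acc-unique (add i∉ _ _ ac) = All.tabulate (λ { j∈ refl → i∉ j∈ }) ∷ acc-unique ac

      acc-root : ∀ {c i⁻ S} → Acc c i⁻ S → i⁻ ∈ S
      acc-root base           = here refl
      acc-root (add _ _ _ ac) = there (acc-root ac)

      acc-path : ∀ {c i⁻ S i} → Acc c i⁻ S → i ∈ S → ∃[ js ] (Path c i⁻ i js × (∀ {j} → j ∈ js → j ∈ S))
      acc-path base (here refl) = [] , end , λ ()
      acc-path (add i∉ j∈ e ac) (here refl) =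
        let js , p , js⊆ = acc-path ac j∈
        in _ ∷ js , step e (λ { (here refl) → i∉ j∈ ; (there i∈) → i∉ (js⊆ i∈) }) p ,
           λ { (here refl) → there j∈ ; (there m) → there (js⊆ m) }
      acc-path (add i∉ j∈ e ac) (there i∈) =
        let js , p , js⊆ = acc-path ac i∈ in js , p , there ∘ js⊆

      path-simple : ∀ {c i⁻ i js} → Path c i⁻ i js → i ∉ js
      path-simple end          ()
      path-simple (step _ i∉ _) = i∉

      -- The edges that made the colours of `S` accessible lead from `i` to `i⁻`, and somewhere on
      -- the way they enter `L`.
      acc-exit : ∀ {c i⁻ S L i} → Acc c i⁻ S → i⁻ ∈ L → i ∈ S → i ∉ L →
                 ∃[ l ] ∃[ j ] (l ∈ S × l ∉ L × j ∈ L × Edge c l j)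
      acc-exit base r∈ (here refl) i∉ = contradiction r∈ i∉
      acc-exit {L = L} (add {l} {j} l∉ j∈ e ac) r∈ i∈ i∉ with l ∈? L | j ∈? L
      ... | no l∉L | yes j∈L = l , j , here refl , l∉L , j∈L , e
      ... | no l∉L | no j∉L  = let l′ , j′ , l′∈ , rest = acc-exit ac r∈ j∈ j∉L in l′ , j′ , there l′∈ , rest
      ... | yes l∈L | _ with i∈
      ...   | here refl = contradiction l∈L i∉
      ...   | there i∈′ = let l′ , j′ , l′∈ , rest = acc-exit ac r∈ i∈′ i∉ in l′ , j′ , there l′∈ , rest

      -- The witness has to stay in class `i`, and class `j` must not gain vertices. Gains of class
      -- `i` and losses of class `j` are harmless.
      edge-transfer : ∀ {c c′ i j} → Edge c i j →
        (∀ {v} → v ∈ xs → c v ≡ i → c′ v ≡ i) → (∀ {v} → v ∈ xs → c′ v ≡ j → c v ≡ j) → Edge c′ i j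
      edge-transfer e f g with find e
      ... | x , x∈ , cx , fr = lose x∈ (f x∈ cx ,
        All.tabulate λ v∈ a c′v → All.lookup fr v∈ a (g v∈ c′v))

      -- No edge of a simple path enters its first class, so that class may gain vertices; hence the
      -- second hypothesis concerns `js` only.
      path-transfer : ∀ {c c′ i⁻ i js} → Path c i⁻ i js →
        (∀ {v} → v ∈ xs → c v ∈ i ∷ js → c′ v ≡ c v) →
        (∀ {v} → v ∈ xs → c′ v ∈ js → c′ v ≡ c v) → Path c′ i⁻ i js
      path-transfer end f g = end
      path-transfer (step e i∉ p) f g = step
        (edge-transfer e (λ { v∈ refl → f v∈ (here refl) }) (λ { v∈ refl → sym (g v∈ (here refl)) }))
        i∉ (path-transfer p (λ v∈ m → f v∈ (there m)) (λ v∈ m → g v∈ (there m)))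

      acc-transfer : ∀ {c c′ i⁻ S} → Acc c i⁻ S →
        (∀ {v} → v ∈ xs → c v ∈ S → c′ v ≡ c v) →
        (∀ {v} → v ∈ xs → c′ v ∈ S → c′ v ≡ c v) → Acc c′ i⁻ S
      acc-transfer base f g = base
      acc-transfer {c} {c′} (add i∉ j∈ e ac) f g = add i∉ j∈
        (edge-transfer e (λ { v∈ refl → f v∈ (here refl) })
          (λ { v∈ refl → sym (g v∈ (there j∈)) }))
        (acc-transfer ac (λ v∈ m → f v∈ (there m)) (λ v∈ m → g v∈ (there m)))

      -- Moving one vertex along each edge of a path from the large to the small class.
      shift : Unique xs → ∀ {cs i⁻ i js c} → NearEquitable cs i⁻ i c → Path c i⁻ i js →
              (∀ {j} → j ∈ js → j ∈ cs) → Equitable cs xs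
      shift u {cs} {c = c} ne end js⊆ = record
        { col = c ; col∈ = col∈ ; proper = proper
        ; count = λ i∈ → +-cancelʳ-≡ _ _ _ (count i∈) }
        where open NearEquitable ne
      shift u {cs} {i⁻} {i} {j ∷ js} {c} ne (step e i∉ p) js⊆ with find e
      ... | x , x∈ , cx , fr = shift u ne′ p′ (js⊆ ∘ there)
        where
        open NearEquitable ne
        c′ = c [ x ↦ j ]
        col∈′ : ∀ {v} → v ∈ xs → c′ v ∈ cs
        col∈′ {v} v∈ with v ≟ˣ x
        ... | yes _ = js⊆ (here refl)
        ... | no _  = col∈ v∈
        proper′ : ∀ {v w} → v ∈ xs → w ∈ xs → Adj v w → c′ v ≢ c′ w
        proper′ {v} {w} v∈ w∈ a with v ≟ˣ x | w ≟ˣ x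
        ... | yes refl | yes refl = λ _ → irr a
        ... | yes refl | no _     = λ eq → All.lookup fr w∈ a (sym eq)
        ... | no _     | yes refl = λ eq → All.lookup fr v∈ (symm a) eq
        ... | no _     | no _     = proper v∈ w∈ a
        count′ : ∀ {l} → l ∈ cs → cnt c′ l + ⟦ i⁻ ≟ l ⟧ ≡ k + ⟦ j ≟ l ⟧
        count′ {l} l∈ = exchange-count (cnt c′ l) (cnt c l) k ⟦ i⁻ ≟ l ⟧ ⟦ i ≟ l ⟧ ⟦ j ≟ l ⟧
          (subst (λ a → cnt c′ l + ⟦ a ≟ l ⟧ ≡ cnt c l + ⟦ j ≟ l ⟧) cx (cnt-update u c j l x∈)) (count l∈)
        ne′ : NearEquitable cs i⁻ j c′
        ne′ = record { i⁻∈ = i⁻∈ ; i⁺∈ = js⊆ (here refl) ; col∈ = col∈′ ; proper = proper′ ; count = count′ }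
        -- Only `x` has changed colour. It left class `i`, which the path does not revisit, and
        -- joined the first class of the remaining path, which is allowed to gain.
        p′ : Path c′ i⁻ j js
        p′ = path-transfer p
          (λ {v} _ cv∈ → update-other c λ { refl → i∉ (subst (_∈ j ∷ js) cx cv∈) })
          (λ {v} _ cv∈ → update-other c λ { refl → path-simple p (subst (_∈ js) (update-same c x) cv∈) })

      -- The colours that reach `i⁻` inside `vs`. With all colours as `vs` this is the full
      -- accessible set; with one colour left out it tests whether other colours depend on that one.
      record Closure (c : X → ℕ) (i⁻ : ℕ) (vs S : List ℕ) : Set where
        field
          set    : List ℕ
          acc    : Acc c i⁻ set
          ⊇S     : ∀ {i} → i ∈ S → i ∈ set
          ⊆vs    : ∀ {i} → i ∈ set → i ∈ vs
          closed : ∀ {i j} → i ∈ vs → i ∉ set → j ∈ set → ¬ Edge c i j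

      -- The set grows by one new colour of `vs` per round, so `fuel` need only bound the number of
      -- colours of `vs` still missing.
      saturate : ∀ {c i⁻ vs S} fuel → length vs ≤ fuel + length S → Acc c i⁻ S →
                 (∀ {i} → i ∈ S → i ∈ vs) → Closure c i⁻ vs S
      saturate {c} {i⁻} {vs} {S} fuel len ac S⊆
        with any? (λ i → (i ∉? S) ×-dec any? (edge? c i) S) vs
      ... | no ¬p = record
        { set = S ; acc = ac ; ⊇S = id ; ⊆vs = S⊆
        ; closed = λ i∈ i∉ j∈ e → ¬p (lose i∈ (i∉ , lose j∈ e)) }
      ... | yes p with find p
      ...   | i , i∈ , i∉ , es with find es
      ...     | j , j∈ , e = go fuel len
        where
        ac′ : Acc c i⁻ (i ∷ S)
        ac′ = add i∉ j∈ e ac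
        S⊆′ : ∀ {l} → l ∈ i ∷ S → l ∈ vs
        S⊆′ (here refl) = i∈
        S⊆′ (there l∈)  = S⊆ l∈
        go : ∀ fuel → length vs ≤ fuel + length S → Closure c i⁻ vs S
        go zero    len = contradiction (≤-trans (⊆⇒length≤ _≟_ (acc-unique ac′) S⊆′) len) 1+n≰n
        go (suc f) len = record { set = Cl.set ; acc = Cl.acc ; ⊇S = Cl.⊇S ∘ there ; ⊆vs = Cl.⊆vs ; closed = Cl.closed }
          where module Cl = Closure (saturate f (≤-trans len (≤-reflexive (sym (+-suc f _)))) ac′ S⊆′)

      -- One round of the Kierstead-Kostochka argument

      module Improve (u : Unique xs) {cs : List ℕ} (ucs : Unique cs)
        (deg< : ∀ {x} → x ∈ xs → degree xs x < length cs)
        (ih : ∀ {cs′} → Unique cs′ → length cs′ < length cs → HasEquitable cs′) where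

        -- The deficient colour stays fixed while the surplus colour may change. The size of the
        -- accessible set is the measure that bounds the number of rounds.
        Progress : ℕ → List ℕ → Set
        Progress i⁻ A = Equitable cs xs ⊎ (∃[ c ] ∃[ i ] ∃[ S ] (NearEquitable cs i⁻ i c ×
          Acc c i⁻ S × (∀ {j} → j ∈ S → j ∈ cs) × suc (length A) ≤ length S))

        -- The obstructed case: `A` is the whole accessible set and misses the surplus colour. No
        -- vertex outside the classes of `A` can then be moved into one of them, so it has a
        -- neighbour in each.
        module Closed {c i⁻ i⁺ A} (ne : NearEquitable cs i⁻ i⁺ c) (accA : Acc c i⁻ A)
          (A⊆ : ∀ {i} → i ∈ A → i ∈ cs)
          (closed : ∀ {i j} → i ∈ cs → i ∉ A → j ∈ A → ¬ Edge c i j) (i⁺∉ : i⁺ ∉ A) where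

          open NearEquitable ne

          Bc : List ℕ
          Bc = filter (_∉? A) cs

          B : List X
          B = filter (λ v → c v ∈? Bc) xs

          uA : Unique A
          uA = acc-unique accA

          uBc : Unique Bc
          uBc = Unique.filter⁺ (_∉? A) ucs

          uB : Unique B
          uB = Unique.filter⁺ (λ v → c v ∈? Bc) u

          Bc∉A : ∀ {i} → i ∈ Bc → i ∉ A
          Bc∉A i∈ = proj₂ (∈-filter⁻ (_∉? A) {xs = cs} i∈)

          Bc⊆cs : ∀ {i} → i ∈ Bc → i ∈ cs
          Bc⊆cs i∈ = proj₁ (∈-filter⁻ (_∉? A) {xs = cs} i∈)

          Bc⁺ : ∀ {i} → i ∈ cs → i ∉ A → i ∈ Bc
          Bc⁺ = ∈-filter⁺ (_∉? A)

          A∉Bc : ∀ {i} → i ∈ A → i ∉ Bc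
          A∉Bc i∈ i∈B = Bc∉A i∈B i∈

          B⁻ : ∀ {v} → v ∈ B → v ∈ xs × c v ∈ Bc
          B⁻ = ∈-filter⁻ (λ v → c v ∈? Bc) {xs = xs}

          B⁺ : ∀ {v} → v ∈ xs → c v ∈ Bc → v ∈ B
          B⁺ = ∈-filter⁺ (λ v → c v ∈? Bc)

          length-cs : length cs ≡ length A + length Bc
          length-cs = trans (Perm.↭-length (unique-⇔⇒↭ ucs
            (Unique.++⁺ uA uBc λ (i∈A , i∈B) → Bc∉A i∈B i∈A)
            (λ {i} i∈ → case i ∈? A of λ { (yes a) → ∈-++⁺ˡ a ; (no ¬a) → ∈-++⁺ʳ A (Bc⁺ i∈ ¬a) })
            (λ i∈ → [ A⊆ , Bc⊆cs ]′ (∈-++⁻ A i∈)))) (length-++ A)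

          q : ℕ
          q = length Bc

          i⁺∈Bc : i⁺ ∈ Bc
          i⁺∈Bc = Bc⁺ i⁺∈ i⁺∉

          -- The deficient colour is accessible and the surplus colour is not, so the classes
          -- outside `A` are all full and together hold one extra vertex.
          length-B : length B ≡ suc (q * k)
          length-B = begin
            length B                                          ≡⟨ length-filter-∑ (λ v → c v ∈? Bc) xs ⟩
            ∑ xs (λ v → ⟦ c v ∈? Bc ⟧)                        ≡⟨ ∑-cong xs (λ {v} _ → ∑-indicator _≟_ uBc (c v)) ⟨
            ∑ xs (λ v → ∑ Bc λ i → ⟦ c v ≟ i ⟧)               ≡⟨ ∑-swap xs Bc _ ⟩
            ∑ Bc (cnt c)                                      ≡⟨ ∑-cong Bc (λ i∈ → cnt-Bc i∈) ⟩
            ∑ Bc (λ i → k + ⟦ i⁺ ≟ i ⟧)                       ≡⟨ ∑-+ Bc _ _ ⟩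
            ∑ Bc (λ _ → k) + ∑ Bc (λ i → ⟦ i⁺ ≟ i ⟧)          ≡⟨ cong₂ _+_ (∑-const Bc k) (trans (∑-indicator _≟_ uBc i⁺) (⟦⟧-yes (i⁺ ∈? Bc) i⁺∈Bc)) ⟩
            q * k + 1                                         ≡⟨ +-comm _ 1 ⟩
            suc (q * k)                                       ∎
            where
            open ≡-Reasoning
            cnt-Bc : ∀ {i} → i ∈ Bc → cnt c i ≡ k + ⟦ i⁺ ≟ i ⟧
            cnt-Bc {i} i∈ = begin
              cnt c i              ≡⟨ +-identityʳ _ ⟨
              cnt c i + 0          ≡⟨ cong (cnt c i +_) (⟦⟧-no (i⁻ ≟ i) λ { refl → Bc∉A i∈ (acc-root accA) }) ⟨
              cnt c i + ⟦ i⁻ ≟ i ⟧ ≡⟨ count (Bc⊆cs i∈) ⟩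
              k + ⟦ i⁺ ≟ i ⟧       ∎

          cnt-A : ∀ {i} → i ∈ A → cnt c i + ⟦ i⁻ ≟ i ⟧ ≡ k
          cnt-A {i} i∈ = trans (count (A⊆ i∈))
            (trans (cong (k +_) (⟦⟧-no (i⁺ ≟ i) λ { refl → i⁺∉ i∈ })) (+-identityʳ k))

          cnt≤k : ∀ {i} → i ∈ A → cnt c i ≤ k
          cnt≤k {i} i∈ = ≤-trans (m≤m+n (cnt c i) ⟦ i⁻ ≟ i ⟧) (≤-reflexive (cnt-A i∈))

          ∑nb+degree-B : ∀ {L} → Unique L → (∀ {i} → i ∈ L → i ∈ A) → ∀ x →
                         ∑ L (λ i → nb c i x) + degree B x ≤ degree xs x
          ∑nb+degree-B {L} uL L⊆ x = begin
            ∑ L (λ i → nb c i x) + degree B x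
              ≡⟨ cong₂ _+_ (∑nb c uL x) (∑-filter (λ v → c v ∈? Bc) xs _) ⟩
            ∑ xs (λ v → ⟦ adj? x v ⟧ * ⟦ c v ∈? L ⟧) + ∑ xs (λ v → ⟦ c v ∈? Bc ⟧ * ⟦ adj? x v ⟧)
              ≡⟨ ∑-+ xs _ _ ⟨
            ∑ xs (λ v → ⟦ adj? x v ⟧ * ⟦ c v ∈? L ⟧ + ⟦ c v ∈? Bc ⟧ * ⟦ adj? x v ⟧)
              ≤⟨ ∑-mono xs (λ {v} _ → pointwise v) ⟩
            degree xs x ∎
            where
            open ≤-Reasoning
            pointwise : ∀ v → ⟦ adj? x v ⟧ * ⟦ c v ∈? L ⟧ + ⟦ c v ∈? Bc ⟧ * ⟦ adj? x v ⟧ ≤ ⟦ adj? x v ⟧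
            pointwise v with c v ∈? L | c v ∈? Bc
            ... | yes l | yes b = contradiction (L⊆ l) (Bc∉A b)
            ... | yes _ | no _  = ≤-reflexive (trans (+-identityʳ _) (*-identityʳ _))
            ... | no _  | yes _ = ≤-reflexive (cong₂ _+_ (*-zeroʳ ⟦ adj? x v ⟧) (+-identityʳ _))
            ... | no _  | no _  = ≤-trans (≤-reflexive (cong (_+ 0) (*-zeroʳ ⟦ adj? x v ⟧))) z≤n

          length≤∑nb : ∀ {L x} → (∀ {i} → i ∈ L → ¬ Free c x i) → length L ≤ ∑ L (λ i → nb c i x)
          length≤∑nb {L} {x} h = begin
            length L             ≡⟨ *-identityʳ _ ⟨
            length L * 1         ≡⟨ ∑-const L 1 ⟨
            ∑ L (λ _ → 1)        ≤⟨ ∑-mono L (λ i∈ → ¬Free⇒nb {c} (h i∈)) ⟩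
            ∑ L (λ i → nb c i x) ∎
            where open ≤-Reasoning

          B-stuck : ∀ {y i} → y ∈ B → i ∈ A → ¬ Free c y i
          B-stuck y∈ i∈ fr = let y∈xs , cy∈ = B⁻ y∈ in
            closed (Bc⊆cs cy∈) (Bc∉A cy∈) i∈ (lose y∈xs (refl , fr))

          -- At least one neighbour is spent in each class of `A`. What remains is the degree
          -- condition for colouring with the `q` colours of `Bc`.
          degree-B< : ∀ {y} → y ∈ B → degree B y < q
          degree-B< {y} y∈ = +-cancelˡ-< (length A) _ _ (begin-strict
            length A + degree B y              ≤⟨ +-monoˡ-≤ _ (length≤∑nb (B-stuck y∈)) ⟩
            ∑ A (λ i → nb c i y) + degree B y  ≤⟨ ∑nb+degree-B uA id y ⟩
            degree xs y                        <⟨ deg< (proj₁ (B⁻ y∈)) ⟩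
            length cs                          ≡⟨ length-cs ⟩
            length A + q                       ∎)
            where open ≤-Reasoning

          -- A solo edge: `z` is the only neighbour of `y` in the class of `z`, so once `z` moves
          -- away, `y` can take its place.
          Solo : X → X → Set
          Solo z y = Adj z y × All (λ v → Adj y v → c v ≡ c z → v ≡ z) xs

          solo? : ∀ z y → Dec (Solo z y)
          solo? z y = adj? z y ×-dec all? (λ v → adj? y v →-dec ((c v ≟ c z) →-dec (v ≟ˣ z))) xs

          B- : X → List X
          B- y = filter (λ v → ¬? (v ≟ˣ y)) B

          B-⁻ : ∀ {y v} → v ∈ B- y → v ∈ B × v ≢ y
          B-⁻ {y} = ∈-filter⁻ (λ v → ¬? (v ≟ˣ y)) {xs = B}

          B-⁺ : ∀ {y v} → v ∈ xs → c v ∈ Bc → v ≢ y → v ∈ B- y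
          B-⁺ {y} v∈ cv∈ = ∈-filter⁺ (λ v → ¬? (v ≟ˣ y)) (B⁺ v∈ cv∈)

          B↭ : ∀ {y} → y ∈ B → B ↭ y ∷ B- y
          B↭ {y} y∈ = unique-⇔⇒↭ uB
            (All.tabulate (λ v∈ y≡v → proj₂ (B-⁻ v∈) (sym y≡v)) ∷ Unique.filter⁺ (λ v → ¬? (v ≟ˣ y)) uB)
            (λ {v} v∈ → case v ≟ˣ y of λ { (yes p) → here p ; (no v≢y) → there (∈-filter⁺ (λ v → ¬? (v ≟ˣ y)) v∈ v≢y) })
            λ { (here refl) → y∈ ; (there v∈) → proj₁ (B-⁻ v∈) }

          length-A>0 : 0 < length A
          length-A>0 = case accA of λ { base → s≤s z≤n ; (add _ _ _ _) → s≤s z≤n }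

          -- Deleting any one vertex of `B` leaves exactly `q * k` vertices, and `q` is below the
          -- number of colours because `A` is not empty.
          recursive : ∀ {y} → y ∈ B → Equitable Bc (B- y)
          recursive {y} y∈ = ih uBc
            (≤-trans (+-monoˡ-≤ q length-A>0) (≤-reflexive (sym length-cs)))
            (Unique.filter⁺ (λ v → ¬? (v ≟ˣ y)) uB)
            (suc-injective (trans (sym (Perm.↭-length (B↭ y∈))) length-B))
            (λ {x} x∈ → ≤-<-trans
              (≤-trans (m≤n+m _ ⟦ adj? x y ⟧) (≤-reflexive (sym (∑-↭ (λ v → ⟦ adj? x v ⟧) (B↭ y∈)))))
              (degree-B< (proj₁ (B-⁻ x∈))))

          mix : (X → ℕ) → X → ℕ
          mix d v with c v ∈? Bc
          ... | yes _ = d v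
          ... | no _  = c v

          mix-B : ∀ d {v} → c v ∈ Bc → mix d v ≡ d v
          mix-B d {v} p with c v ∈? Bc
          ... | yes _ = refl
          ... | no ¬p = contradiction p ¬p

          mix-A : ∀ d {v} → c v ∉ Bc → mix d v ≡ c v
          mix-A d {v} ¬p with c v ∈? Bc
          ... | yes p = contradiction p ¬p
          ... | no _  = refl

          -- The other accessible colours reach `i⁻` without passing through `W`, so changing class
          -- `W` does not cut them off.
          record Terminal (W : ℕ) : Set where
            field
              others   : List ℕ
              acc      : Acc c i⁻ others
              W∉       : W ∉ others
              ⊆A       : ∀ {i} → i ∈ others → i ∈ A
              A⊆others : ∀ {i} → i ∈ A → i ≢ W → i ∈ others

          Movable : X → Set
          Movable z = Any (λ j → j ≢ c z × Free c z j) A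

          movable? : ∀ z → Dec (Movable z)
          movable? z = any? (λ j → ¬? (j ≟ c z) ×-dec free? c z j) A

          -- Colour B ∖ {y} by E, give y the colour of its solo neighbour z, and z the colour i.
          module Recolour {z y i} (z∈ : z ∈ xs) (cz∈ : c z ∈ A) (y∈B : y ∈ B) (solo : Solo z y)
            (i∈ : i ∈ cs) (i≢ : i ≢ c z) (E : Equitable Bc (B- y))
            (free : ∀ {v} → v ∈ xs → v ≢ y → Adj z v → mix (Equitable.col E) v ≢ i) where

            private module E = Equitable E
            d = E.col
            W = c z

            y∈ : y ∈ xs
            y∈ = proj₁ (B⁻ y∈B)

            cy∈ : c y ∈ Bc
            cy∈ = proj₂ (B⁻ y∈B)

            z≢y : z ≢ y
            z≢y refl = irr (proj₁ solo)

            c₀ c₁ : X → ℕ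
            c₀ = mix d [ y ↦ W ]
            c₁ = c₀ [ z ↦ i ]

            c₁-z : c₁ z ≡ i
            c₁-z = update-same c₀ z

            c₁-y : c₁ y ≡ W
            c₁-y = trans (update-other c₀ (z≢y ∘ sym)) (update-same (mix d) y)

            c₁-other : ∀ {v} → v ≢ z → v ≢ y → c₁ v ≡ mix d v
            c₁-other v≢z v≢y = trans (update-other c₀ v≢z) (update-other (mix d) v≢y)

            mix∈Bc : ∀ {v} → v ∈ xs → v ≢ y → c v ∈ Bc → mix d v ∈ Bc
            mix∈Bc v∈ v≢y cv∈ = subst (_∈ Bc) (sym (mix-B d cv∈)) (E.col∈ (B-⁺ v∈ cv∈ v≢y))

            mix-A⁻ : ∀ {v} → v ∈ xs → v ≢ y → mix d v ∈ A → mix d v ≡ c v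
            mix-A⁻ {v} v∈ v≢y m∈ = mix-A d λ cv∈ → Bc∉A (mix∈Bc v∈ v≢y cv∈) m∈

            z-proper : ∀ {v} → v ∈ xs → v ≢ z → Adj z v → c₁ v ≢ i
            z-proper {v} v∈ v≢z a eq with v ≟ˣ y
            ... | yes refl = i≢ (trans (sym eq) c₁-y)
            ... | no v≢y   = free v∈ v≢y a (trans (sym (c₁-other v≢z v≢y)) eq)

            y-proper : ∀ {v} → v ∈ xs → v ≢ z → v ≢ y → Adj y v → c₁ v ≢ W
            y-proper {v} v∈ v≢z v≢y a eq = v≢z (All.lookup (proj₂ solo) v∈ a
              (trans (sym (mix-A⁻ v∈ v≢y (subst (_∈ A) (sym meq) cz∈))) meq))
              where meq = trans (sym (c₁-other v≢z v≢y)) eq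

            mix-proper : ∀ {v w} → v ∈ xs → w ∈ xs → v ≢ y → w ≢ y → Adj v w → mix d v ≢ mix d w
            mix-proper {v} {w} v∈ w∈ v≢y w≢y a eq with c v ∈? Bc | c w ∈? Bc
            ... | yes p | yes r = E.proper (B-⁺ v∈ p v≢y) (B-⁺ w∈ r w≢y) a eq
            ... | yes p | no ¬r = ¬r (subst (_∈ Bc) eq (E.col∈ (B-⁺ v∈ p v≢y)))
            ... | no ¬p | yes r = ¬p (subst (_∈ Bc) (sym eq) (E.col∈ (B-⁺ w∈ r w≢y)))
            ... | no ¬p | no ¬r = proper v∈ w∈ a eq

            proper₁ : ∀ {v w} → v ∈ xs → w ∈ xs → Adj v w → c₁ v ≢ c₁ w
            proper₁ {v} {w} v∈ w∈ a eq = case v ≟ˣ z of λ where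
              (yes refl) → case w ≟ˣ z of λ where
                (yes refl) → irr a
                (no w≢z)   → z-proper w∈ w≢z a (trans (sym eq) c₁-z)
              (no v≢z) → case w ≟ˣ z of λ where
                (yes refl) → z-proper v∈ v≢z (symm a) (trans eq c₁-z)
                (no w≢z)   → case v ≟ˣ y of λ where
                  (yes refl) → case w ≟ˣ y of λ where
                    (yes refl) → irr a
                    (no w≢y)   → y-proper w∈ w≢z w≢y a (trans (sym eq) c₁-y)
                  (no v≢y) → case w ≟ˣ y of λ where
                    (yes refl) → y-proper v∈ v≢z v≢y (symm a) (trans eq c₁-y)
                    (no w≢y)   → mix-proper v∈ w∈ v≢y w≢y a
                      (trans (sym (c₁-other v≢z v≢y)) (trans eq (c₁-other w≢z w≢y)))

            col∈₁ : ∀ {v} → v ∈ xs → c₁ v ∈ cs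
            col∈₁ {v} v∈ = case v ≟ˣ z of λ where
              (yes refl) → subst (_∈ cs) (sym c₁-z) i∈
              (no v≢z)   → case v ≟ˣ y of λ where
                (yes refl) → subst (_∈ cs) (sym c₁-y) (A⊆ cz∈)
                (no v≢y)   → subst (_∈ cs) (sym (c₁-other v≢z v≢y)) (case c v ∈? Bc of λ where
                  (yes p) → Bc⊆cs (mix∈Bc v∈ v≢y p)
                  (no ¬p) → subst (_∈ cs) (sym (mix-A d ¬p)) (col∈ v∈))

            -- Without `y` every class of `Bc` has exactly `k` vertices; placing `y` in class `W`
            -- therefore moves the surplus to `W`, before `z` leaves it.
            count₀ : ∀ {j} → j ∈ cs → cnt c₀ j + ⟦ i⁻ ≟ j ⟧ ≡ k + ⟦ W ≟ j ⟧
            count₀ {j} j∈ with j ∈? A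
            ... | yes j∈A = exchange-count (cnt c₀ j) (cnt c j) k ⟦ i⁻ ≟ j ⟧ ⟦ c y ≟ j ⟧ ⟦ W ≟ j ⟧
              (subst (λ n → n + ⟦ c y ≟ j ⟧ ≡ cnt c j + ⟦ W ≟ j ⟧) (∑-cong xs same) (cnt-update u c W j y∈))
              (trans (cnt-A j∈A) (sym (trans (cong (k +_) (⟦⟧-no (c y ≟ j) λ { refl → Bc∉A cy∈ j∈A })) (+-identityʳ k))))
              where
              same : ∀ {v} → v ∈ xs → ⟦ (c [ y ↦ W ]) v ≟ j ⟧ ≡ ⟦ c₀ v ≟ j ⟧
              same {v} v∈ with v ≟ˣ y
              ... | yes _ = refl
              ... | no v≢y with c v ∈? Bc
              ...   | no _  = refl
              ...   | yes p = trans (⟦⟧-no (c v ≟ j) λ { refl → Bc∉A p j∈A })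
                (sym (⟦⟧-no (d v ≟ j) λ { refl → Bc∉A (E.col∈ (B-⁺ v∈ p v≢y)) j∈A }))
            ... | no j∉A = begin
              cnt c₀ j + ⟦ i⁻ ≟ j ⟧ ≡⟨ cong₂ _+_ cnt₀ (⟦⟧-no (i⁻ ≟ j) λ { refl → j∉A (acc-root accA) }) ⟩
              k + 0                 ≡⟨ cong (k +_) (⟦⟧-no (W ≟ j) λ { refl → j∉A cz∈ }) ⟨
              k + ⟦ W ≟ j ⟧         ∎
              where
              open ≡-Reasoning
              same : ∀ {v} → v ∈ xs → ⟦ c₀ v ≟ j ⟧ ≡ ⟦ c v ∈? Bc ⟧ * (⟦ ¬? (v ≟ˣ y) ⟧ * ⟦ d v ≟ j ⟧)
              same {v} v∈ with v ≟ˣ y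
              ... | yes _ = trans (⟦⟧-no (W ≟ j) λ { refl → j∉A cz∈ }) (sym (*-zeroʳ ⟦ c v ∈? Bc ⟧))
              ... | no v≢y with c v ∈? Bc
              ...   | no ¬p = ⟦⟧-no (c v ≟ j) λ { refl → ¬p (Bc⁺ j∈ j∉A) }
              ...   | yes p = sym (trans (+-identityʳ _) (+-identityʳ _))
              cnt₀ : cnt c₀ j ≡ k
              cnt₀ = begin
                cnt c₀ j
                  ≡⟨ ∑-cong xs same ⟩
                ∑ xs (λ v → ⟦ c v ∈? Bc ⟧ * (⟦ ¬? (v ≟ˣ y) ⟧ * ⟦ d v ≟ j ⟧))
                  ≡⟨ ∑-filter (λ v → c v ∈? Bc) xs _ ⟨
                ∑ B (λ v → ⟦ ¬? (v ≟ˣ y) ⟧ * ⟦ d v ≟ j ⟧)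
                  ≡⟨ ∑-filter (λ v → ¬? (v ≟ˣ y)) B _ ⟨
                ∑ (B- y) (λ v → ⟦ d v ≟ j ⟧)
                  ≡⟨ E.count (Bc⁺ j∈ j∉A) ⟩
                k ∎

            near : NearEquitable cs i⁻ i c₁
            near = record
              { i⁻∈ = i⁻∈ ; i⁺∈ = i∈ ; col∈ = col∈₁ ; proper = proper₁
              ; count = λ {j} j∈ → exchange-count (cnt c₁ j) (cnt c₀ j) k ⟦ i⁻ ≟ j ⟧ ⟦ W ≟ j ⟧ ⟦ i ≟ j ⟧
                  (subst (λ a → cnt c₁ j + ⟦ a ≟ j ⟧ ≡ cnt c₀ j + ⟦ i ≟ j ⟧)
                    (trans (update-other (mix d) z≢y) (mix-A d (A∉Bc cz∈))) (cnt-update u c₀ i j z∈))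
                  (count₀ j∈) }

            keep : ∀ {v} → v ∈ xs → c v ∈ A → c v ≢ W → c₁ v ≡ c v
            keep v∈ cv∈ cv≢ = trans (c₁-other (λ { refl → cv≢ refl }) (λ { refl → Bc∉A cy∈ cv∈ }))
              (mix-A d (A∉Bc cv∈))

            keep⁻ : ∀ {v} → v ∈ xs → c₁ v ∈ A → c₁ v ≢ W → c₁ v ≢ i → c₁ v ≡ c v
            keep⁻ {v} v∈ c₁v∈ c₁v≢W c₁v≢i = trans eq (mix-A⁻ v∈ v≢y (subst (_∈ A) eq c₁v∈))
              where
              v≢z : v ≢ z
              v≢z refl = c₁v≢i c₁-z
              v≢y : v ≢ y
              v≢y refl = c₁v≢W c₁-y
              eq = c₁-other v≢z v≢y

            module _ (t : Terminal W) where
              private module T = Terminal t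

              ≢W : ∀ {l} → l ∈ T.others → l ≢ W
              ≢W l∈ refl = T.W∉ l∈

              -- A path from `i` to `i⁻` avoids the changed class `W`. Its only affected class is
              -- its first one, which gained `z`, so the surplus can be shifted along it.
              finish : i ∈ A → Equitable cs xs
              finish i∈A with acc-path T.acc (T.A⊆others i∈A i≢)
              ... | js , p , js⊆ = shift u near
                (path-transfer p
                  (λ v∈ m → keep v∈ (T.⊆A (i∷js⊆ m)) (≢W (i∷js⊆ m)))
                  (λ v∈ m → keep⁻ v∈ (T.⊆A (js⊆ m)) (≢W (js⊆ m))
                    λ eq → path-simple p (subst (_∈ js) eq m)))
                (A⊆ ∘ T.⊆A ∘ js⊆)
                where
                i∷js⊆ : ∀ {l} → l ∈ i ∷ js → l ∈ T.others
                i∷js⊆ (here refl) = T.A⊆others i∈A i≢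
                i∷js⊆ (there m)   = js⊆ m

              module _ (i∈Bc : i ∈ Bc) (¬mv : ¬ Movable z) {y′} (y′∈ : y′ ∈ B) (y≢y′ : y ≢ y′)
                       (solo′ : Solo z y′) (¬adj : ¬ Adj y y′) where

                i∉A : i ∉ A
                i∉A = Bc∉A i∈Bc

                acc₀ : Acc c₁ i⁻ T.others
                acc₀ = acc-transfer T.acc
                  (λ v∈ m → keep v∈ (T.⊆A m) (≢W m))
                  (λ v∈ m → keep⁻ v∈ (T.⊆A m) (≢W m) λ eq → i∉A (subst (_∈ A) eq (T.⊆A m)))

                leave : ∃[ j ] (j ∈ T.others × Edge c W j)
                leave with acc-exit accA (acc-root T.acc) cz∈ T.W∉
                ... | l , j , l∈ , l∉ , j∈ , e with l ≟ W
                ...   | yes l≡ = j , j∈ , subst (λ l → Edge c l j) l≡ e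
                ...   | no l≢  = contradiction (T.A⊆others l∈ l≢) l∉

                acc₁ : Acc c₁ i⁻ (W ∷ T.others)
                acc₁ with leave
                ... | j , j∈ , e with find e
                ...   | w , w∈ , cw , fr = add T.W∉ j∈ (lose w∈ (cw₁ , fr₁)) acc₀
                  where
                  -- The witness of an edge out of `W` cannot be `z`, which is not movable; hence it
                  -- is still in class `W` after the swap and keeps `W` accessible.
                  w≢z : w ≢ z
                  w≢z refl = ¬mv (lose (T.⊆A j∈) (≢W j∈ , fr))
                  cw∈ : c w ∈ A
                  cw∈ = subst (_∈ A) (sym cw) cz∈
                  w≢y : w ≢ y
                  w≢y refl = Bc∉A cy∈ cw∈
                  cw₁ : c₁ w ≡ W
                  cw₁ = trans (c₁-other w≢z w≢y) (trans (mix-A d (A∉Bc cw∈)) cw)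
                  fr₁ : Free c₁ w j
                  fr₁ = All.tabulate λ v∈ a eq → All.lookup fr v∈ a
                    (trans (sym (keep⁻ v∈ (subst (_∈ A) (sym eq) (T.⊆A j∈)) (λ eq′ → ≢W j∈ (trans (sym eq) eq′))
                      λ eq′ → i∉A (subst (_∈ A) (trans (sym eq) eq′) (T.⊆A j∈)))) eq)

                y′∈xs : y′ ∈ xs
                y′∈xs = proj₁ (B⁻ y′∈)

                c₁y′ : c₁ y′ ∈ Bc
                c₁y′ = subst (_∈ Bc) (sym (c₁-other (λ { refl → irr (proj₁ solo′) }) (y≢y′ ∘ sym)))
                  (mix∈Bc y′∈xs (y≢y′ ∘ sym) (proj₂ (B⁻ y′∈)))

                W∷others⊆A : ∀ {j} → j ∈ W ∷ T.others → j ∈ A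
                W∷others⊆A (here refl) = cz∈
                W∷others⊆A (there m)   = T.⊆A m

                -- `z` was the only neighbour of `y′` in class `W` and has left it, and the newcomer
                -- `y` is not adjacent to `y′`.
                fr′ : Free c₁ y′ W
                fr′ = All.tabulate λ {v} v∈ a eq → go v∈ a eq (v ≟ˣ z) (v ≟ˣ y)
                  where
                  go : ∀ {v} → v ∈ xs → Adj y′ v → c₁ v ≡ W → Dec (v ≡ z) → Dec (v ≡ y) → ⊥
                  go v∈ a eq (yes refl) _          = i∉A (subst (_∈ A) (trans (sym eq) c₁-z) cz∈)
                  go v∈ a eq (no v≢z) (yes refl) = ¬adj (symm a)
                  go v∈ a eq (no v≢z) (no v≢y)   = v≢z (All.lookup (proj₂ solo′) v∈ a
                    (trans (sym (mix-A⁻ v∈ v≢y (subst (_∈ A) (sym meq) cz∈))) meq))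
                    where meq = trans (sym (c₁-other v≢z v≢y)) eq

                -- All of `A` stays accessible, and `y′` can now be moved to class `W`, so the new
                -- colour of `y′`, which lies outside `A`, becomes accessible as well.
                extend : Progress i⁻ A
                extend = inj₂ (c₁ , i , S , near , accS , S⊆ , ⊆⇒length≤ _≟_ uA′ A′⊆)
                  where
                  S : List ℕ
                  S = c₁ y′ ∷ W ∷ T.others
                  accS : Acc c₁ i⁻ S
                  accS = add (λ m → Bc∉A c₁y′ (W∷others⊆A m)) (here refl) (lose y′∈xs (refl , fr′)) acc₁
                  S⊆ : ∀ {j} → j ∈ S → j ∈ cs
                  S⊆ (here eq) = subst (_∈ cs) (sym eq) (Bc⊆cs c₁y′)
                  S⊆ (there m) = A⊆ (W∷others⊆A m)
                  uA′ : Unique (c₁ y′ ∷ A)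
                  uA′ = All.tabulate (λ m eq → Bc∉A c₁y′ (subst (_∈ A) (sym eq) m)) ∷ uA
                  A′⊆ : ∀ {j} → j ∈ c₁ y′ ∷ A → j ∈ S
                  A′⊆ (here eq) = here eq
                  A′⊆ {j} (there m) with j ≟ W
                  ... | yes p = there (here p)
                  ... | no j≢ = there (there (T.A⊆others m j≢))

          mix-free-A : ∀ {z y j} (E : Equitable Bc (B- y)) → Free c z j → j ∈ A →
                       ∀ {v} → v ∈ xs → v ≢ y → Adj z v → mix (Equitable.col E) v ≢ j
          mix-free-A E fr j∈A {v} v∈ v≢y a eq with c v ∈? Bc
          ... | yes p = A∉Bc j∈A (subst (_∈ Bc) eq (Equitable.col∈ E (B-⁺ v∈ p v≢y)))
          ... | no ¬p = All.lookup fr v∈ a eq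

          mix-free-Bc : ∀ {z y j} (E : Equitable Bc (B- y)) → Neighbours.Free (B- y) (Equitable.col E) z j → j ∈ Bc →
                        ∀ {v} → v ∈ xs → v ≢ y → Adj z v → mix (Equitable.col E) v ≢ j
          mix-free-Bc E fr j∈Bc {v} v∈ v≢y a eq with c v ∈? Bc
          ... | yes p = All.lookup fr (B-⁺ v∈ p v≢y) a eq
          ... | no ¬p = ¬p (subst (_∈ Bc) (sym eq) j∈Bc)

          solo-movable : ∀ {z y} → z ∈ xs → c z ∈ A → Terminal (c z) → y ∈ B → Solo z y →
                         Movable z → Equitable cs xs
          solo-movable {z} {y} z∈ cz∈ t y∈ solo mv = go (recursive y∈) (find mv)
            where
            go : Equitable Bc (B- y) → ∃[ j ] (j ∈ A × j ≢ c z × Free c z j) → Equitable cs xs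
            go E (j , j∈A , j≢ , fr) =
              Recolour.finish z∈ cz∈ y∈ solo (A⊆ j∈A) j≢ E (mix-free-A E fr j∈A) t j∈A

          -- An unmovable vertex has a neighbour in each of the other |A| - 1 accessible classes,
          -- out of at most |A| + q - 1 neighbours in all.
          unmovable-degree : ∀ {z} → z ∈ xs → ¬ Movable z → degree B z ≤ q
          unmovable-degree {z} z∈ ¬mv = +-cancelˡ-≤ (length A) _ _ (begin
            length A + degree B z                     ≤⟨ +-monoˡ-≤ _ (⊆⇒length≤ _≟_ uA A⊆cz∷L) ⟩
            suc (length L + degree B z)               ≤⟨ s≤s (+-monoˡ-≤ _ (length≤∑nb λ j∈ fr → ¬mv (lose (L⊆A j∈) (proj₂ (L⁻ j∈) , fr)))) ⟩
            suc (∑ L (λ j → nb c j z) + degree B z)   ≤⟨ s≤s (∑nb+degree-B (Unique.filter⁺ (λ j → ¬? (j ≟ c z)) uA) L⊆A z) ⟩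
            suc (degree xs z)                         ≤⟨ deg< z∈ ⟩
            length cs                                 ≡⟨ length-cs ⟩
            length A + q                              ∎)
            where
            open ≤-Reasoning
            L = filter (λ j → ¬? (j ≟ c z)) A
            L⁻ : ∀ {j} → j ∈ L → j ∈ A × j ≢ c z
            L⁻ = ∈-filter⁻ (λ j → ¬? (j ≟ c z)) {xs = A}
            L⊆A : ∀ {j} → j ∈ L → j ∈ A
            L⊆A = proj₁ ∘ L⁻
            A⊆cz∷L : ∀ {j} → j ∈ A → j ∈ c z ∷ L
            A⊆cz∷L {j} j∈ with j ≟ c z
            ... | yes p = here p
            ... | no j≢ = there (∈-filter⁺ (λ j → ¬? (j ≟ c z)) j∈ j≢)

          solo-pair : ∀ {z y y′} → z ∈ xs → c z ∈ A → Terminal (c z) → ¬ Movable z →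
                      y ∈ B → y′ ∈ B → y ≢ y′ → Solo z y → Solo z y′ → ¬ Adj y y′ → Progress i⁻ A
          solo-pair {z} {y} z∈ cz∈ t ¬mv y∈ y′∈ y≢y′ solo solo′ ¬adj = go (recursive y∈)
            where
            -- Leaving out the neighbour `y` brings the degree of `z` below `q`, so some class of
            -- the equitable colouring of `B- y` can receive `z`.
            degree-B- : degree (B- y) z < q
            degree-B- = ≤-trans
              (≤-reflexive (trans (cong (_+ degree (B- y) z) (sym (⟦⟧-yes (adj? z y) (proj₁ solo))))
                                  (sym (∑-↭ (λ v → ⟦ adj? z v ⟧) (B↭ y∈)))))
              (unmovable-degree z∈ ¬mv)
            go : Equitable Bc (B- y) → Progress i⁻ A
            go E = let i , i∈ , fr = Neighbours.free-colour (B- y) (Equitable.col E) uBc z degree-B- in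
              Recolour.extend z∈ cz∈ y∈ solo (Bc⊆cs i∈) (λ eq → Bc∉A i∈ (subst (_∈ A) (sym eq) cz∈)) E
                (mix-free-Bc E fr i∈) t i∈ ¬mv y′∈ y≢y′ solo′ ¬adj

          -- Removing U cuts T = A ∖ (U ∷ S) off from i⁻. Once T is minimal, all its colours are
          -- terminal, that is, no colour of T is needed by any other colour to reach i⁻.
          record Stage (U : ℕ) (S : List ℕ) : Set where
            field
              acc    : Acc c i⁻ (U ∷ S)
              ⊆A     : ∀ {i} → i ∈ U ∷ S → i ∈ A
              cut    : ∀ {i j} → i ∈ A → i ∉ U ∷ S → j ∈ S → ¬ Edge c i j
              rest   : ∃[ i ] (i ∈ A × i ∉ U ∷ S)

          AllTerminal : ℕ → List ℕ → Set
          AllTerminal U S = ∀ {W} → W ∈ A → W ∉ U ∷ S → Terminal W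

          -- Explore from `U ∷ S` inside `A` without `W`. If every other colour is reached, `W` is
          -- terminal. Otherwise `W` cuts the missed colours off from `i⁻`, and this cut lies deeper
          -- than the one at `U`.
          refine : ∀ {U S} → Stage U S → ∀ {W} → W ∈ A → W ∉ U ∷ S →
                   Terminal W ⊎ (∃[ S′ ] (Stage W S′ × length (U ∷ S) ≤ length S′))
          refine {U} {S} st {W} W∈ W∉ = go (saturate (length vs) (m≤m+n _ _) st.acc
              λ j∈ → vs⁺ (st.⊆A j∈) λ { refl → W∉ j∈ })
            where
            module st = Stage st
            vs = filter (λ j → ¬? (j ≟ W)) A
            vs⁻ : ∀ {j} → j ∈ vs → j ∈ A × j ≢ W
            vs⁻ = ∈-filter⁻ (λ j → ¬? (j ≟ W)) {xs = A}
            vs⁺ : ∀ {j} → j ∈ A → j ≢ W → j ∈ vs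
            vs⁺ = ∈-filter⁺ (λ j → ¬? (j ≟ W))
            go : Closure c i⁻ vs (U ∷ S) → Terminal W ⊎ (∃[ S′ ] (Stage W S′ × length (U ∷ S) ≤ length S′))
            go Cl with all? (_∈? Closure.set Cl) vs
            ... | yes all = inj₁ record
              { others = Cl.set ; acc = Cl.acc ; W∉ = λ W∈′ → proj₂ (vs⁻ (Cl.⊆vs W∈′)) refl
              ; ⊆A = proj₁ ∘ vs⁻ ∘ Cl.⊆vs
              ; A⊆others = λ j∈ j≢ → All.lookup all (vs⁺ j∈ j≢) }
              where module Cl = Closure Cl
            ... | no ¬all = inj₂ (Cl.set , st′ , ⊆⇒length≤ _≟_ (acc-unique st.acc) Cl.⊇S)
              where
              module Cl = Closure Cl
              W∉′ : W ∉ Cl.set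
              W∉′ W∈′ = proj₂ (vs⁻ (Cl.⊆vs W∈′)) refl
              -- Some edge enters the explored set from outside, and it has to start at `W`, because
              -- the explored set is closed among the remaining colours.
              acc′ : Acc c i⁻ (W ∷ Cl.set)
              acc′ with acc-exit accA (acc-root Cl.acc) W∈ W∉′
              ... | l , j , l∈ , l∉ , j∈ , e with l ≟ W
              ...   | yes l≡ = add W∉′ j∈ (subst (λ l → Edge c l j) l≡ e) Cl.acc
              ...   | no l≢  = contradiction e (Cl.closed (vs⁺ l∈ l≢) l∉ j∈)
              st′ : Stage W Cl.set
              st′ = record
                { acc = acc′
                ; ⊆A = λ { (here refl) → W∈ ; (there m) → proj₁ (vs⁻ (Cl.⊆vs m)) }
                ; cut = λ i∈ i∉ j∈ → Cl.closed (vs⁺ i∈ (i∉ ∘ here)) (i∉ ∘ there) j∈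
                ; rest = case find (All.¬All⇒Any¬ (_∈? Cl.set) vs ¬all) of λ where
                    (i , i∈ , i∉) → i , proj₁ (vs⁻ i∈) , λ { (here p) → proj₂ (vs⁻ i∈) p ; (there m) → i∉ m } }

          -- The list `U ∷ S` grows strictly inside `A`, so the cuts cannot deepen for ever; at the
          -- last one every colour beyond the cut is terminal.
          descend : ∀ fuel {U S} → length A ≤ fuel + length (U ∷ S) → Stage U S →
                    ∃[ U′ ] ∃[ S′ ] (Stage U′ S′ × AllTerminal U′ S′)
          descend zero {U} {S} len st = contradiction (≤-trans (⊆⇒length≤ _≟_ uI I⊆) len) 1+n≰n
            where
            open Stage st
            uI : Unique (proj₁ rest ∷ U ∷ S)
            uI = All.tabulate (λ { m refl → proj₂ (proj₂ rest) m }) ∷ acc-unique acc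
            I⊆ : ∀ {j} → j ∈ proj₁ rest ∷ U ∷ S → j ∈ A
            I⊆ (here refl) = proj₁ (proj₂ rest)
            I⊆ (there m)   = ⊆A m
          descend (suc fuel) {U} {S} len st with partition-⊎ {P = λ W → W ∉ U ∷ S → Terminal W}
                 {Q = λ W → ∃[ S′ ] (Stage W S′ × length (U ∷ S) ≤ length S′)} try
            where
            try : ∀ {W} → W ∈ A → (W ∉ U ∷ S → Terminal W) ⊎ (∃[ S′ ] (Stage W S′ × length (U ∷ S) ≤ length S′))
            try {W} W∈ with W ∈? (U ∷ S)
            ... | yes m = inj₁ λ W∉ → contradiction m W∉
            ... | no W∉ = [ (λ t → inj₁ λ _ → t) , inj₂ ]′ (refine st W∈ W∉)
          ... | inj₁ all = U , S , st , all
          ... | inj₂ (W , _ , S′ , st′ , len′) = descend fuel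
            (≤-trans len (≤-trans (≤-reflexive (sym (+-suc fuel _))) (+-monoʳ-≤ fuel (s≤s len′)))) st′

          degree-B≤ : ∀ {z L} → z ∈ xs → Unique L → (∀ {i} → i ∈ L → i ∈ A) →
                      (∀ {i} → i ∈ L → ¬ Free c z i) → length L + degree B z < length A + q
          degree-B≤ {z} {L} z∈ uL L⊆ stuck = begin-strict
            length L + degree B z             ≤⟨ +-monoˡ-≤ _ (length≤∑nb stuck) ⟩
            ∑ L (λ i → nb c i z) + degree B z ≤⟨ ∑nb+degree-B uL L⊆ z ⟩
            degree xs z                       <⟨ deg< z∈ ⟩
            length cs                         ≡⟨ length-cs ⟩
            length A + q                      ∎
            where open ≤-Reasoning

          ∑∑-adj : ∀ (f : X → ℕ) → ∑ B (λ y → ∑ xs λ z → f z * ⟦ adj? z y ⟧) ≡ ∑ xs (λ z → f z * degree B z)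
          ∑∑-adj f = trans (∑-swap B xs _) (∑-cong xs λ {z} _ → ∑-*ˡ (f z) B _)

          -- If i⁻ were the only accessible colour, every vertex of B would have a neighbour of
          -- colour i⁻, more than the degrees of the k - 1 vertices of that colour allow.
          ¬lonely : ¬ (∀ {i} → i ∈ A → i ≡ i⁻)
          ¬lonely h = <⇒≱ (≤-reflexive (sym length-B)) (begin
            length B                                             ≡⟨ *-identityʳ _ ⟨
            length B * 1                                         ≡⟨ ∑-const B 1 ⟨
            ∑ B (λ _ → 1)                                        ≤⟨ ∑-mono B (λ y∈ → ¬Free⇒nb {c} (B-stuck y∈ (acc-root accA))) ⟩
            ∑ B (nb c i⁻)                                        ≤⟨ ∑-mono B (λ {y} _ → ∑-mono xs λ {z} _ → flip-adj y z) ⟩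
            ∑ B (λ y → ∑ xs λ z → ⟦ c z ≟ i⁻ ⟧ * ⟦ adj? z y ⟧)   ≡⟨ ∑∑-adj (λ z → ⟦ c z ≟ i⁻ ⟧) ⟩
            ∑ xs (λ z → ⟦ c z ≟ i⁻ ⟧ * degree B z)               ≤⟨ ∑-mono xs (λ z∈ → *-monoʳ-≤ ⟦ c _ ≟ i⁻ ⟧ (deg≤q z∈)) ⟩
            ∑ xs (λ z → ⟦ c z ≟ i⁻ ⟧ * q)                        ≡⟨ ∑-*ʳ q xs _ ⟩
            cnt c i⁻ * q                                         ≤⟨ *-monoˡ-≤ q (cnt≤k (acc-root accA)) ⟩
            k * q                                                ≡⟨ *-comm k q ⟩
            q * k                                                ∎)
            where
            open ≤-Reasoning
            flip-adj : ∀ y z → ⟦ adj? y z ⟧ * ⟦ c z ≟ i⁻ ⟧ ≤ ⟦ c z ≟ i⁻ ⟧ * ⟦ adj? z y ⟧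
            flip-adj y z = ≤-trans (≤-reflexive (*-comm ⟦ adj? y z ⟧ _))
              (*-monoʳ-≤ ⟦ c z ≟ i⁻ ⟧ (⟦⟧-mono (adj? y z) (adj? z y) symm))
            deg≤q : ∀ {z} → z ∈ xs → degree B z ≤ q
            deg≤q z∈ = ≤-pred (≤-trans (degree-B≤ z∈ [] (λ ()) λ ())
              (+-monoˡ-≤ q (⊆⇒length≤ _≟_ uA λ i∈ → here {xs = []} (h i∈))))

          stage₀ : Stage i⁻ []
          stage₀ = record
            { acc = base ; ⊆A = λ { (here refl) → acc-root accA } ; cut = λ _ _ ()
            ; rest = rest }
            where
            rest : ∃[ i ] (i ∈ A × i ∉ i⁻ ∷ [])
            rest with all? (_≟ i⁻) A
            ... | yes all = ⊥-elim (¬lonely (All.lookup all))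
            ... | no ¬all = let i , i∈ , i≢ = find (All.¬All⇒Any¬ (_≟ i⁻) A ¬all)
                            in i , i∈ , λ { (here p) → i≢ p }

          -- The final double counting in the proof of Kierstead and Kostochka (T is their 𝒜′): q < τ
          -- follows from counting edges between B and one class of T, and the contradiction from
          -- counting solo edges between T and a maximal independent set of B.
          module Counting {U S} (st : Stage U S)
            (unmovable : ∀ {z y} → z ∈ xs → c z ∈ A → c z ∉ U ∷ S → y ∈ B → Solo z y → ¬ Movable z)
            (clique : ∀ {z y y′} → z ∈ xs → c z ∈ A → c z ∉ U ∷ S → y ∈ B → y′ ∈ B → y ≢ y′ →
                      Solo z y → Solo z y′ → Adj y y′) where

            open Stage st

            T : List ℕ
            T = filter (_∉? (U ∷ S)) A

            τ : ℕ
            τ = length T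

            uT : Unique T
            uT = Unique.filter⁺ (_∉? (U ∷ S)) uA

            T⁻ : ∀ {i} → i ∈ T → i ∈ A × i ∉ U ∷ S
            T⁻ = ∈-filter⁻ (_∉? (U ∷ S)) {xs = A}

            A↭ : A ↭ T ++ (U ∷ S)
            A↭ = unique-⇔⇒↭ uA (Unique.++⁺ uT (acc-unique acc) λ (t , s) → proj₂ (T⁻ t) s)
              split λ m → [ proj₁ ∘ T⁻ , ⊆A ]′ (∈-++⁻ T m)
              where
              split : ∀ {i} → i ∈ A → i ∈ T ++ (U ∷ S)
              split {i} i∈ with i ∈? (U ∷ S)
              ... | yes m = ∈-++⁺ʳ T m
              ... | no ¬m = ∈-++⁺ˡ (∈-filter⁺ (_∉? (U ∷ S)) i∈ ¬m)

            length-A : length A ≡ τ + suc (length S)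
            length-A = trans (Perm.↭-length A↭) (length-++ T)

            solos : ℕ → X → ℕ
            solos W y = ∑ xs λ z → ⟦ c z ≟ W ⟧ * ⟦ solo? z y ⟧

            -- Since `y` is stuck, it has a neighbour in class `W`. Either there is a second one, or
            -- the first is a solo neighbour and is counted twice.
            2≤solos+nb : ∀ {W y} → W ∈ A → y ∈ B → 2 ≤ solos W y + nb c W y
            2≤solos+nb {W} {y} W∈ y∈ with ¬Free⇒neighbour {c} (B-stuck y∈ W∈)
            ... | z , z∈ , a , cz with solo? z y
            ...   | yes s = +-mono-≤
              (≤-trans (≤-reflexive (sym (cong₂ _*_ (⟦⟧-yes (c z ≟ W) cz) (⟦⟧-yes (solo? z y) s))))
                       (≤∑ (λ z → ⟦ c z ≟ W ⟧ * ⟦ solo? z y ⟧) z∈))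
              (¬Free⇒nb {c} (B-stuck y∈ W∈))
            ...   | no ¬s = ≤-trans (two another) (m≤n+m _ (solos W y))
              where
              Alone : X → Set
              Alone v = Adj y v → c v ≡ c z → v ≡ z
              alone? : ∀ v → Dec (Alone v)
              alone? v = adj? y v →-dec ((c v ≟ c z) →-dec (v ≟ˣ z))
              another : ∃[ v ] (v ∈ xs × ¬ Alone v)
              another = find (All.¬All⇒Any¬ alone? xs λ all → ¬s (symm a , all))
              two : ∃[ v ] (v ∈ xs × ¬ Alone v) → 2 ≤ nb c W y
              two (v , v∈ , ¬al) with adj? y v in eq₁ | c v ≟ c z | v ≟ˣ z
              ... | no ¬b | _      | _      = contradiction (λ b → contradiction b ¬b) ¬al
              ... | _     | no ¬e  | _      = contradiction (λ _ e → contradiction e ¬e) ¬al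
              ... | _     | _      | yes p  = contradiction (λ _ _ → p) ¬al
              ... | yes b | yes e  | no v≢z = ≤-trans
                (+-mono-≤ (nb-term {c} b (trans e cz)) (nb-term {c} a cz))
                (+≤∑ (λ u → ⟦ adj? y u ⟧ * ⟦ c u ≟ W ⟧) v∈ z∈ v≢z)

            σ : X → ℕ
            σ y = ∑ T λ W → solos W y

            -- Count the neighbours of `y`: at least `2 * τ` minus `σ y` in the classes of `T`, at
            -- least one in each class of `U ∷ S`, and those in `B`. Their total is less than |A| +
            -- q.
            σ-bound : ∀ {y} → y ∈ B → τ + suc (degree B y) ≤ σ y + q
            σ-bound {y} y∈ = +-cancelʳ-≤ (τ + suc (length S)) _ _ (begin
              τ + suc (degree B y) + (τ + suc (length S))
                ≡⟨ solve 3 (λ t d s → t :+ (con 1 :+ d) :+ (t :+ (con 1 :+ s)) := con 1 :+ (t :* con 2 :+ ((con 1 :+ s) :+ d))) refl τ (degree B y) (length S) ⟩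
              suc (τ * 2 + (suc (length S) + degree B y))
                ≤⟨ s≤s (+-mono-≤ (≤-trans (≤-reflexive (sym (∑-const T 2))) (∑-mono T λ W∈ → 2≤solos+nb (proj₁ (T⁻ W∈)) y∈))
                     (+-monoˡ-≤ _ (length≤∑nb (B-stuck y∈ ∘ ⊆A)))) ⟩
              suc (∑ T (λ W → solos W y + nb c W y) + (NU + degree B y))
                ≡⟨ cong (λ n → suc (n + (NU + degree B y))) (∑-+ T _ _) ⟩
              suc (σ y + NT + (NU + degree B y))
                ≡⟨ cong suc (trans (+-assoc (σ y) NT _) (cong (σ y +_) (sym (+-assoc NT NU _)))) ⟩
              suc (σ y + (NT + NU + degree B y))
                ≡⟨ cong (λ n → suc (σ y + (n + degree B y))) (trans (∑-↭ (λ W → nb c W y) A↭) (∑-++ T (U ∷ S) _)) ⟨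
              suc (σ y + (∑ A (λ W → nb c W y) + degree B y))
                ≤⟨ s≤s (+-monoʳ-≤ (σ y) (∑nb+degree-B uA id y)) ⟩
              suc (σ y + degree xs y)
                ≡⟨ +-suc (σ y) _ ⟨
              σ y + suc (degree xs y)
                ≤⟨ +-monoʳ-≤ (σ y) (deg< (proj₁ (B⁻ y∈))) ⟩
              σ y + length cs
                ≡⟨ cong (σ y +_) (trans length-cs (cong (_+ q) length-A)) ⟩
              σ y + (τ + suc (length S) + q)
                ≡⟨ cong (σ y +_) (+-comm _ q) ⟩
              σ y + (q + (τ + suc (length S)))
                ≡⟨ +-assoc (σ y) q _ ⟨
              σ y + q + (τ + suc (length S)) ∎)
              where
              open ≤-Reasoning
              open +-*-Solver
              NT = ∑ T λ W → nb c W y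
              NU = ∑ (U ∷ S) λ W → nb c W y

            -- Suppose `τ ≤ q` and fix a colour `W` of `T`. Each vertex of `B` receives weight at
            -- least 2 from class `W`, while each of the at most `k` vertices of that class gives
            -- weight at most 2q. This makes 2(qk + 1) at most 2qk.
            q<τ : q < τ
            q<τ = ≰⇒> λ τ≤q → <⇒≱ (*-monoʳ-< 2 (n<1+n (q * k))) (begin
              2 * suc (q * k)                                  ≡⟨ cong (2 *_) length-B ⟨
              2 * length B                                     ≡⟨ trans (*-comm 2 (length B)) (sym (∑-const B 2)) ⟩
              ∑ B (λ _ → 2)                                    ≤⟨ ∑-mono B (λ y∈ → 2≤solos+nb W∈A y∈) ⟩
              ∑ B (λ y → solos W y + nb c W y)                 ≡⟨ ∑-cong B (λ _ → sym (∑-+ xs _ _)) ⟩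
              ∑ B (λ y → ∑ xs λ z → ⟦ c z ≟ W ⟧ * ⟦ solo? z y ⟧ + ⟦ adj? y z ⟧ * ⟦ c z ≟ W ⟧)
                                                               ≤⟨ ∑-mono B (λ y∈ → ∑-mono xs λ {z} _ → weigh z y∈) ⟩
              ∑ B (λ y → ∑ xs λ z → ⟦ c z ≟ W ⟧ * ω z * ⟦ adj? z y ⟧) ≡⟨ ∑∑-adj (λ z → ⟦ c z ≟ W ⟧ * ω z) ⟩
              ∑ xs (λ z → ⟦ c z ≟ W ⟧ * ω z * degree B z)      ≤⟨ ∑-mono xs (λ {z} z∈ → ≤-trans (≤-reflexive (*-assoc ⟦ c z ≟ W ⟧ _ _))
                                                                    (⟦⟧*-mono (c z ≟ W) (heavy τ≤q z∈))) ⟩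
              ∑ xs (λ z → ⟦ c z ≟ W ⟧ * (2 * q))               ≡⟨ ∑-*ʳ (2 * q) xs _ ⟩
              cnt c W * (2 * q)                                ≤⟨ *-monoˡ-≤ (2 * q) (cnt≤k W∈A) ⟩
              k * (2 * q)                                      ≡⟨ trans (*-comm k _) (*-assoc 2 q k) ⟩
              2 * (q * k)                                      ∎)
              where
              open ≤-Reasoning
              W = proj₁ rest
              W∈A = proj₁ (proj₂ rest)
              W∉ = proj₂ (proj₂ rest)
              hasSolo? : ∀ z → Dec (Any (Solo z) B)
              hasSolo? z = any? (solo? z) B
              -- With these weights every vertex of B sees total weight at least 2 in the class W.
              ω : X → ℕ
              ω z = suc ⟦ hasSolo? z ⟧
              weigh : ∀ z {y} → y ∈ B → ⟦ c z ≟ W ⟧ * ⟦ solo? z y ⟧ + ⟦ adj? y z ⟧ * ⟦ c z ≟ W ⟧ ≤ ⟦ c z ≟ W ⟧ * ω z * ⟦ adj? z y ⟧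
              weigh z {y} y∈ = begin
                ⟦ c z ≟ W ⟧ * ⟦ solo? z y ⟧ + ⟦ adj? y z ⟧ * ⟦ c z ≟ W ⟧ ≡⟨ cong (⟦ c z ≟ W ⟧ * ⟦ solo? z y ⟧ +_) (*-comm ⟦ adj? y z ⟧ _) ⟩
                ⟦ c z ≟ W ⟧ * ⟦ solo? z y ⟧ + ⟦ c z ≟ W ⟧ * ⟦ adj? y z ⟧ ≡⟨ *-distribˡ-+ ⟦ c z ≟ W ⟧ _ _ ⟨
                ⟦ c z ≟ W ⟧ * (⟦ solo? z y ⟧ + ⟦ adj? y z ⟧)             ≤⟨ *-monoʳ-≤ ⟦ c z ≟ W ⟧ (pointwise (adj? z y) (solo? z y)) ⟩
                ⟦ c z ≟ W ⟧ * (ω z * ⟦ adj? z y ⟧)                       ≡⟨ *-assoc ⟦ c z ≟ W ⟧ _ _ ⟨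
                ⟦ c z ≟ W ⟧ * ω z * ⟦ adj? z y ⟧                         ∎
                where
                pointwise : (a : Dec (Adj z y)) (s : Dec (Solo z y)) → ⟦ s ⟧ + ⟦ adj? y z ⟧ ≤ ω z * ⟦ a ⟧
                pointwise (no ¬a) s = ≤-trans (≤-reflexive (cong₂ _+_ (⟦⟧-no s (¬a ∘ proj₁)) (⟦⟧-no (adj? y z) (¬a ∘ symm)))) z≤n
                pointwise (yes a) (no ¬s) = ≤-trans (⟦⟧≤1 (adj? y z)) (s≤s z≤n)
                pointwise (yes a) (yes s) = ≤-trans (s≤s (⟦⟧≤1 (adj? y z)))
                  (≤-reflexive (sym (cong (λ n → suc n * 1) (⟦⟧-yes (hasSolo? z) (lose y∈ s)))))
              heavy : τ ≤ q → ∀ {z} → z ∈ xs → c z ≡ W → ω z * degree B z ≤ 2 * q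
              heavy τ≤q {z} z∈ cz with hasSolo? z
              ... | yes h = let y , y∈ , s = find h in
                *-monoʳ-≤ 2 (unmovable-degree z∈ (unmovable z∈ (subst (_∈ A) (sym cz) W∈A) (subst (_∉ U ∷ S) (sym cz) W∉) y∈ s))
              -- Here `z` has weight 1. Its colour lies beyond the cut and has no edge into `S`, so
              -- `z` has a neighbour in every class of `S`, which leaves at most `τ + q` neighbours
              -- in `B`.
              ... | no _ = begin
                degree B z + 0    ≡⟨ +-identityʳ _ ⟩
                degree B z        ≤⟨ ≤-pred (+-cancelˡ-≤ (length S) _ _ (begin
                  length S + suc (degree B z)   ≡⟨ +-suc (length S) _ ⟩
                  suc (length S + degree B z)   ≤⟨ degree-B≤ z∈ (AllPairs.tail (acc-unique acc)) (⊆A ∘ there) stuck ⟩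
                  length A + q                  ≡⟨ cong (_+ q) (trans length-A (+-suc τ _)) ⟩
                  suc (τ + length S + q)        ≡⟨ cong (λ n → suc (n + q)) (+-comm τ _) ⟩
                  suc (length S + τ + q)        ≡⟨ cong suc (+-assoc (length S) τ q) ⟩
                  suc (length S + (τ + q))      ≡⟨ +-suc (length S) _ ⟨
                  length S + suc (τ + q)        ∎)) ⟩
                τ + q             ≤⟨ +-monoˡ-≤ q τ≤q ⟩
                q + q             ≡⟨ cong (q +_) (+-identityʳ q) ⟨
                2 * q             ∎
                where
                stuck : ∀ {j} → j ∈ S → ¬ Free c z j
                stuck j∈ fr = cut W∈A W∉ j∈ (lose z∈ (cz , fr))

            Independent : List X → Set
            Independent = AllPairs λ x y → ¬ Adj x y

            Dominates : List X → X → Set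
            Dominates I y = Any (λ w → w ≡ y ⊎ Adj w y) I

            maximal-independent : ∀ {l} → Unique l → ∃[ I ] (Unique I × Independent I ×
              (∀ {y} → y ∈ I → y ∈ l) × (∀ {y} → y ∈ l → Dominates I y))
            maximal-independent {[]} _ = [] , [] , [] , (λ ()) , λ ()
            maximal-independent {y ∷ l} (y∉ ∷ ul) with maximal-independent ul
            ... | I , uI , ind , I⊆ , dom with any? (adj? y) I
            ...   | yes p = let w , w∈ , a = find p in
              I , uI , ind , there ∘ I⊆ , λ { (here refl) → lose w∈ (inj₂ (symm a)) ; (there m) → dom m }
            ...   | no ¬p = y ∷ I , All.tabulate (λ w∈ → All.lookup y∉ (I⊆ w∈)) ∷ uI ,
              All.¬Any⇒All¬ I ¬p ∷ ind , (λ { (here eq) → here eq ; (there m) → there (I⊆ m) }) ,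
              λ { (here refl) → here (inj₁ refl) ; (there m) → there (dom m) }

            -- Summing `σ-bound` over a maximal independent set I of `B` gives |I|τ + qk + 1 ≤ kτ +
            -- |I|q, that is (|I| - k)(τ - q) < 0, although |I| > k and τ > q.
            contra : ⊥
            contra with maximal-independent uB
            ... | I , uI , ind , I⊆ , dom = 1+n≰n (begin
              suc (length I * q + k * τ)
                ≤⟨ excess ⟩
              length I * τ + suc (q * k)
                ≤⟨ +-monoʳ-≤ (length I * τ) D-lower ⟩
              length I * τ + ∑ I (λ y → suc (degree B y))
                ≡⟨ cong (_+ ∑ I (λ y → suc (degree B y))) (∑-const I τ) ⟨
              ∑ I (λ _ → τ) + ∑ I (λ y → suc (degree B y))
                ≡⟨ ∑-+ I _ _ ⟨
              ∑ I (λ y → τ + suc (degree B y))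
                ≤⟨ ∑-mono I (λ y∈ → σ-bound (I⊆ y∈)) ⟩
              ∑ I (λ y → σ y + q)
                ≡⟨ ∑-+ I _ _ ⟩
              ∑ I σ + ∑ I (λ _ → q)
                ≤⟨ +-mono-≤ ∑σ≤ (≤-reflexive (∑-const I q)) ⟩
              τ * k + length I * q
                ≡⟨ trans (+-comm (τ * k) _) (cong (length I * q +_) (*-comm τ k)) ⟩
              length I * q + k * τ ∎)
              where
              open ≤-Reasoning
              D-lower : suc (q * k) ≤ ∑ I (λ y → suc (degree B y))
              D-lower = begin
                suc (q * k)                                            ≡⟨ length-B ⟨
                length B                                               ≡⟨ *-identityʳ _ ⟨
                length B * 1                                           ≡⟨ ∑-const B 1 ⟨
                ∑ B (λ _ → 1)                                          ≤⟨ ∑-mono B (λ y∈ → dominated (find (dom y∈))) ⟩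
                ∑ B (λ y → ∑ I λ w → ⟦ w ≟ˣ y ⟧ + ⟦ adj? w y ⟧)        ≡⟨ ∑-swap B I _ ⟩
                ∑ I (λ w → ∑ B λ y → ⟦ w ≟ˣ y ⟧ + ⟦ adj? w y ⟧)        ≡⟨ ∑-cong I (λ _ → ∑-+ B _ _) ⟩
                ∑ I (λ w → ∑ B (λ y → ⟦ w ≟ˣ y ⟧) + degree B w)        ≤⟨ ∑-mono I (λ {w} _ → +-monoˡ-≤ (degree B w)
                                                                             (≤-trans (≤-reflexive (∑-indicator _≟ˣ_ uB w)) (⟦⟧≤1 (w ∈ˣ? B)))) ⟩
                ∑ I (λ w → suc (degree B w))                           ∎
                where
                open DecMembership _≟ˣ_ renaming (_∈?_ to _∈ˣ?_) using ()
                dominated : ∀ {y} → ∃[ w ] (w ∈ I × (w ≡ y ⊎ Adj w y)) → 1 ≤ ∑ I (λ w → ⟦ w ≟ˣ y ⟧ + ⟦ adj? w y ⟧)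
                dominated {y} (w , w∈ , inj₁ eq) = ≤-trans
                  (≤-trans (≤-reflexive (sym (⟦⟧-yes (w ≟ˣ y) eq))) (m≤m+n _ _)) (≤∑ (λ w → ⟦ w ≟ˣ y ⟧ + ⟦ adj? w y ⟧) w∈)
                dominated {y} (w , w∈ , inj₂ a) = ≤-trans
                  (≤-trans (≤-reflexive (sym (⟦⟧-yes (adj? w y) a))) (m≤n+m _ _)) (≤∑ (λ w → ⟦ w ≟ˣ y ⟧ + ⟦ adj? w y ⟧) w∈)
              -- The closed neighbourhoods of the members of I cover the `q * k + 1` vertices of
              -- `B`, and each contains at most `q` of them.
              k<I : k < length I
              k<I = *-cancelʳ-< q _ _ (begin-strict
                k * q                            ≡⟨ *-comm k q ⟩
                q * k                            <⟨ D-lower ⟩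
                ∑ I (λ y → suc (degree B y))     ≤⟨ ∑-mono I (λ y∈ → degree-B< (I⊆ y∈)) ⟩
                ∑ I (λ _ → q)                    ≡⟨ ∑-const I q ⟩
                length I * q                     ∎)
              -- The product of |I| - k and τ - q is nonnegative; it is expanded here with `e` for τ
              -- - q.
              excess : suc (length I * q + k * τ) ≤ length I * τ + suc (q * k)
              excess with m≤n⇒∃[o]m+o≡n (<⇒≤ q<τ)
              ... | e , q+e≡τ = begin
                suc (length I * q + k * τ)             ≡⟨ cong (λ t → suc (length I * q + k * t)) q+e≡τ ⟨
                suc (length I * q + k * (q + e))       ≡⟨ solve 4 (λ n q k e → con 1 :+ (n :* q :+ k :* (q :+ e)) := n :* q :+ (con 1 :+ q :* k) :+ k :* e) refl (length I) q k e ⟩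
                length I * q + suc (q * k) + k * e     ≤⟨ +-monoʳ-≤ (length I * q + suc (q * k)) (*-monoˡ-≤ e (<⇒≤ k<I)) ⟩
                length I * q + suc (q * k) + length I * e ≡⟨ solve 4 (λ n q k e → n :* q :+ (con 1 :+ q :* k) :+ n :* e := n :* (q :+ e) :+ (con 1 :+ q :* k)) refl (length I) q k e ⟩
                length I * (q + e) + suc (q * k)       ≡⟨ cong (λ t → length I * t + suc (q * k)) q+e≡τ ⟩
                length I * τ + suc (q * k)             ∎
                where open +-*-Solver
              -- The solo neighbours of a vertex `z` form a clique, so at most one of them is in I,
              -- and the classes of `T` have at most `τ * k` vertices.
              ∑σ≤ : ∑ I σ ≤ τ * k
              ∑σ≤ = begin
                ∑ I σ                                                              ≡⟨ ∑-swap I T _ ⟩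
                ∑ T (λ W → ∑ I λ y → solos W y)                                    ≡⟨ ∑-cong T (λ _ → ∑-swap I xs _) ⟩
                ∑ T (λ W → ∑ xs λ z → ∑ I λ y → ⟦ c z ≟ W ⟧ * ⟦ solo? z y ⟧)       ≡⟨ ∑-cong T (λ {W} _ → ∑-cong xs λ {z} _ → ∑-*ˡ ⟦ c z ≟ W ⟧ I _) ⟩
                ∑ T (λ W → ∑ xs λ z → ⟦ c z ≟ W ⟧ * ∑ I λ y → ⟦ solo? z y ⟧)       ≤⟨ ∑-mono T (λ {W} W∈ → ∑-mono xs λ {z} z∈ → ⟦⟧*-mono (c z ≟ W) (one W∈ z∈)) ⟩
                ∑ T (λ W → ∑ xs λ z → ⟦ c z ≟ W ⟧ * 1)                             ≡⟨ ∑-cong T (λ _ → trans (∑-*ʳ 1 xs _) (*-identityʳ _)) ⟩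
                ∑ T (cnt c)                                                        ≤⟨ ∑-mono T (λ W∈ → cnt≤k (proj₁ (T⁻ W∈))) ⟩
                ∑ T (λ _ → k)                                                      ≡⟨ ∑-const T k ⟩
                τ * k                                                              ∎
                where
                one : ∀ {W} → W ∈ T → ∀ {z} → z ∈ xs → c z ≡ W → ∑ I (λ y → ⟦ solo? z y ⟧) ≤ 1
                one W∈ {z} z∈ refl = ∑-⟦⟧≤1 (solo? z) (pairs uI ind I⊆)
                  where
                  pairs : ∀ {J} → Unique J → Independent J → (∀ {y} → y ∈ J → y ∈ B) →
                          AllPairs (λ y y′ → Solo z y → Solo z y′ → ⊥) J
                  pairs [] [] J⊆ = []
                  pairs (y∉ ∷ uJ) (ny ∷ iJ) J⊆ = All.tabulate (λ y′∈ s s′ → All.lookup ny y′∈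
                    (clique z∈ (proj₁ (T⁻ W∈)) (proj₂ (T⁻ W∈)) (J⊆ (here refl)) (J⊆ (there y′∈)) (All.lookup y∉ y′∈) s s′))
                    ∷ pairs uJ iJ (J⊆ ∘ there)

          -- If a solo vertex z of T is movable, moving it lets a solo neighbour y into its class, and
          -- B ∖ {y} is coloured by induction. If z has two nonadjacent solo neighbours y and y′, the
          -- same swap with y makes y′ movable into A, so the accessible set grows.
          progress : Progress i⁻ A
          progress = go (descend (length A) (m≤m+n _ _) stage₀)
            where
            Good : ℕ → List ℕ → X → Set
            Good U S z = c z ∈ A × c z ∉ U ∷ S
            good? : ∀ U S z → Dec (Good U S z)
            good? U S z = (c z ∈? A) ×-dec (c z ∉? (U ∷ S))
            go : ∃[ U ] ∃[ S ] (Stage U S × AllTerminal U S) → Progress i⁻ A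
            go (U , S , st , term)
              with any? (λ z → good? U S z ×-dec (any? (solo? z) B ×-dec movable? z)) xs
            ... | yes p = let z , z∈ , (a , b) , s , mv = find p
                              y , y∈ , sy = find s in
              inj₁ (solo-movable z∈ a (term a b) y∈ sy mv)
            ... | no ¬move
              with any? (λ z → good? U S z ×-dec any? (λ y → any? (λ y′ →
                     ¬? (y ≟ˣ y′) ×-dec (solo? z y ×-dec (solo? z y′ ×-dec ¬? (adj? y y′)))) B) B) xs
            ...   | yes p = let z , z∈ , (a , b) , ys = find p
                                y , y∈ , ys′ = find ys
                                y′ , y′∈ , y≢y′ , s , s′ , ¬adj = find ys′ in
              solo-pair z∈ a (term a b) (λ mv → ¬move (lose z∈ ((a , b) , lose y∈ s , mv)))
                y∈ y′∈ y≢y′ s s′ ¬adj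
            ...   | no ¬pair = ⊥-elim (Counting.contra st
              (λ z∈ a b y∈ s mv → ¬move (lose z∈ ((a , b) , lose y∈ s , mv)))
              (λ {z} {y} {y′} z∈ a b y∈ y′∈ y≢ s s′ → decidable-stable (adj? y y′) λ ¬adj →
                ¬pair (lose z∈ ((a , b) , lose y∈ (lose y′∈ (y≢ , s , s′ , ¬adj))))))

        -- If the surplus colour is accessible, a path settles the matter. Otherwise each round
        -- either ends with an equitable colouring or enlarges the accessible set, which is bounded
        -- by `cs`.
        near⇒equitable : ∀ fuel {c i⁻ i⁺ S} → NearEquitable cs i⁻ i⁺ c → Acc c i⁻ S →
          (∀ {i} → i ∈ S → i ∈ cs) → length cs ≤ fuel + length S → Equitable cs xs
        near⇒equitable fuel {c} {i⁻} {i⁺} {S} ne ac S⊆ len =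
          go fuel len (saturate (length cs) (m≤m+n _ _) ac S⊆)
          where
          go : ∀ fuel → length cs ≤ fuel + length S → Closure c i⁻ cs S → Equitable cs xs
          go fuel len Cl with i⁺ ∈? Closure.set Cl
          ... | yes i∈ = let js , p , js⊆ = acc-path (Closure.acc Cl) i∈ in
            shift u ne p (Closure.⊆vs Cl ∘ js⊆)
          go zero len Cl | no i∉ = contradiction
            (⊆⇒length≤ _≟_ (All.tabulate (λ m eq → i∉ (subst (_∈ Closure.set Cl) (sym eq) (Closure.⊇S Cl m))) ∷ acc-unique ac)
              λ { (here refl) → NearEquitable.i⁺∈ ne ; (there m) → S⊆ m })
            (≤⇒≯ len)
          go (suc fuel) len Cl | no i∉
            with Closed.progress ne (Closure.acc Cl) (Closure.⊆vs Cl) (Closure.closed Cl) i∉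
          ... | inj₁ E = E
          ... | inj₂ (c′ , i′ , S′ , ne′ , ac′ , S′⊆ , len′) = near⇒equitable fuel ne′ ac′ S′⊆
            (≤-trans len (≤-trans (≤-reflexive (sym (+-suc fuel _)))
              (+-monoʳ-≤ fuel (≤-trans (s≤s (⊆⇒length≤ _≟_ (acc-unique ac) (Closure.⊇S Cl))) len′))))

  -- Introducing the edges vertex by vertex

  open DecMembership _≟ˣ_ using () renaming (_∈?_ to _∈ˣ?_)

  -- Edges are deleted rather than vertices, so that the number of vertices stays a multiple of `k`.
  restrict : Graph X → List X → Graph X
  restrict G act = record
    { Adj  = λ x y → Adj x y × x ∈ act × y ∈ act
    ; adj? = λ x y → adj? x y ×-dec ((x ∈ˣ? act) ×-dec (y ∈ˣ? act))
    ; symm = λ (a , x∈ , y∈) → symm a , y∈ , x∈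
    ; irr  = λ (a , _) → irr a }
    where open Graph G

  degree-restrict : ∀ G act xs x → degree (restrict G act) xs x ≤ degree G xs x
  degree-restrict G act xs x = ∑-mono xs λ {y} _ →
    ⟦⟧-mono (Graph.adj? (restrict G act) x y) (Graph.adj? G x y) proj₁

  distribute : ∀ {cs : List ℕ} {xs : List X} → Unique cs → Unique xs → length xs ≡ length cs * k →
    Σ (X → ℕ) λ c → ((∀ {x} → x ∈ xs → c x ∈ cs) × (∀ {i} → i ∈ cs → ∑ xs (λ x → ⟦ c x ≟ i ⟧) ≡ k))
  distribute {[]} {[]} _ _ _ = (λ _ → 0) , (λ ()) , λ ()
  distribute {i ∷ cs} {xs} (i∉ ∷ ucs) uxs len = c , c∈ , count
    where
    ys = take k xs
    zs = drop k xs
    eq : ys ++ zs ≡ xs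
    eq = take++drop≡id k xs
    len-ys : length ys ≡ k
    len-ys = trans (length-take k xs) (m≤n⇒m⊓n≡m (≤-trans (m≤m+n k _) (≤-reflexive (sym len))))
    rec = distribute ucs (Unique.drop⁺ k uxs)
      (trans (length-drop k xs) (trans (cong (_∸ k) len) (m+n∸m≡n k _)))
    c′ = proj₁ rec
    c : X → ℕ
    c x with x ∈ˣ? ys
    ... | yes _ = i
    ... | no _  = c′ x
    c-ys : ∀ {x} → x ∈ ys → c x ≡ i
    c-ys {x} x∈ with x ∈ˣ? ys
    ... | yes _ = refl
    ... | no ¬m = contradiction x∈ ¬m
    disjoint : ∀ {as bs : List X} → Unique (as ++ bs) → ∀ {x} → x ∈ as → x ∉ bs
    disjoint {a ∷ as} (a∉ ∷ u) (here refl) x∈bs = All.lookup a∉ (∈-++⁺ʳ as x∈bs) refl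
    disjoint {a ∷ as} (a∉ ∷ u) (there x∈)  x∈bs = disjoint u x∈ x∈bs
    c-zs : ∀ {x} → x ∈ zs → c x ≡ c′ x
    c-zs {x} x∈ with x ∈ˣ? ys
    ... | yes m = contradiction x∈ (disjoint (subst Unique (sym eq) uxs) m)
    ... | no _  = refl
    c∈ : ∀ {x} → x ∈ xs → c x ∈ i ∷ cs
    c∈ {x} x∈ with ∈-++⁻ ys (subst (x ∈_) (sym eq) x∈)
    ... | inj₁ m = here (c-ys m)
    ... | inj₂ m = there (subst (_∈ cs) (sym (c-zs m)) (proj₁ (proj₂ rec) m))
    split : ∀ j → ∑ xs (λ x → ⟦ c x ≟ j ⟧) ≡ k * ⟦ i ≟ j ⟧ + ∑ zs (λ x → ⟦ c′ x ≟ j ⟧)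
    split j = begin
      ∑ xs (λ x → ⟦ c x ≟ j ⟧)                                ≡⟨ cong (λ l → ∑ l (λ x → ⟦ c x ≟ j ⟧)) eq ⟨
      ∑ (ys ++ zs) (λ x → ⟦ c x ≟ j ⟧)                        ≡⟨ ∑-++ ys zs _ ⟩
      ∑ ys (λ x → ⟦ c x ≟ j ⟧) + ∑ zs (λ x → ⟦ c x ≟ j ⟧)     ≡⟨ cong₂ _+_ (∑-cong ys λ m → cong (λ a → ⟦ a ≟ j ⟧) (c-ys m)) (∑-cong zs λ m → cong (λ a → ⟦ a ≟ j ⟧) (c-zs m)) ⟩
      ∑ ys (λ _ → ⟦ i ≟ j ⟧) + ∑ zs (λ x → ⟦ c′ x ≟ j ⟧)      ≡⟨ cong (_+ ∑ zs (λ x → ⟦ c′ x ≟ j ⟧)) (trans (∑-const ys ⟦ i ≟ j ⟧) (cong (_* ⟦ i ≟ j ⟧) len-ys)) ⟩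
      k * ⟦ i ≟ j ⟧ + ∑ zs (λ x → ⟦ c′ x ≟ j ⟧)               ∎
      where open ≡-Reasoning
    count : ∀ {j} → j ∈ i ∷ cs → ∑ xs (λ x → ⟦ c x ≟ j ⟧) ≡ k
    count (here refl) = trans (split i) (trans (cong₂ _+_
        (trans (cong (k *_) (⟦⟧-yes (i ≟ i) refl)) (*-identityʳ k))
        (trans (∑-cong zs λ {x} m → ⟦⟧-no (c′ x ≟ i) λ e → All.lookup i∉ (proj₁ (proj₂ rec) m) (sym e))
               (trans (∑-const zs 0) (*-zeroʳ (length zs)))))
      (+-identityʳ k))
    count {j} (there j∈) = trans (split j) (cong₂ _+_
        (trans (cong (k *_) (⟦⟧-no (i ≟ j) λ e → All.lookup i∉ j∈ e)) (*-zeroʳ k))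
        (proj₂ (proj₂ rec) j∈))

  -- Edges are introduced vertex by vertex: moving u to a colour that is free at u keeps the
  -- colouring proper and nearly equitable.
  activate : ∀ (G : Graph X) {cs xs} → Unique cs → Unique xs → (∀ {x} → x ∈ xs → degree G xs x < length cs) →
    (∀ act {cs′} → Unique cs′ → length cs′ < length cs → HasEquitable (restrict G act) cs′) →
    ∀ u act → u ∈ xs → Equitable (restrict G act) cs xs → Equitable (restrict G (u ∷ act)) cs xs
  activate G {cs} {xs} ucs uxs deg< ih u act u∈ E =
    near⇒equitable (length cs) near base (λ { (here refl) → col∈ u∈ }) (m≤m+n _ _)
    where
    open Equitable E
    G′ = restrict G (u ∷ act)
    open Graph G′
    deg<′ : ∀ {x} → x ∈ xs → degree G′ xs x < length cs
    deg<′ x∈ = ≤-<-trans (degree-restrict G (u ∷ act) xs _) (deg< x∈)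
    open Classes G′ xs
    open Improve uxs ucs deg<′ (ih (u ∷ act))
    fc = Neighbours.free-colour G′ xs col ucs u (deg<′ u∈)
    j  = proj₁ fc
    c′ = col [ u ↦ j ]
    proper′ : ∀ {v w} → v ∈ xs → w ∈ xs → Adj v w → c′ v ≢ c′ w
    proper′ {v} {w} v∈ w∈ a with v ≟ˣ u | w ≟ˣ u
    ... | yes refl | yes refl = λ _ → irr a
    ... | yes refl | no _     = λ e → All.lookup (proj₂ (proj₂ fc)) w∈ a (sym e)
    ... | no _     | yes refl = λ e → All.lookup (proj₂ (proj₂ fc)) v∈ (symm a) e
    ... | no v≢u   | no w≢u   = proper v∈ w∈ (proj₁ a , old v≢u (proj₁ (proj₂ a)) , old w≢u (proj₂ (proj₂ a)))
      where
      old : ∀ {x} → x ≢ u → x ∈ u ∷ act → x ∈ act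
      old x≢ (here e)   = contradiction e x≢
      old x≢ (there x∈) = x∈
    col∈′ : ∀ {x} → x ∈ xs → c′ x ∈ cs
    col∈′ {x} x∈ with x ≟ˣ u
    ... | yes _ = proj₁ (proj₂ fc)
    ... | no _  = col∈ x∈
    near : NearEquitable cs (col u) j c′
    near = record
      { i⁻∈ = col∈ u∈ ; i⁺∈ = proj₁ (proj₂ fc) ; col∈ = col∈′ ; proper = proper′
      ; count = λ {l} l∈ → trans (cnt-update uxs col j l u∈) (cong (_+ ⟦ j ≟ l ⟧) (count l∈)) }

  -- The outer induction, on a bound for the number of colours, covers all graphs because it is
  -- applied to restricted ones. The inner one activates the vertices of `xs` in turn, starting
  -- without edges.
  hajnal-szemerédi : ∀ n (G : Graph X) {cs} → Unique cs → length cs < n → HasEquitable G cs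
  hajnal-szemerédi (suc n) G {cs} ucs cs<n {xs} uxs len deg< = record
    { col = col ; col∈ = col∈ ; count = count
    ; proper = λ x∈ y∈ a → proper x∈ y∈ (a , x∈ , y∈) }
    where
    activated : ∀ act → (∀ {x} → x ∈ act → x ∈ xs) → Equitable (restrict G act) cs xs
    activated [] _ = let c , c∈ , count = distribute ucs uxs len in
      record { col = c ; col∈ = c∈ ; proper = λ { _ _ (_ , () , _) } ; count = count }
    activated (u ∷ act) act⊆ = activate G ucs uxs deg<
      (λ act ucs′ cs′<cs → hajnal-szemerédi n (restrict G act) ucs′ (≤-trans cs′<cs (≤-pred cs<n)))
      u act (act⊆ (here refl)) (activated act (act⊆ ∘ there))
    open Equitable (activated xs id)

-- Averaging over disjoint sets

∑-map : (h : A₁ → A₂) (xs : List A₁) (f : A₂ → ℕ) → ∑ (map h xs) f ≡ ∑ xs (f ∘ h)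
∑-map h xs f = cong sum (sym (map-∘ xs))

allSubsets : ∀ n → List (Subset n)
allSubsets zero    = [] ∷ []
allSubsets (suc n) = map (false ∷_) (allSubsets n) ++ map (true ∷_) (allSubsets n)

∈-allSubsets : (s : Subset n) → s ∈ allSubsets n
∈-allSubsets []          = here refl
∈-allSubsets (false ∷ s) = ∈-++⁺ˡ (∈-map⁺ (false ∷_) (∈-allSubsets s))
∈-allSubsets {suc n} (true ∷ s) =
  ∈-++⁺ʳ (map (false ∷_) (allSubsets n)) (∈-map⁺ (true ∷_) (∈-allSubsets s))

allSubsets-unique : ∀ n → Unique (allSubsets n)
allSubsets-unique zero    = [] ∷ []
allSubsets-unique (suc n) = Unique.++⁺
  (Unique.map⁺ Vec.∷-injectiveʳ (allSubsets-unique n)) (Unique.map⁺ Vec.∷-injectiveʳ (allSubsets-unique n))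
  λ (p , q) → case ∈-map⁻ (false ∷_) p , ∈-map⁻ (true ∷_) q of λ { ((_ , _ , refl) , (_ , _ , ())) }

_≟ˢ_ : DecidableEquality (Subset n)
_≟ˢ_ = Vec.≡-dec Bool._≟_

In : ℕ → Subset n → Subset n → Set
In r U s = s ⊆ˢ U × ∣ s ∣ ≡ r

in? : ∀ r (U s : Subset n) → Dec (In r U s)
in? r U s = (s Subset.⊆? U) ×-dec (∣ s ∣ ≟ r)

nC0≡1 : ∀ n → n C 0 ≡ 1
nC0≡1 n = trans (nCk≡nC[n∸k] {0} {n} z≤n) (nCn≡1 n)

nCk>0 : ∀ {n k} → k ≤ n → 0 < n C k
nCk>0 {n}     {zero}  _         = ≤-reflexive (sym (nC0≡1 n))
nCk>0 {suc n} {suc k} (s≤s k≤n) = ≤-trans (nCk>0 k≤n)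
  (≤-trans (m≤m+n _ _) (≤-reflexive (nCk+nC[k+1]≡[n+1]C[k+1] n k)))

∑-In : ∀ r (U : Subset n) → ∑ (allSubsets n) (λ s → ⟦ in? r U s ⟧) ≡ ∣ U ∣ C r
∑-In zero    [] = trans (cong (_+ 0) (⟦⟧-yes (in? 0 [] []) (id , refl))) (sym (nC0≡1 0))
∑-In (suc r) [] = trans (cong (_+ 0) (⟦⟧-no (in? (suc r) [] []) λ ())) (sym (k>n⇒nCk≡0 {0} {suc r} (s≤s z≤n)))
∑-In {suc n} r (b ∷ U) = trans (trans (∑-++ (map (false ∷_) (allSubsets n)) _ _)
    (cong₂ _+_ (trans (∑-map (false ∷_) (allSubsets n) _)
                      (trans (∑-cong (allSubsets n) λ {s} _ → ⟦⟧-cong (in? r (b ∷ U) (false ∷ s)) (in? r U s)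
                                (λ (p , e) → Subset.drop-∷-⊆ p , e) (λ (p , e) → Subset.out⊆ p , e))
                             (∑-In r U)))
               (∑-map (true ∷_) (allSubsets n) _)))
  (step r b)
  where
  vanish : ∀ {f : Subset n → ℕ} → (∀ {s} → f s ≡ 0) → ∑ (allSubsets n) f ≡ 0
  vanish eq = trans (∑-cong (allSubsets n) λ _ → eq) (trans (∑-const (allSubsets n) 0) (*-zeroʳ (length (allSubsets n))))
  step : ∀ r b → ∣ U ∣ C r + ∑ (allSubsets n) (λ s → ⟦ in? r (b ∷ U) (true ∷ s) ⟧) ≡ ∣ b ∷ U ∣ C r
  step r false = trans (cong (∣ U ∣ C r +_) (vanish λ {s} → ⟦⟧-no (in? r (false ∷ U) (true ∷ s))
    λ (p , _) → case p here of λ ())) (+-identityʳ _)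
  step zero true = trans (cong₂ _+_ (nC0≡1 ∣ U ∣) (vanish λ {s} → ⟦⟧-no (in? 0 (true ∷ U) (true ∷ s)) λ ()))
    (sym (nC0≡1 (suc ∣ U ∣)))
  step (suc r) true = trans (cong (∣ U ∣ C suc r +_)
      (trans (∑-cong (allSubsets n) λ {s} _ → ⟦⟧-cong (in? (suc r) (true ∷ U) (true ∷ s)) (in? r U s)
          (λ (p , e) → Subset.drop-∷-⊆ p , suc-injective e) (λ (p , e) → Subset.in⊆in p , cong suc e))
        (∑-In r U)))
    (trans (+-comm (∣ U ∣ C suc r) _) (nCk+nC[k+1]≡[n+1]C[k+1] ∣ U ∣ r))

∣─∣+∣∣ : (U e : Subset n) → e ⊆ˢ U → ∣ U ─ e ∣ + ∣ e ∣ ≡ ∣ U ∣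
∣─∣+∣∣ []          []          _ = refl
∣─∣+∣∣ (false ∷ U) (false ∷ e) p = ∣─∣+∣∣ U e (Subset.drop-∷-⊆ p)
∣─∣+∣∣ (true ∷ U)  (false ∷ e) p = cong suc (∣─∣+∣∣ U e (Subset.drop-∷-⊆ p))
∣─∣+∣∣ (false ∷ U) (true ∷ e)  p = case p here of λ ()
∣─∣+∣∣ (true ∷ U)  (true ∷ e)  p = trans (+-suc _ _) (cong suc (∣─∣+∣∣ U e (Subset.drop-∷-⊆ p)))

∈─⇒∉ : (U e : Subset n) {v : Fin n} → v ∈ˢ U ─ e → v ∉ˢ e
∈─⇒∉ (x ∷ U) (false ∷ e) {suc v} (there m) (there v∈) = ∈─⇒∉ U e m v∈
∈─⇒∉ (x ∷ U) (true ∷ e)  {suc v} (there m) (there v∈) = ∈─⇒∉ U e m v∈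

⊆─⇒Disjoint : (U e g : Subset n) → g ⊆ˢ U ─ e → Disjoint e g
⊆─⇒Disjoint U e g p v v∈e v∈g = ∈─⇒∉ U e (p v∈g) v∈e

-- Both sides describe an ordered pair of disjoint r-subsets of `U`; this symmetry drives the double
-- count below.
In-─-comm : ∀ {r} (U e g : Subset n) → In r U e × In r (U ─ e) g → In r U g × In r (U ─ g) e
In-─-comm U e g ((e⊆ , ce) , (g⊆ , cg)) =
  ((λ v∈ → Subset.p─q⊆p U e (g⊆ v∈)) , cg) ,
  ((λ v∈e → Subset.x∈p∧x∉q⇒x∈p─q (e⊆ v∈e) (⊆─⇒Disjoint U e g g⊆ _ v∈e)) , ce)

Matching : (Subset n → Set) → List (Subset n) → Set
Matching P M = AllPairs Disjoint M × All P M

module Averaging {F : Subset n → Set} (F? : Decidable₁ F) (r : ℕ) where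

  size : Subset n → ℕ
  size U = ∑ (allSubsets n) λ g → ⟦ F? g ⟧ * ⟦ in? r U g ⟧

  AveragingBound : ℕ → Set
  AveragingBound q = ∀ s U → q * r ≤ ∣ U ∣ → (∀ M → Matching (λ g → F g × In r U g) M → length M ≤ s) →
                     q * size U ≤ s * (∣ U ∣ C r)

  -- Induction on q: sum the bound for U ─ e over all r-sets e ⊆ U.
  averaging : ∀ q → AveragingBound q
  averaging zero s U _ _ = z≤n
  -- A single r-set is treated apart, because the inductive step divides by C(|U| - r, r), and its
  -- positivity is drawn from 2r ≤ |U|.
  averaging (suc zero) s U _ bound = begin
    size U + 0                                              ≡⟨ +-identityʳ _ ⟩
    size U                                                  ≤⟨ ∑-mono (allSubsets n) (λ {g} _ → pointwise g) ⟩
    ∑ (allSubsets n) (λ g → s * ⟦ in? r U g ⟧)              ≡⟨ ∑-*ˡ s (allSubsets n) _ ⟩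
    s * ∑ (allSubsets n) (λ g → ⟦ in? r U g ⟧)              ≡⟨ cong (s *_) (∑-In r U) ⟩
    s * (∣ U ∣ C r)                                         ∎
    where
    open ≤-Reasoning
    pointwise : ∀ g → ⟦ F? g ⟧ * ⟦ in? r U g ⟧ ≤ s * ⟦ in? r U g ⟧
    pointwise g with F? g | in? r U g
    ... | no _  | _     = z≤n
    ... | yes _ | no _  = z≤n
    ... | yes f | yes i = *-monoˡ-≤ 1 (bound (g ∷ []) (([] ∷ []) , (f , i) ∷ []))
  averaging (suc q@(suc q′)) s U qr≤ bound = *-cancelʳ-≤ _ _ C′ {{>-nonZero C′>0}} (begin
    -- Of the q + 1 copies of `size U`, q are counted through the members of F inside `U ─ e` and
    -- one through the sets `e` that belong to F themselves.
    suc q * size U * C′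
      ≡⟨ *-assoc (suc q) (size U) C′ ⟩
    size U * C′ + q * (size U * C′)
      ≡⟨ +-comm (size U * C′) _ ⟩
    q * (size U * C′) + size U * C′
      ≡⟨ cong₂ _+_ (cong (q *_) (sym double-count)) (trans (cong (_* C′) (∑-cong (allSubsets n) λ {e} _ → *-comm ⟦ F? e ⟧ _)) (sym (∑-*ʳ C′ (allSubsets n) _))) ⟩
    q * ∑ (allSubsets n) (λ e → ⟦ in? r U e ⟧ * size (U ─ e)) + ∑ (allSubsets n) (λ e → ⟦ in? r U e ⟧ * ⟦ F? e ⟧ * C′)
      ≡⟨ cong (_+ ∑ (allSubsets n) (λ e → ⟦ in? r U e ⟧ * ⟦ F? e ⟧ * C′)) (∑-*ˡ q (allSubsets n) _) ⟨
    ∑ (allSubsets n) (λ e → q * (⟦ in? r U e ⟧ * size (U ─ e))) + ∑ (allSubsets n) (λ e → ⟦ in? r U e ⟧ * ⟦ F? e ⟧ * C′)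
      ≡⟨ ∑-+ (allSubsets n) _ _ ⟨
    ∑ (allSubsets n) (λ e → q * (⟦ in? r U e ⟧ * size (U ─ e)) + ⟦ in? r U e ⟧ * ⟦ F? e ⟧ * C′)
      ≤⟨ ∑-mono (allSubsets n) (λ {e} _ → ≤-trans (≤-reflexive (regroup ⟦ in? r U e ⟧ q (size (U ─ e)) ⟦ F? e ⟧ C′))
           (⟦⟧*-mono (in? r U e) (λ i → remove (averaging q) i (F? e)))) ⟩
    ∑ (allSubsets n) (λ e → ⟦ in? r U e ⟧ * (s * C′))
      ≡⟨ ∑-*ʳ (s * C′) (allSubsets n) _ ⟩
    ∑ (allSubsets n) (λ e → ⟦ in? r U e ⟧) * (s * C′)
      ≡⟨ cong (_* (s * C′)) (∑-In r U) ⟩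
    (∣ U ∣ C r) * (s * C′)
      ≡⟨ trans (sym (*-assoc (∣ U ∣ C r) s C′)) (cong (_* C′) (*-comm (∣ U ∣ C r) s)) ⟩
    s * (∣ U ∣ C r) * C′ ∎)
    where
    open ≤-Reasoning
    C′ = (∣ U ∣ ∸ r) C r
    C′>0 : 0 < C′
    C′>0 = nCk>0 (m+n≤o⇒m≤o∸n r (≤-trans (+-monoʳ-≤ r (m≤m+n r (q′ * r))) qr≤))
    card : ∀ {e} → In r U e → ∣ U ─ e ∣ ≡ ∣ U ∣ ∸ r
    card {e} (e⊆ , refl) = sym (trans (cong (_∸ ∣ e ∣) (sym (∣─∣+∣∣ U e e⊆))) (m+n∸n≡m ∣ U ─ e ∣ ∣ e ∣))
    regroup : ∀ i q z f c → q * (i * z) + i * f * c ≡ i * (q * z + f * c)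
    regroup i q z f c = trans (cong₂ _+_ (trans (sym (*-assoc q i z)) (trans (cong (_* z) (*-comm q i)) (*-assoc i q z)))
      (*-assoc i f c)) (sym (*-distribˡ-+ i (q * z) (f * c)))
    In-─ : ∀ {e g} → In r (U ─ e) g → In r U g
    In-─ {e} (g⊆ , c) = (λ v∈ → Subset.p─q⊆p U e (g⊆ v∈)) , c
    -- If `e` is in F, it extends every matching inside `U ─ e`. The bound there then holds with s -
    -- 1, and the amount saved pays for the term `⟦ d ⟧ * C′`.
    remove : AveragingBound q → ∀ {e} → In r U e → (d : Dec (F e)) → q * size (U ─ e) + ⟦ d ⟧ * C′ ≤ s * C′
    remove ih {e} i d = go d s bound
      where
      qr≤′ : q * r ≤ ∣ U ─ e ∣
      qr≤′ = ≤-trans (m+n≤o⇒m≤o∸n (q * r) (≤-trans (≤-reflexive (+-comm (q * r) r)) qr≤)) (≤-reflexive (sym (card i)))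
      weaken : ∀ {M} → Matching (λ g → F g × In r (U ─ e) g) M → All (λ g → F g × In r U g) M
      weaken (_ , all) = All.map (λ (f , i) → f , In-─ i) all
      go : (d : Dec (F e)) → ∀ s → (∀ M → Matching (λ g → F g × In r U g) M → length M ≤ s) →
           q * size (U ─ e) + ⟦ d ⟧ * C′ ≤ s * C′
      go (no _) s bound = ≤-trans (≤-reflexive (+-identityʳ _))
        (≤-trans (ih s (U ─ e) qr≤′ λ M m → bound M (proj₁ m , weaken m))
                 (≤-reflexive (cong (λ c → s * (c C r)) (card i))))
      go (yes f) zero bound = contradiction (bound (e ∷ []) (([] ∷ []) , (f , i) ∷ [])) λ ()
      go (yes f) (suc s) bound = ≤-trans
        (+-mono-≤ (≤-trans (ih s (U ─ e) qr≤′ λ M m → ≤-pred (bound (e ∷ M)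
                     ((All.map (λ { {g} (_ , g⊆ , _) → ⊆─⇒Disjoint U e g g⊆ }) (proj₂ m) ∷ proj₁ m) , (f , i) ∷ weaken m)))
                     (≤-reflexive (cong (λ c → s * (c C r)) (card i))))
                  (≤-reflexive (+-identityʳ C′)))
        (≤-reflexive (+-comm (s * C′) C′))
    -- Each r-set `g` inside `U` is disjoint from exactly `C′` of the r-sets `e`.
    double-count : ∑ (allSubsets n) (λ e → ⟦ in? r U e ⟧ * size (U ─ e)) ≡ size U * C′
    double-count = begin-equality
      ∑ (allSubsets n) (λ e → ⟦ in? r U e ⟧ * size (U ─ e))
        ≡⟨ ∑-cong (allSubsets n) (λ {e} _ → ∑-*ˡ ⟦ in? r U e ⟧ (allSubsets n) _) ⟨
      ∑ (allSubsets n) (λ e → ∑ (allSubsets n) λ g → ⟦ in? r U e ⟧ * (⟦ F? g ⟧ * ⟦ in? r (U ─ e) g ⟧))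
        ≡⟨ ∑-swap (allSubsets n) (allSubsets n) _ ⟩
      ∑ (allSubsets n) (λ g → ∑ (allSubsets n) λ e → ⟦ in? r U e ⟧ * (⟦ F? g ⟧ * ⟦ in? r (U ─ e) g ⟧))
        ≡⟨ ∑-cong (allSubsets n) (λ {g} _ → ∑-cong (allSubsets n) λ {e} _ → exchange e g) ⟩
      ∑ (allSubsets n) (λ g → ∑ (allSubsets n) λ e → ⟦ F? g ⟧ * ⟦ in? r U g ⟧ * ⟦ in? r (U ─ g) e ⟧)
        ≡⟨ ∑-cong (allSubsets n) (λ {g} _ → trans (∑-*ˡ (⟦ F? g ⟧ * ⟦ in? r U g ⟧) (allSubsets n) _)
             (cong (⟦ F? g ⟧ * ⟦ in? r U g ⟧ *_) (∑-In r (U ─ g)))) ⟩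
      ∑ (allSubsets n) (λ g → ⟦ F? g ⟧ * ⟦ in? r U g ⟧ * (∣ U ─ g ∣ C r))
        ≡⟨ ∑-cong (allSubsets n) (λ {g} _ → fix g) ⟩
      ∑ (allSubsets n) (λ g → ⟦ F? g ⟧ * ⟦ in? r U g ⟧ * C′)
        ≡⟨ ∑-*ʳ C′ (allSubsets n) _ ⟩
      size U * C′ ∎
      where
      exchange : ∀ e g → ⟦ in? r U e ⟧ * (⟦ F? g ⟧ * ⟦ in? r (U ─ e) g ⟧) ≡ ⟦ F? g ⟧ * ⟦ in? r U g ⟧ * ⟦ in? r (U ─ g) e ⟧
      exchange e g = begin-equality
        ⟦ in? r U e ⟧ * (⟦ F? g ⟧ * ⟦ in? r (U ─ e) g ⟧)   ≡⟨ *-assoc ⟦ in? r U e ⟧ _ _ ⟨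
        ⟦ in? r U e ⟧ * ⟦ F? g ⟧ * ⟦ in? r (U ─ e) g ⟧     ≡⟨ cong (_* ⟦ in? r (U ─ e) g ⟧) (*-comm ⟦ in? r U e ⟧ _) ⟩
        ⟦ F? g ⟧ * ⟦ in? r U e ⟧ * ⟦ in? r (U ─ e) g ⟧     ≡⟨ *-assoc ⟦ F? g ⟧ _ _ ⟩
        ⟦ F? g ⟧ * (⟦ in? r U e ⟧ * ⟦ in? r (U ─ e) g ⟧)   ≡⟨ cong (⟦ F? g ⟧ *_) (trans (sym (⟦⟧-× (in? r U e) (in? r (U ─ e) g)))
                                                             (trans (⟦⟧-cong (in? r U e ×-dec in? r (U ─ e) g) (in? r U g ×-dec in? r (U ─ g) e) (In-─-comm U e g) (In-─-comm U g e))
                                                             (⟦⟧-× (in? r U g) (in? r (U ─ g) e)))) ⟩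
        ⟦ F? g ⟧ * (⟦ in? r U g ⟧ * ⟦ in? r (U ─ g) e ⟧)   ≡⟨ *-assoc ⟦ F? g ⟧ _ _ ⟨
        ⟦ F? g ⟧ * ⟦ in? r U g ⟧ * ⟦ in? r (U ─ g) e ⟧     ∎
      fix : ∀ g → ⟦ F? g ⟧ * ⟦ in? r U g ⟧ * (∣ U ─ g ∣ C r) ≡ ⟦ F? g ⟧ * ⟦ in? r U g ⟧ * C′
      fix g with in? r U g
      ... | yes i = cong (λ c → ⟦ F? g ⟧ * 1 * (c C r)) (card i)
      ... | no _  = trans (cong (_* (∣ U ─ g ∣ C r)) (*-zeroʳ ⟦ F? g ⟧)) (sym (cong (_* C′) (*-zeroʳ ⟦ F? g ⟧)))

-- Packings by matchings

Meets : Subset n → Subset n → Set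
Meets s t = ∃[ v ] (v ∈ˢ s × v ∈ˢ t)

meets? : (s t : Subset n) → Dec (Meets s t)
meets? s t = Fin.any? λ v → (v Subset.∈? s) ×-dec (v Subset.∈? t)

¬Meets⇒Disjoint : {s t : Subset n} → ¬ Meets s t → Disjoint s t
¬Meets⇒Disjoint ¬m v v∈s v∈t = ¬m (v , v∈s , v∈t)

Disjoint⇒¬Meets : {s t : Subset n} → Disjoint s t → ¬ Meets s t
Disjoint⇒¬Meets d (v , v∈s , v∈t) = d v v∈s v∈t

Disjoint-sym : {s t : Subset n} → Disjoint s t → Disjoint t s
Disjoint-sym d v v∈t v∈s = d v v∈s v∈t

nonempty : {s : Subset n} → 0 < ∣ s ∣ → ∃[ v ] (v ∈ˢ s)
nonempty {n} {s} pos with Subset.nonempty? s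
... | yes p = p
... | no ¬p = contradiction (≤-trans pos (≤-reflexive (trans (cong ∣_∣ (Subset.Empty-unique ¬p)) (Subset.∣⊥∣≡0 n)))) λ ()

-- Disjoint sets that meet `f` do so in different points. The point used by the first set is removed
-- from `f`, and the other sets still meet what is left.
transversal-bound : ∀ (f : Subset n) M → Matching (Meets f) M → length M ≤ ∣ f ∣
transversal-bound f []      _ = z≤n
transversal-bound f (g ∷ M) (d ∷ ds , (v , v∈f , v∈g) ∷ ms) = ≤-trans
  (s≤s (transversal-bound (f - v) M (ds , All.tabulate λ h∈ → avoid (All.lookup d h∈) (All.lookup ms h∈))))
  (Subset.x∈p⇒∣p-x∣<∣p∣ v∈f)
  where
  avoid : ∀ {h} → Disjoint g h → Meets f h → Meets (f - v) h
  avoid dis (w , w∈f , w∈h) = w , Subset.x∈p∧x≢y⇒x∈p-y w∈f (λ { refl → dis w v∈g w∈h }) , w∈h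

matching-unique : {M : List (Subset n)} → All (λ s → 0 < ∣ s ∣) M → AllPairs Disjoint M → Unique M
matching-unique []         []       = []
matching-unique (pos ∷ ps) (d ∷ ds) =
  All.map (λ { dis refl → let v , v∈ = nonempty pos in dis v v∈ v∈ }) d ∷ matching-unique ps ds

HasMatching : ℕ → List (Subset n) → Set
HasMatching k L = ∃[ M ] (length M ≡ k × Matching (_∈ L) M)

MatchingFree : ℕ → List (Subset n) → Set
MatchingFree k L = ∀ M → Matching (_∈ L) M → length M < k

disjoint? : (s t : Subset n) → Dec (Disjoint s t)
disjoint? s t with meets? s t
... | yes m = no λ d → Disjoint⇒¬Meets d m
... | no ¬m = yes (¬Meets⇒Disjoint ¬m)

-- Branches on whether the matching uses the first set. If it does, the remaining members come from
-- the sets disjoint from it; nonemptiness ensures that the first set is not among these.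
hasMatching? : ∀ k (L : List (Subset n)) → All (λ s → 0 < ∣ s ∣) L → HasMatching k L ⊎ MatchingFree k L
hasMatching? zero    L       _ = inj₁ ([] , refl , [] , [])
hasMatching? (suc k) []      _ = inj₂ λ { [] _ → s≤s z≤n ; (_ ∷ _) (_ , () ∷ _) }
hasMatching? (suc k) (x ∷ L) (px ∷ pL)
  with hasMatching? k (filter (disjoint? x) L) (All.filter⁺ (disjoint? x) pL) | hasMatching? (suc k) L pL
... | inj₁ (M , len , ds , M∈) | _ = inj₁ (x ∷ M , cong suc len ,
      All.map (λ m → proj₂ (∈-filter⁻ (disjoint? x) {xs = L} m)) M∈ ∷ ds ,
      here refl ∷ All.map (λ m → there (proj₁ (∈-filter⁻ (disjoint? x) {xs = L} m))) M∈)
... | inj₂ _ | inj₁ (M , len , ds , M∈) = inj₁ (M , len , ds , All.map there M∈)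
... | inj₂ free₁ | inj₂ free₂ = inj₂ free
  where
  free : MatchingFree (suc k) (x ∷ L)
  free M (ds , M∈) with any? (x ≟ˢ_) M
  ... | no x∉ = free₂ M (ds , All.tabulate λ {s} s∈ → case All.lookup M∈ s∈ of λ where
          (here eq) → contradiction (subst (_∈ M) eq s∈) x∉
          (there m) → m)
  ... | yes x∈ with ∈-∃++ x∈
  ...   | ys , zs , refl = ≤-trans (≤-reflexive (cong suc (Perm.↭-length shifted))) (s≤s (free₁ (ys ++ zs)
            (AllPairs.tail ds′ , All.tabulate λ {s} s∈ → ∈-filter⁺ (disjoint? x) (in-L s∈) (All.lookup (AllPairs.head ds′) s∈))))
    where
    shifted : ys ++ [ x ] ++ zs ↭ x ∷ ys ++ zs
    shifted = Perm.shift x ys zs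
    ds′ : AllPairs Disjoint (x ∷ ys ++ zs)
    ds′ = PermS.AllPairs-resp-↭ (setoid _) Disjoint-sym (subst (Disjoint _) , subst (λ s → Disjoint s _)) (↭⇒↭ₛ shifted) ds
    in-L : ∀ {s} → s ∈ ys ++ zs → s ∈ L
    in-L {s} s∈ with All.lookup M∈ (Perm.∈-resp-↭ (↭-sym shifted) (there s∈))
    ... | there m = m
    ... | here eq = let v , v∈ = nonempty px in
      contradiction v∈ (All.lookup (AllPairs.head ds′) (subst (_∈ ys ++ zs) eq s∈) v v∈)

record Packing (k : ℕ) (L : List (Subset n)) : Set where
  field
    copies   : List (List (Subset n))
    rest     : List (Subset n)
    matching : All (λ P → length P ≡ k × AllPairs Disjoint P) copies
    perm     : concat copies ++ rest ↭ L

greedy-packing : ∀ fuel k (L : List (Subset n)) → length L ≤ fuel → All (λ s → 0 < ∣ s ∣) L → Unique L →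
                 Σ (Packing (suc k) L) λ P → MatchingFree (suc k) (Packing.rest P)
greedy-packing fuel k L len pos u with hasMatching? (suc k) L pos
... | inj₂ free = record { copies = [] ; rest = L ; matching = [] ; perm = _↭_.refl } , free
... | inj₁ (M , lenM , ds , M∈) = go fuel len
  where
  open DecMembership _≟ˢ_ using (_∈?_; _∉?_)
  L′ = filter (_∉? M) L
  M-unique : Unique M
  M-unique = matching-unique (All.map (All.lookup pos) M∈) ds
  split : L ↭ M ++ L′
  split = unique-⇔⇒↭ u
    (Unique.++⁺ M-unique (Unique.filter⁺ (_∉? M) u) λ (p , q) → proj₂ (∈-filter⁻ (_∉? M) {xs = L} q) p)
    (λ {s} s∈ → case s ∈? M of λ { (yes m) → ∈-++⁺ˡ m ; (no ¬m) → ∈-++⁺ʳ M (∈-filter⁺ (_∉? M) s∈ ¬m) })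
    (λ s∈ → [ All.lookup M∈ , (λ m → proj₁ (∈-filter⁻ (_∉? M) {xs = L} m)) ]′ (∈-++⁻ M s∈))
  shorter : length L ≡ suc (k + length L′)
  shorter = trans (Perm.↭-length split) (trans (length-++ M) (cong (_+ length L′) lenM))
  go : ∀ fuel → length L ≤ fuel → Σ (Packing (suc k) L) λ P → MatchingFree (suc k) (Packing.rest P)
  go zero       len = contradiction (subst (_≤ 0) shorter len) λ ()
  go (suc fuel) len with greedy-packing fuel k L′
                           (≤-trans (m≤n+m _ k) (≤-pred (subst (_≤ suc fuel) shorter len)))
                           (All.filter⁺ (_∉? M) pos) (Unique.filter⁺ (_∉? M) u)
  ... | P , free = record
    { copies = M ∷ copies ; rest = rest ; matching = (lenM , ds) ∷ matching
    ; perm = _↭_.trans (subst (_↭ M ++ L′) (sym (++-assoc M (concat copies) rest)) (Perm.++⁺ˡ M perm)) (↭-sym split) }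
    , free
    where open Packing P

-- Distinctness is part of adjacency, since a nonempty set meets itself.
conflict : ∀ n → Graph (Subset n)
conflict n = record
  { Adj  = λ s t → s ≢ t × Meets s t
  ; adj? = λ s t → ¬? (s ≟ˢ t) ×-dec meets? s t
  ; symm = λ (s≢t , v , v∈s , v∈t) → s≢t ∘ sym , v , v∈t , v∈s
  ; irr  = λ (s≢s , _) → s≢s refl }

-- Hajnal-Szemerédi needs exactly `t * k` vertices, so only that many sets are coloured, and
-- dropping the others cannot raise a degree. Classes of the conflict graph are matchings.
equitable-packing : ∀ k t (L : List (Subset n)) → Unique L → t * k ≤ length L →
  (∀ {s} → s ∈ L → Colouring.degree _≟ˢ_ k (conflict n) L s < t) →
  Σ (Packing k L) λ P → length (Packing.copies P) ≡ t
equitable-packing {n} k t L u len deg< =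
  record { copies = map class cs ; rest = ys ; matching = matching ; perm = perm } ,
  trans (length-map class cs) (length-upTo t)
  where
  open Colouring _≟ˢ_ k
  xs = take (t * k) L
  ys = drop (t * k) L
  cs = upTo t
  split : xs ++ ys ≡ L
  split = take++drop≡id (t * k) L
  xs⊆L : ∀ {s} → s ∈ xs → s ∈ L
  xs⊆L s∈ = subst (_ ∈_) split (∈-++⁺ˡ s∈)
  degree-xs : ∀ s → degree (conflict n) xs s ≤ degree (conflict n) L s
  degree-xs s = ≤-trans (m≤m+n _ _) (≤-reflexive (trans (sym (∑-++ xs ys _)) (cong (λ l → ∑ l _) split)))
  E : Equitable (conflict n) cs xs
  E = hajnal-szemerédi (suc t) (conflict n) (Unique.upTo⁺ t) (s≤s (≤-reflexive (length-upTo t)))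
    (Unique.take⁺ (t * k) u)
    (trans (length-take (t * k) L) (trans (m≤n⇒m⊓n≡m len) (cong (_* k) (sym (length-upTo t)))))
    (λ s∈ → ≤-<-trans (degree-xs _) (<-≤-trans (deg< (xs⊆L s∈)) (≤-reflexive (sym (length-upTo t)))))
  open Equitable E
  class : ℕ → List (Subset n)
  class i = filter (λ s → col s ≟ i) xs
  class⁻ : ∀ {i s} → s ∈ class i → s ∈ xs × col s ≡ i
  class⁻ {i} = ∈-filter⁻ (λ s → col s ≟ i) {xs = xs}
  class-unique : ∀ i → Unique (class i)
  class-unique i = Unique.filter⁺ (λ s → col s ≟ i) (Unique.take⁺ (t * k) u)
  independent : ∀ {i M} → Unique M → (∀ {s} → s ∈ M → s ∈ class i) → AllPairs Disjoint M
  independent [] _ = []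
  independent (s∉ ∷ uM) M⊆ = All.tabulate (λ t∈ → ¬Meets⇒Disjoint λ m →
      let s∈ , cs = class⁻ (M⊆ (here refl)) ; t∈′ , ct = class⁻ (M⊆ (there t∈)) in
      proper s∈ t∈′ (All.lookup s∉ t∈ , m) (trans cs (sym ct)))
    ∷ independent uM (M⊆ ∘ there)
  matching : All (λ P → length P ≡ k × AllPairs Disjoint P) (map class cs)
  matching = All.map⁺ (All.tabulate λ {i} i∈ →
    trans (length-filter-∑ (λ s → col s ≟ i) xs) (count i∈) , independent (class-unique i) id)
  classes-disjoint : ∀ {i j} → i ≢ j → DisjointLists.Disjoint (class i) (class j)
  classes-disjoint i≢j (p , q) = i≢j (trans (sym (proj₂ (class⁻ p))) (proj₂ (class⁻ q)))
  classes-unique : Unique (concat (map class cs))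
  classes-unique = Unique.concat⁺ (All.map⁺ (All.tabulate λ {i} _ → class-unique i))
    (AllPairsₚ.map⁺ (AllPairs.map classes-disjoint (Unique.upTo⁺ t)))
  concat↭ : concat (map class cs) ↭ xs
  concat↭ = unique-⇔⇒↭ classes-unique (Unique.take⁺ (t * k) u) into
    (λ s∈ → ∈-concat⁺′ (∈-filter⁺ (λ s → col s ≟ _) s∈ refl) (∈-map⁺ class (col∈ s∈)))
    where
    into : ∀ {s} → s ∈ concat (map class cs) → s ∈ xs
    into s∈ with ∈-concat⁻′ (map class cs) s∈
    ... | _ , s∈c , c∈ with ∈-map⁻ class c∈
    ...   | _ , _ , refl = proj₁ (class⁻ s∈c)
  perm : concat (map class cs) ++ ys ↭ L
  perm = subst (concat (map class cs) ++ ys ↭_) split (Perm.++⁺ʳ ys concat↭)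

-- Copies of H

-- With its inverse `nth`, the increasing enumeration of `e`; matching ranks gives a bijection
-- between two sets of equal size.
rank : (e : Subset n) {v : Fin n} → v ∈ˢ e → Fin ∣ e ∣
rank (true ∷ e)  here       = zero
rank (true ∷ e)  (there v∈) = suc (rank e v∈)
rank (false ∷ e) (there v∈) = rank e v∈

rank-irrelevant : (e : Subset n) {v : Fin n} (p q : v ∈ˢ e) → rank e p ≡ rank e q
rank-irrelevant (true ∷ e)  here      here      = refl
rank-irrelevant (true ∷ e)  (there p) (there q) = cong suc (rank-irrelevant e p q)
rank-irrelevant (false ∷ e) (there p) (there q) = rank-irrelevant e p q

rank-injective : (e : Subset n) {v w : Fin n} (p : v ∈ˢ e) (q : w ∈ˢ e) → rank e p ≡ rank e q → v ≡ w
rank-injective (true ∷ e)  here      here      _  = refl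
rank-injective (true ∷ e)  (there p) (there q) eq = cong suc (rank-injective e p q (Fin.suc-injective eq))
rank-injective (false ∷ e) (there p) (there q) eq = cong suc (rank-injective e p q eq)

nth : (e : Subset n) → Fin ∣ e ∣ → Fin n
nth (true ∷ e)  zero    = zero
nth (true ∷ e)  (suc i) = suc (nth e i)
nth (false ∷ e) i       = suc (nth e i)

nth∈ : (e : Subset n) (i : Fin ∣ e ∣) → nth e i ∈ˢ e
nth∈ (true ∷ e)  zero    = here
nth∈ (true ∷ e)  (suc i) = there (nth∈ e i)
nth∈ (false ∷ e) i       = there (nth∈ e i)

rank-nth : (e : Subset n) (i : Fin ∣ e ∣) → rank e (nth∈ e i) ≡ i
rank-nth (true ∷ e)  zero    = refl
rank-nth (true ∷ e)  (suc i) = cong suc (rank-nth e i)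
rank-nth (false ∷ e) i       = rank-nth e i

nth-rank : (e : Subset n) {v : Fin n} (p : v ∈ˢ e) → nth e (rank e p) ≡ v
nth-rank e p = rank-injective e (nth∈ e (rank e p)) p (rank-nth e (rank e p))

nth-injective : (e : Subset n) {i j : Fin ∣ e ∣} → nth e i ≡ nth e j → i ≡ j
nth-injective e {i} {j} eq = trans (sym (rank-nth e i)) (trans (lemma (nth∈ e i) eq) (rank-nth e j))
  where
  lemma : ∀ {v} (p : v ∈ˢ e) → v ≡ nth e j → rank e p ≡ rank e (nth∈ e j)
  lemma p refl = rank-irrelevant e p (nth∈ e j)

zip-lists : (xs : List A₁) (ys : List A₂) → length xs ≡ length ys →
            ∃[ zs ] (map proj₁ zs ≡ xs × map proj₂ zs ≡ ys)
zip-lists []       []       _  = [] , refl , refl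
zip-lists (x ∷ xs) (y ∷ ys) eq with zip-lists xs ys (suc-injective eq)
... | zs , p , q = (x , y) ∷ zs , cong (x ∷_) p , cong (y ∷_) q

AllPairs-lookup : {R : A₁ → A₁ → Set} → (∀ {x y} → R x y → R y x) → {xs : List A₁} → AllPairs R xs →
                  ∀ {x y} → x ∈ xs → y ∈ xs → x ≡ y ⊎ R x y
AllPairs-lookup sy (r ∷ rs) (here refl) (here refl) = inj₁ refl
AllPairs-lookup sy (r ∷ rs) (here refl) (there y∈)  = inj₂ (All.lookup r y∈)
AllPairs-lookup sy (r ∷ rs) (there x∈)  (here refl) = inj₂ (sy (All.lookup r x∈))
AllPairs-lookup sy (r ∷ rs) (there x∈)  (there y∈)  = AllPairs-lookup sy rs x∈ y∈

∈-tabulateˢ⁺ : {g : Fin n → Bool} {v : Fin n} → g v ≡ true → v ∈ˢ tabulate g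
∈-tabulateˢ⁺ {g = g} {v} eq = Vec.lookup⇒[]= v (tabulate g) (trans (Vec.lookup∘tabulate g v) eq)

∈-tabulateˢ⁻ : {g : Fin n → Bool} {v : Fin n} → v ∈ˢ tabulate g → g v ≡ true
∈-tabulateˢ⁻ {g = g} {v} v∈ = trans (sym (Vec.lookup∘tabulate g v)) (Vec.[]=⇒lookup v∈)

does-true : {P : Set} (d : Dec P) → does d ≡ true → P
does-true (yes p) _ = p

true-does : {P : Set} (d : Dec P) → P → does d ≡ true
true-does (yes _) _ = refl
true-does (no ¬p) p = contradiction p ¬p

module _ {m n : ℕ} (f : Fin m → Fin n) where

  preimage? : (e : Subset m) (v : Fin n) → Dec (∃[ i ] (i ∈ˢ e × f i ≡ v))
  preimage? e v = Fin.any? λ i → (i Subset.∈? e) ×-dec (f i Fin.≟ v)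

  image : Subset m → Subset n
  image e = tabulate λ v → does (preimage? e v)

  image-IsImage : ∀ e → IsImage f e (image e)
  image-IsImage e v = mk⇔ (λ v∈ → does-true (preimage? e v) (∈-tabulateˢ⁻ v∈))
                          (λ p → ∈-tabulateˢ⁺ (true-does (preimage? e v) p))

  IsImage-unique : ∀ {e s t} → IsImage f e s → IsImage f e t → s ≡ t
  IsImage-unique p q = Subset.⊆-antisym
    (λ {v} v∈ → Equivalence.from (q v) (Equivalence.to (p v) v∈))
    (λ {v} v∈ → Equivalence.from (p v) (Equivalence.to (q v) v∈))

  image-injective : Injective _≡_ _≡_ f → ∀ {d e} → image d ≡ image e → d ≡ e
  image-injective inj {d} {e} eq = Subset.⊆-antisym (half eq) (half (sym eq))
    where
    half : ∀ {d e} → image d ≡ image e → d ⊆ˢ e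
    half {d} {e} eq {v} v∈ with Equivalence.to (image-IsImage e (f v))
                          (subst (f v ∈ˢ_) eq (Equivalence.from (image-IsImage d (f v)) (v , v∈ , refl)))
    ... | w , w∈ , fw = subst (_∈ˢ e) (inj fw) w∈

module _ {r m k : ℕ} (H : RGraph r m) (kd : KDisjointEdges k H) where

  private
    Es = proj₁ kd
    lenEs = proj₁ (proj₂ kd)
    uEs = proj₁ (proj₂ (proj₂ kd))
    dEs = proj₁ (proj₂ (proj₂ (proj₂ kd)))
    edgeEs = proj₁ (proj₂ (proj₂ (proj₂ (proj₂ kd))))
    cover = proj₂ (proj₂ (proj₂ (proj₂ (proj₂ kd))))

  -- `FormsCopyOf` determines `P` only as a set. Its length follows because `P` has no repetitions
  -- and an injective map sends distinct edges to distinct images.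
  length-copy : {P : List (Subset n)} → FormsCopyOf H P → Unique P → length P ≡ k
  length-copy {P = P} (f , inj , copy) uP = trans
    (Perm.↭-length (unique-⇔⇒↭ uP (Unique.map⁺ (image-injective f inj) uEs) into onto))
    (trans (length-map (image f) Es) lenEs)
    where
    into : ∀ {s} → s ∈ P → s ∈ map (image f) Es
    into {s} s∈ with Equivalence.to (copy s) s∈
    ... | e , He , im = subst (_∈ map (image f) Es) (IsImage-unique f (image-IsImage f e) im)
      (∈-map⁺ (image f) (Equivalence.from (edgeEs e) He))
    onto : ∀ {s} → s ∈ map (image f) Es → s ∈ P
    onto s∈ with ∈-map⁻ (image f) s∈
    ... | e , e∈ , refl = Equivalence.from (copy _) (e , Equivalence.to (edgeEs e) e∈ , image-IsImage f e)

  -- Pair the edges of `H` with the sets of `P` in list order. The edges partition the vertices of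
  -- `H`, so preserving the rank within each pair defines a map on all of them, and disjointness in
  -- `P` makes it injective.
  matching-copy : {P : List (Subset n)} → length P ≡ k → AllPairs Disjoint P → All (λ s → ∣ s ∣ ≡ r) P →
                  FormsCopyOf H P
  matching-copy {n} {P} lenP dP sizes with zip-lists Es P (trans lenEs (sym lenP))
  ... | Z , refl , refl = f , f-injective , copy
    where
    Pair : Set
    Pair = Subset m × Subset n
    same-size : {z : Pair} → z ∈ Z → ∣ proj₁ z ∣ ≡ ∣ proj₂ z ∣
    same-size {z} z∈ = trans (uniform H (proj₁ z) (Equivalence.to (edgeEs (proj₁ z)) (∈-map⁺ proj₁ z∈)))
      (sym (All.lookup sizes (∈-map⁺ proj₂ z∈)))
    disjoint₁ : {y z : Pair} → y ∈ Z → z ∈ Z → y ≡ z ⊎ Disjoint (proj₁ y) (proj₁ z)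
    disjoint₁ = AllPairs-lookup (λ {x} {y} → Disjoint-sym {s = proj₁ x} {proj₁ y}) (AllPairsₚ.map⁻ dEs)
    disjoint₂ : {y z : Pair} → y ∈ Z → z ∈ Z → y ≡ z ⊎ Disjoint (proj₂ y) (proj₂ z)
    disjoint₂ = AllPairs-lookup (λ {x} {y} → Disjoint-sym {s = proj₂ x} {proj₂ y}) (AllPairsₚ.map⁻ dP)
    pair : ∀ v → ∃[ z ] (z ∈ Z × v ∈ˢ proj₁ z)
    pair v with cover v
    ... | e , e∈ , v∈ with ∈-map⁻ proj₁ e∈
    ...   | z , z∈ , refl = z , z∈ , v∈
    send : ∀ {z : Pair} → z ∈ Z → ∀ {v} → v ∈ˢ proj₁ z → Fin n
    send {z} z∈ v∈ = nth (proj₂ z) (Fin.cast (same-size z∈) (rank (proj₁ z) v∈))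
    f : Fin m → Fin n
    f v = send (proj₁ (proj₂ (pair v))) (proj₂ (proj₂ (pair v)))
    send∈ : ∀ {z : Pair} (z∈ : z ∈ Z) {v} (v∈ : v ∈ˢ proj₁ z) → send z∈ v∈ ∈ˢ proj₂ z
    send∈ {z} z∈ v∈ = nth∈ (proj₂ z) _
    send-rank : ∀ {z : Pair} {z∈ z∈′ : z ∈ Z} {v w} (p : v ∈ˢ proj₁ z) (q : w ∈ˢ proj₁ z) →
               send z∈ p ≡ send z∈′ q → rank (proj₁ z) p ≡ rank (proj₁ z) q
    send-rank {z} {z∈} {z∈′} p q eq = Fin.toℕ-injective (trans (sym (Fin.toℕ-cast (same-size z∈) _))
      (trans (cong Fin.toℕ (nth-injective (proj₂ z) eq)) (Fin.toℕ-cast (same-size z∈′) _)))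
    send-irrelevant : ∀ {z : Pair} (z∈ z∈′ : z ∈ Z) {v} (p q : v ∈ˢ proj₁ z) → send z∈ p ≡ send z∈′ q
    send-irrelevant {z} z∈ z∈′ p q = cong (nth (proj₂ z)) (Fin.toℕ-injective
      (trans (Fin.toℕ-cast (same-size z∈) _) (trans (cong Fin.toℕ (rank-irrelevant (proj₁ z) p q))
        (sym (Fin.toℕ-cast (same-size z∈′) _)))))
    -- `f` uses whichever pair the covering condition returns; disjointness of the edges of `H`
    -- makes it the only pair that contains `v`.
    f-send : ∀ {z : Pair} (z∈ : z ∈ Z) {v} (v∈ : v ∈ˢ proj₁ z) → f v ≡ send z∈ v∈
    f-send z∈ {v} v∈ with pair v
    ... | y , y∈ , v∈y with disjoint₁ y∈ z∈
    ...   | inj₁ refl = send-irrelevant y∈ z∈ v∈y v∈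
    ...   | inj₂ d    = contradiction v∈ (d v v∈y)
    f-injective : Injective _≡_ _≡_ f
    f-injective {v} {w} eq with pair v | pair w
    ... | y , y∈ , v∈ | z , z∈ , w∈ with disjoint₂ y∈ z∈
    ...   | inj₂ d    = contradiction (subst (_∈ˢ proj₂ z) (sym eq) (send∈ z∈ w∈)) (d _ (send∈ y∈ v∈))
    ...   | inj₁ refl = rank-injective (proj₁ y) v∈ w∈ (send-rank {z∈ = y∈} {z∈} v∈ w∈ eq)
    isImage : ∀ {z} → z ∈ Z → IsImage f (proj₁ z) (proj₂ z)
    isImage {z} z∈ w = mk⇔ to λ { (i , i∈ , refl) → subst (_∈ˢ proj₂ z) (sym (f-send z∈ i∈)) (send∈ z∈ i∈) }
      where
      to : w ∈ˢ proj₂ z → ∃[ i ] (i ∈ˢ proj₁ z × f i ≡ w)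
      to w∈ = v , v∈ , trans (f-send z∈ v∈) (trans (cong (nth (proj₂ z)) (Fin.toℕ-injective
          (trans (Fin.toℕ-cast (same-size z∈) _) (trans (cong Fin.toℕ (rank-nth (proj₁ z) j)) (Fin.toℕ-cast _ _)))))
        (nth-rank (proj₂ z) w∈))
        where
        j : Fin ∣ proj₁ z ∣
        j = Fin.cast (sym (same-size z∈)) (rank (proj₂ z) w∈)
        v = nth (proj₁ z) j
        v∈ = nth∈ (proj₁ z) j
    copy : ∀ s → (s ∈ map proj₂ Z ⇔ (∃[ e ] (IsEdge H e × IsImage f e s)))
    copy s = mk⇔ to from
      where
      to : s ∈ map proj₂ Z → ∃[ e ] (IsEdge H e × IsImage f e s)
      to s∈ with ∈-map⁻ proj₂ s∈
      ... | z , z∈ , refl = proj₁ z , Equivalence.to (edgeEs (proj₁ z)) (∈-map⁺ proj₁ z∈) , isImage z∈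
      from : ∃[ e ] (IsEdge H e × IsImage f e s) → s ∈ map proj₂ Z
      from (e , He , im) with ∈-map⁻ proj₁ (Equivalence.from (edgeEs e) He)
      ... | z , z∈ , refl = subst (_∈ map proj₂ Z) (IsImage-unique f (isImage z∈) im) (∈-map⁺ proj₂ z∈)

-- The decomposition number

module PartCount (κ : ℕ) where

  k = suc κ

  minParts : ℕ → ℕ
  minParts e = e / k + e % k

  minParts-+* : ∀ b a → minParts (b + a * k) ≡ a + minParts b
  minParts-+* b a = begin
    (b + a * k) / k + (b + a * k) % k ≡⟨ cong₂ _+_ (+-distrib-/-∣ʳ b (n∣m*n a)) ([m+kn]%n≡m%n b a k) ⟩
    b / k + a * k / k + b % k         ≡⟨ cong (λ c → b / k + c + b % k) (m*n/n≡m a k) ⟩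
    b / k + a + b % k                 ≡⟨ cong (_+ b % k) (+-comm (b / k) a) ⟩
    a + b / k + b % k                 ≡⟨ +-assoc a _ _ ⟩
    a + minParts b                    ∎
    where open ≡-Reasoning

  minParts-small : ∀ {b} → b < k → minParts b ≡ b
  minParts-small b<k = cong₂ _+_ (m<n⇒m/n≡0 b<k) (m<n⇒m%n≡m b<k)

  minParts≤ : ∀ b → minParts b ≤ b
  minParts≤ b = begin
    b / k + b % k       ≡⟨ +-comm (b / k) _ ⟩
    b % k + b / k       ≤⟨ +-monoʳ-≤ (b % k) (m≤m*n (b / k) k) ⟩
    b % k + b / k * k   ≡⟨ m≡m%n+[m/n]*n b k ⟨
    b                   ∎
    where open ≤-Reasoning

  minParts-lower : ∀ a b → minParts (b + a * k) ≤ a + b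
  minParts-lower a b = ≤-trans (≤-reflexive (minParts-+* b a)) (+-monoʳ-≤ a (minParts≤ b))

  Residue : ℕ → ℕ → Set
  Residue N ℓ = N % k ≡ (ℓ + κ) % k

  suc-residue : ∀ {l} → l < k → (suc l + κ) % k ≡ l
  suc-residue {l} l<k = trans (cong (_% k) (sym (+-suc l κ))) (trans ([m+n]%n≡m%n l k) (m<n⇒m%n≡m l<k))

  -- The second case cannot occur for `κ = 0`, as every remainder modulo 1 is 0, so the truncated
  -- subtraction does no harm.
  IsMax : ℕ → ℕ → Set
  IsMax N φ = (N % k ≡ κ × φ ≡ N / k + κ) ⊎ (N % k ≢ κ × φ ≡ N / k + (κ ∸ 1))

  module Max {N φ} (max : IsMax N φ) where

    X = N / k
    Y = N % k

    N≡ : N ≡ Y + X * k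
    N≡ = m≡m%n+[m/n]*n N k

    Y≤κ : Y ≤ κ
    Y≤κ = ≤-pred (m%n<n N k)

    -- In the second case, a smaller quotient loses one, which makes up for a remainder of `κ`; with
    -- the same quotient, the remainder is at most `Y`, hence below `κ`.
    minParts≤φ : ∀ {e} → e ≤ N → minParts e ≤ φ
    minParts≤φ {e} e≤N = go max
      where
      x≤X : e / k ≤ X
      x≤X = /-monoˡ-≤ k e≤N
      y≤κ : e % k ≤ κ
      y≤κ = ≤-pred (m%n<n e k)
      go : IsMax N φ → minParts e ≤ φ
      go (inj₁ (_ , refl)) = +-mono-≤ x≤X y≤κ
      go (inj₂ (Y≢κ , refl)) with m≤n⇒m<n∨m≡n x≤X
      ... | inj₁ x<X = begin
        e / k + e % k            ≤⟨ +-monoʳ-≤ (e / k) (≤-trans y≤κ (m≤n+m∸n κ 1)) ⟩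
        e / k + suc (κ ∸ 1)      ≡⟨ +-suc (e / k) _ ⟩
        suc (e / k) + (κ ∸ 1)    ≤⟨ +-monoˡ-≤ (κ ∸ 1) x<X ⟩
        X + (κ ∸ 1)              ∎
        where open ≤-Reasoning
      ... | inj₂ x≡X = +-mono-≤ x≤X (≤-trans y≤Y (<⇒≤pred (≤∧≢⇒< Y≤κ Y≢κ)))
        where
        y≤Y : e % k ≤ Y
        y≤Y = +-cancelʳ-≤ (X * k) _ _ (begin
          e % k + X * k        ≡⟨ cong (λ x → e % k + x * k) x≡X ⟨
          e % k + e / k * k    ≡⟨ m≡m%n+[m/n]*n e k ⟨
          e                    ≤⟨ e≤N ⟩
          N                    ≡⟨ N≡ ⟩
          Y + X * k            ∎)
          where open ≤-Reasoning

    -- In either case `φ` exceeds `X` by at least `Y`, so `k * φ` is at least Y + Xk = N.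
    few⇒<φ : ∀ {p} → k * p < N → p < φ
    few⇒<φ {p} kp<N = ≰⇒> λ φ≤p → <⇒≱ kp<N (≤-trans (go max) (*-monoʳ-≤ k φ≤p))
      where
      open ≤-Reasoning
      bound : ∀ c → Y ≤ c → N ≤ k * (X + c)
      bound c Y≤c = begin
        N                ≡⟨ N≡ ⟩
        Y + X * k        ≤⟨ +-mono-≤ (≤-trans Y≤c (m≤n*m c k)) (≤-reflexive (*-comm X k)) ⟩
        k * c + k * X    ≡⟨ trans (+-comm (k * c) _) (sym (*-distribˡ-+ k X c)) ⟩
        k * (X + c)      ∎
      go : IsMax N φ → N ≤ k * φ
      go (inj₁ (_ , refl))   = bound κ Y≤κ
      go (inj₂ (Y≢κ , refl)) = bound (κ ∸ 1) (<⇒≤pred (≤∧≢⇒< Y≤κ Y≢κ))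

    minParts-top : N % k ≡ (κ ∸ 1) % k → minParts N ≡ φ
    minParts-top eq = go max
      where
      go : IsMax N φ → X + Y ≡ φ
      go (inj₁ (Y≡κ , refl)) = cong (X +_) Y≡κ
      go (inj₂ (_ , refl))   = cong (X +_) (trans eq (m<n⇒m%n≡m (s≤s (m∸n≤m κ 1))))

    -- If `ℓ` is positive, then N = Xk + ℓ - 1 and e = (X - 1)k + κ: one quotient is given up for
    -- the largest remainder.
    minParts-residue : ∀ {e ℓ} → ℓ < k → e + ℓ ≡ N → Residue N ℓ → minParts e ≡ φ
    minParts-residue {e} {zero} _ e≡N res = go max
      where
      Y≡κ : Y ≡ κ
      Y≡κ = trans res (m<n⇒m%n≡m ≤-refl)
      go : IsMax N φ → minParts e ≡ φ
      go (inj₁ (_ , refl)) = trans (cong minParts (trans (sym (+-identityʳ e)) e≡N)) (cong (X +_) Y≡κ)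
      go (inj₂ (Y≢κ , _))  = contradiction Y≡κ Y≢κ
    minParts-residue {e} {suc l} (s≤s l<κ) e+ℓ≡N res = go max
      where
      Y≡l : Y ≡ l
      Y≡l = trans res (suc-residue (m<n⇒m<1+n l<κ))
      1+e : suc e ≡ X * k
      1+e = +-cancelʳ-≡ l _ _ (begin
        suc e + l      ≡⟨ +-suc e l ⟨
        e + suc l      ≡⟨ trans e+ℓ≡N N≡ ⟩
        Y + X * k      ≡⟨ trans (cong (_+ X * k) Y≡l) (+-comm l _) ⟩
        X * k + l      ∎)
        where open ≡-Reasoning
      split : ∀ x → suc e ≡ x * k → minParts e ≡ x + (κ ∸ 1)
      split (suc x) eq = begin
        minParts e                ≡⟨ cong minParts (suc-injective eq) ⟩
        minParts (κ + x * k)      ≡⟨ minParts-+* κ x ⟩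
        x + minParts κ            ≡⟨ cong (x +_) (minParts-small ≤-refl) ⟩
        x + κ                     ≡⟨ cong (x +_) (m+[n∸m]≡n (≤-trans (s≤s z≤n) l<κ)) ⟨
        x + suc (κ ∸ 1)           ≡⟨ +-suc x _ ⟩
        suc x + (κ ∸ 1)           ∎
        where open ≡-Reasoning
      go : IsMax N φ → minParts e ≡ φ
      go (inj₁ (Y≡κ , _))  = contradiction (trans (sym Y≡l) Y≡κ) (<⇒≢ l<κ)
      go (inj₂ (_ , refl)) = split X 1+e

    -- The converse, from equality in `minParts≤φ`: a sum of two bounded terms reaches its bound
    -- only if both terms do.
    extremal-sizes : ∀ {e} → e ≤ N → minParts e ≡ φ →
      (∃[ ℓ ] (ℓ < k × e + ℓ ≡ N × Residue N ℓ)) ⊎ (e ≡ N × N % k ≡ (κ ∸ 1) % k)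
    extremal-sizes {e} e≤N eq = go max
      where
      x≤X : e / k ≤ X
      x≤X = /-monoˡ-≤ k e≤N
      y≤κ : e % k ≤ κ
      y≤κ = ≤-pred (m%n<n e k)
      e≡ : e ≡ e % k + e / k * k
      e≡ = m≡m%n+[m/n]*n e k
      tight : ∀ {a b c d} → a ≤ b → c ≤ d → a + c ≡ b + d → a ≡ b × c ≡ d
      tight {a} {b} {c} {d} a≤b c≤d eq =
        ≤-antisym a≤b (+-cancelʳ-≤ c _ _ (≤-trans (+-monoʳ-≤ b c≤d) (≤-reflexive (sym eq)))) ,
        ≤-antisym c≤d (+-cancelˡ-≤ a _ _ (≤-trans (+-monoˡ-≤ d a≤b) (≤-reflexive (sym eq))))
      go : IsMax N φ → (∃[ ℓ ] (ℓ < k × e + ℓ ≡ N × Residue N ℓ)) ⊎ (e ≡ N × N % k ≡ (κ ∸ 1) % k)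
      go (inj₁ (Y≡κ , refl)) with tight x≤X y≤κ eq
      ... | x≡X , y≡κ = inj₁ (0 , s≤s z≤n ,
        trans (+-identityʳ e) (trans e≡ (trans (cong₂ (λ y x → y + x * k) (trans y≡κ (sym Y≡κ)) x≡X) (sym N≡))) ,
        trans Y≡κ (sym (m<n⇒m%n≡m ≤-refl)))
      go (inj₂ (Y≢κ , refl)) with m≤n⇒m<n∨m≡n x≤X
      ... | inj₁ x<X with tight x<X (≤-trans y≤κ (m≤n+m∸n κ 1)) (trans (cong suc eq) (sym (+-suc X (κ ∸ 1))))
      -- Here e = Xk - 1, so the `Y` edges above Xk are missing and one more.
      ...   | sx≡X , y≡ = inj₁ (suc Y , s≤s Y<κ , e+ℓ , sym (suc-residue (m%n<n N k)))
        where
        Y<κ : Y < κ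
        Y<κ = ≤∧≢⇒< Y≤κ Y≢κ
        y≡κ : e % k ≡ κ
        y≡κ = trans y≡ (m+[n∸m]≡n (≤-trans (s≤s z≤n) Y<κ))
        open ≡-Reasoning
        e+ℓ : e + suc Y ≡ N
        e+ℓ = begin
          e + suc Y                         ≡⟨ cong (_+ suc Y) (trans e≡ (cong (_+ e / k * k) y≡κ)) ⟩
          κ + e / k * k + suc Y             ≡⟨ +-suc (κ + e / k * k) Y ⟩
          suc (e / k) * k + Y               ≡⟨ cong (λ x → x * k + Y) sx≡X ⟩
          X * k + Y                         ≡⟨ +-comm (X * k) Y ⟩
          Y + X * k                         ≡⟨ N≡ ⟨
          N                                 ∎
      go (inj₂ (Y≢κ , refl)) | inj₂ x≡X = inj₂ (e≡N , trans (sym Y≡) (sym (m<n⇒m%n≡m (s≤s (m∸n≤m κ 1)))))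
        where
        y≤Y : e % k ≤ Y
        y≤Y = +-cancelʳ-≤ (X * k) _ _ (≤-trans (≤-reflexive (trans (cong (λ x → e % k + x * k) (sym x≡X)) (sym e≡)))
          (≤-trans e≤N (≤-reflexive N≡)))
        Y≤ : Y ≤ κ ∸ 1
        Y≤ = <⇒≤pred (≤∧≢⇒< Y≤κ Y≢κ)
        y≡ : e % k ≡ κ ∸ 1
        y≡ = proj₂ (tight x≤X (≤-trans y≤Y Y≤) eq)
        Y≡ : κ ∸ 1 ≡ Y
        Y≡ = ≤-antisym (≤-trans (≤-reflexive (sym y≡)) y≤Y) Y≤
        e≡N : e ≡ N
        e≡N = trans e≡ (trans (cong₂ (λ y x → y + x * k) (trans y≡ Y≡) x≡X) (sym N≡))

    residue-exists : k ≤ N → ∃[ ℓ ] (ℓ < k × ℓ ≤ N × Residue N ℓ)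
    residue-exists k≤N with Y ≟ κ
    ... | yes Y≡κ = 0 , s≤s z≤n , z≤n , trans Y≡κ (sym (m<n⇒m%n≡m ≤-refl))
    ... | no Y≢κ  = suc Y , s≤s Y<κ , ≤-trans (≤-trans Y<κ (n≤1+n κ)) k≤N , sym (suc-residue (m%n<n N k))
      where
      Y<κ : Y < κ
      Y<κ = ≤∧≢⇒< Y≤κ Y≢κ

phiValue-IsMax : ∀ n r κ → PartCount.IsMax κ (n C r) (phiValue n r (suc κ))
phiValue-IsMax n r κ with (n C r) % suc κ ≟ κ
... | yes eq = inj₁ (eq , refl)
... | no ¬eq = inj₂ (¬eq , refl)

-- The r-sets of an n-set and the edges of a graph

module UniformSets (r n : ℕ) (r>0 : 0 < r) where

  open DecMembership (_≟ˢ_ {n}) using () renaming (_∈?_ to _∈ᴸ?_; _∉?_ to _∉ᴸ?_)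

  rSets : List (Subset n)
  rSets = filter (λ s → ∣ s ∣ ≟ r) (allSubsets n)

  rSets-unique : Unique rSets
  rSets-unique = Unique.filter⁺ (λ s → ∣ s ∣ ≟ r) (allSubsets-unique n)

  ∈-rSets⁺ : ∀ {s} → ∣ s ∣ ≡ r → s ∈ rSets
  ∈-rSets⁺ {s} = ∈-filter⁺ (λ s → ∣ s ∣ ≟ r) (∈-allSubsets s)

  ∈-rSets⁻ : ∀ {s} → s ∈ rSets → ∣ s ∣ ≡ r
  ∈-rSets⁻ s∈ = proj₂ (∈-filter⁻ (λ s → ∣ s ∣ ≟ r) {xs = allSubsets n} s∈)

  length-rSets : length rSets ≡ n C r
  length-rSets = begin
    length rSets                                                 ≡⟨ length-filter-∑ (λ s → ∣ s ∣ ≟ r) (allSubsets n) ⟩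
    ∑ (allSubsets n) (λ s → ⟦ ∣ s ∣ ≟ r ⟧)                       ≡⟨ ∑-cong (allSubsets n) (λ {s} _ → ⟦⟧-cong (∣ s ∣ ≟ r) (in? r Subset.⊤ s) (λ eq → Subset.⊆⊤ , eq) proj₂) ⟩
    ∑ (allSubsets n) (λ s → ⟦ in? r Subset.⊤ s ⟧)                ≡⟨ ∑-In r (Subset.⊤ {n}) ⟩
    ∣ Subset.⊤ {n} ∣ C r                                         ≡⟨ cong (_C r) (Subset.∣⊤∣≡n n) ⟩
    n C r                                                        ∎
    where open ≡-Reasoning

  positive : {L : List (Subset n)} → All (λ s → ∣ s ∣ ≡ r) L → All (λ s → 0 < ∣ s ∣) L
  positive = All.map λ eq → subst (0 <_) (sym eq) r>0

  length-bound : ∀ q s {L} → q * r ≤ n → Unique L → All (λ s → ∣ s ∣ ≡ r) L →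
                 (∀ M → Matching (_∈ L) M → length M ≤ s) → q * length L ≤ s * (n C r)
  length-bound q s {L} qr≤n u sizes bound = begin
    q * length L                    ≤⟨ *-monoʳ-≤ q counted ⟩
    q * size Subset.⊤               ≤⟨ averaging q s Subset.⊤ (≤-trans qr≤n (≤-reflexive (sym (Subset.∣⊤∣≡n n))))
                                         (λ M (ds , all) → bound M (ds , All.map proj₁ all)) ⟩
    s * (∣ Subset.⊤ {n} ∣ C r)      ≡⟨ cong (λ c → s * (c C r)) (Subset.∣⊤∣≡n n) ⟩
    s * (n C r)                     ∎
    where
    open ≤-Reasoning
    open Averaging (_∈ᴸ? L) r
    counted : length L ≤ size Subset.⊤
    counted = begin
      length L                                     ≤⟨ ⊆⇒length≤ _≟ˢ_ u (λ {s} s∈ → ∈-filter⁺ (_∈ᴸ? L) (∈-allSubsets s) s∈) ⟩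
      length (filter (_∈ᴸ? L) (allSubsets n))      ≡⟨ length-filter-∑ (_∈ᴸ? L) (allSubsets n) ⟩
      ∑ (allSubsets n) (λ s → ⟦ s ∈ᴸ? L ⟧)         ≤⟨ ∑-mono (allSubsets n) (λ {s} _ → ≤-trans
                                                        (⟦⟧-mono (s ∈ᴸ? L) (s ∈ᴸ? L ×-dec in? r Subset.⊤ s) (λ s∈ → s∈ , Subset.⊆⊤ , All.lookup sizes s∈))
                                                        (≤-reflexive (⟦⟧-× (s ∈ᴸ? L) (in? r Subset.⊤ s)))) ⟩
      size Subset.⊤                                ∎

  conflicts : Subset n → List (Subset n)
  conflicts f = filter (meets? f) rSets

  conflicts-bound : ∀ q {f} → q * r ≤ n → ∣ f ∣ ≡ r → q * length (conflicts f) ≤ r * (n C r)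
  conflicts-bound q {f} qr≤n refl = length-bound q r qr≤n (Unique.filter⁺ (meets? f) rSets-unique)
    (All.tabulate λ s∈ → ∈-rSets⁻ (proj₁ (∈-filter⁻ (meets? f) {xs = rSets} s∈)))
    λ M (ds , M∈) → transversal-bound f M (ds , All.map (λ s∈ → proj₂ (∈-filter⁻ (meets? f) {xs = rSets} s∈)) M∈)

  -- The averaging bound for the family of a single r-set, where matchings have at most one member.
  -- It ensures that there are enough r-sets to delete `ℓ` of them.
  q≤nCr : ∀ q → q * r ≤ n → r ≤ n → q ≤ n C r
  q≤nCr q qr≤n r≤n = go rSets refl
    where
    go : ∀ L → L ≡ rSets → q ≤ n C r
    go []      eq = contradiction (subst (0 <_) (sym length-rSets) (nCk>0 r≤n)) (subst (λ l → ¬ 0 < length l) eq λ ())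
    go (f ∷ _) eq = subst₂ _≤_ (*-identityʳ q) (+-identityʳ _) (length-bound q 1 qr≤n ([] ∷ []) sizes
        λ M (ds , M∈) → ⊆⇒length≤ _≟ˢ_ (matching-unique (All.map (All.lookup (positive sizes)) M∈) ds) (All.lookup M∈))
      where
      sizes : All (λ s → ∣ s ∣ ≡ r) (f ∷ [])
      sizes = ∈-rSets⁻ (subst (f ∈_) eq (here refl)) ∷ []

  -- Strict, because `f` meets itself but is not its own neighbour.
  degree<conflicts : ∀ k {L f} → Unique L → All (λ s → ∣ s ∣ ≡ r) L → f ∈ L →
                     Colouring.degree _≟ˢ_ k (conflict n) L f < length (conflicts f)
  degree<conflicts k {L} {f} u sizes f∈ = ≤-trans
    (≤-reflexive (cong suc (sym (length-filter-∑ (Graph.adj? (conflict n) f) L))))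
    (⊆⇒length≤ _≟ˢ_ (All.tabulate (λ s∈ → proj₁ (proj₂ (nbr⁻ s∈))) ∷ Unique.filter⁺ (Graph.adj? (conflict n) f) u) sub)
    where
    nbr⁻ : ∀ {s} → s ∈ filter (Graph.adj? (conflict n) f) L → s ∈ L × Graph.Adj (conflict n) f s
    nbr⁻ = ∈-filter⁻ (Graph.adj? (conflict n) f) {xs = L}
    sub : ∀ {s} → s ∈ f ∷ filter (Graph.adj? (conflict n) f) L → s ∈ conflicts f
    sub (here refl) = let v , v∈ = nonempty (All.lookup (positive sizes) f∈) in
      ∈-filter⁺ (meets? f) (∈-rSets⁺ (All.lookup sizes f∈)) (v , v∈ , v∈)
    sub (there s∈)  = ∈-filter⁺ (meets? f) (∈-rSets⁺ (All.lookup sizes (proj₁ (nbr⁻ s∈)))) (proj₂ (proj₂ (nbr⁻ s∈)))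

  module Edges (G : RGraph r n) where

    isEdge? : ∀ s → Dec (IsEdge G s)
    isEdge? s = edge G s Bool.≟ true

    edges missing : List (Subset n)
    edges   = filter isEdge? (allSubsets n)
    missing = filter (¬? ∘ isEdge?) rSets

    edges-unique : Unique edges
    edges-unique = Unique.filter⁺ isEdge? (allSubsets-unique n)

    ∈-edges⁺ : ∀ {s} → IsEdge G s → s ∈ edges
    ∈-edges⁺ {s} = ∈-filter⁺ isEdge? (∈-allSubsets s)

    ∈-edges⁻ : ∀ {s} → s ∈ edges → IsEdge G s
    ∈-edges⁻ s∈ = proj₂ (∈-filter⁻ isEdge? {xs = allSubsets n} s∈)

    edges-size : All (λ s → ∣ s ∣ ≡ r) edges
    edges-size = All.tabulate λ {s} s∈ → uniform G s (∈-edges⁻ s∈)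

    ∈-missing⁻ : ∀ {s} → s ∈ missing → ∣ s ∣ ≡ r × ¬ IsEdge G s
    ∈-missing⁻ s∈ = let s∈r , ¬e = ∈-filter⁻ (¬? ∘ isEdge?) {xs = rSets} s∈ in ∈-rSets⁻ s∈r , ¬e

    ∈-missing⁺ : ∀ {s} → ∣ s ∣ ≡ r → ¬ IsEdge G s → s ∈ missing
    ∈-missing⁺ c = ∈-filter⁺ (¬? ∘ isEdge?) (∈-rSets⁺ c)

    missing-unique : Unique missing
    missing-unique = Unique.filter⁺ (¬? ∘ isEdge?) rSets-unique

    complement : ∀ {L} → Unique L → (∀ {s} → s ∈ L → ∣ s ∣ ≡ r × ¬ IsEdge G s) →
                 (∀ {s} → ∣ s ∣ ≡ r → ¬ IsEdge G s → s ∈ L) → length edges + length L ≡ n C r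
    complement {L} u L⁻ L⁺ = trans (sym (length-++ edges)) (trans (Perm.↭-length (unique-⇔⇒↭
        (Unique.++⁺ edges-unique u λ (p , q) → proj₂ (L⁻ q) (∈-edges⁻ p)) rSets-unique
        (λ s∈ → [ (λ e → ∈-rSets⁺ (All.lookup edges-size e)) , ∈-rSets⁺ ∘ proj₁ ∘ L⁻ ]′ (∈-++⁻ edges s∈))
        (λ {s} s∈ → case isEdge? s of λ where
          (yes e) → ∈-++⁺ˡ (∈-edges⁺ e)
          (no ¬e) → ∈-++⁺ʳ edges (L⁺ (∈-rSets⁻ s∈) ¬e))))
      length-rSets)

    edges+missing : length edges + length missing ≡ n C r
    edges+missing = complement missing-unique ∈-missing⁻ ∈-missing⁺

AllPairs-++⁻ : {R : A₁ → A₁ → Set} (xs : List A₁) {ys : List A₁} → AllPairs R (xs ++ ys) → AllPairs R xs × AllPairs R ys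
AllPairs-++⁻ []       rs       = [] , rs
AllPairs-++⁻ (x ∷ xs) (r ∷ rs) = let p , q = AllPairs-++⁻ xs rs in All.++⁻ˡ xs r ∷ p , q

-- Decompositions of a single graph

module Decompose {r m n κ : ℕ} (H : RGraph r m) (kd : KDisjointEdges (suc κ) H) (r>0 : 0 < r) (G : RGraph r n) where

  open PartCount κ
  open UniformSets r n r>0
  open Edges G

  e : ℕ
  e = length edges

  partCount : (ps : List (List (Subset n))) → All (AllowedPart H) ps → Unique (concat ps) →
              ∃[ a ] ∃[ b ] (length ps ≡ a + b × length (concat ps) ≡ b + a * k)
  partCount []       []         _ = 0 , 0 , refl , refl
  partCount (p ∷ ps) (al ∷ als) u with AllPairs-++⁻ p u
  ... | up , ups with partCount ps als ups | al
  ...   | a , b , eq₁ , eq₂ | inj₁ (s , refl) = a , suc b , trans (cong suc eq₁) (sym (+-suc a b)) , cong suc eq₂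
  ...   | a , b , eq₁ , eq₂ | inj₂ copy       = suc a , b , cong suc eq₁ , (begin
            length (p ++ concat ps)        ≡⟨ length-++ p ⟩
            length p + length (concat ps)  ≡⟨ cong₂ _+_ (length-copy H kd copy up) eq₂ ⟩
            k + (b + a * k)                ≡⟨ +-assoc k b _ ⟨
            k + b + a * k                  ≡⟨ cong (_+ a * k) (+-comm k b) ⟩
            b + k + a * k                  ≡⟨ +-assoc b k _ ⟩
            b + suc a * k                  ∎)
    where open ≡-Reasoning

  lower : (D : Decomposition H G) → minParts e ≤ length (parts D)
  lower D with partCount (parts D) (allowed D) (distinct D)
  ... | a , b , eq₁ , eq₂ = begin
    minParts e             ≡⟨ cong minParts (trans (Perm.↭-length edges↭) eq₂) ⟩
    minParts (b + a * k)   ≤⟨ minParts-lower a b ⟩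
    a + b                  ≡⟨ eq₁ ⟨
    length (parts D)       ∎
    where
    open ≤-Reasoning
    edges↭ : edges ↭ concat (parts D)
    edges↭ = unique-⇔⇒↭ edges-unique (distinct D)
      (λ s∈ → Equivalence.from (covers D _) (∈-edges⁻ s∈)) (λ s∈ → ∈-edges⁺ (Equivalence.to (covers D _) s∈))

  module _ (P : Packing k edges) where
    open Packing P

    concat-parts : concat (copies ++ map [_] rest) ≡ concat copies ++ rest
    concat-parts = trans (sym (concat-++ copies (map [_] rest))) (cong (concat copies ++_) (concat-map-[ rest ]))

    parts↭ : concat (copies ++ map [_] rest) ↭ edges
    parts↭ = subst (_↭ edges) (sym concat-parts) perm

    decomposition : Decomposition H G
    decomposition = record
      { parts    = copies ++ map [_] rest
      ; allowed  = All.++⁺ (All.tabulate λ {Q} Q∈ → inj₂ (matching-copy H kd (proj₁ (All.lookup matching Q∈))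
                       (proj₂ (All.lookup matching Q∈)) (All.tabulate λ s∈ → All.lookup edges-size
                         (Perm.∈-resp-↭ perm (∈-++⁺ˡ (∈-concat⁺′ s∈ Q∈))))))
                     (All.map⁺ (All.universal (λ s → inj₁ (s , refl)) rest))
      ; distinct = PermS.Unique-resp-↭ (setoid _) (↭⇒↭ₛ (↭-sym parts↭)) edges-unique
      ; covers   = λ s → mk⇔ (λ s∈ → ∈-edges⁻ (Perm.∈-resp-↭ parts↭ s∈))
                             (λ es → Perm.∈-resp-↭ (↭-sym parts↭) (∈-edges⁺ es)) }

    length-decomposition : length (parts decomposition) ≡ length copies + length rest
    length-decomposition = trans (length-++ copies) (cong (length copies +_) (length-map [_] rest))

    e≡ : e ≡ length rest + length copies * k
    e≡ = begin
      e                                    ≡⟨ Perm.↭-length perm ⟨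
      length (concat copies ++ rest)       ≡⟨ length-++ (concat copies) ⟩
      length (concat copies) + length rest ≡⟨ cong (_+ length rest) (concat-length copies matching) ⟩
      length copies * k + length rest      ≡⟨ +-comm (length copies * k) _ ⟩
      length rest + length copies * k      ∎
      where
      open ≡-Reasoning
      concat-length : ∀ Ps → All (λ Q → length Q ≡ k × AllPairs Disjoint Q) Ps → length (concat Ps) ≡ length Ps * k
      concat-length []       []               = refl
      concat-length (Q ∷ Qs) ((len , _) ∷ ms) = trans (length-++ Q) (cong₂ _+_ len (concat-length Qs ms))

  -- Either alternative keeps the number of parts within the maximum. The second stays strictly
  -- below it, and the description of the extremal graphs rests on this strictness.
  upper : ∀ q → q ≡ k * r + κ * κ → q * r ≤ n →
          Σ (Decomposition H G) λ D → length (parts D) ≡ minParts e ⊎ k * length (parts D) < n C r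
  upper q q≡ qr≤n with any? (λ f → e / k <? length (conflicts f)) edges
  ... | no ¬big = decomposition P , inj₁ (trans (length-decomposition P) (cong₂ _+_ t≡ rest≡))
    where
    result : Σ (Packing k edges) λ P → length (Packing.copies P) ≡ e / k
    result = equitable-packing k (e / k) edges edges-unique (m/n*n≤m e k)
      λ f∈ → <-≤-trans (degree<conflicts k edges-unique edges-size f∈) (≮⇒≥ λ big → ¬big (lose f∈ big))
    P = proj₁ result
    t≡ = proj₂ result
    rest≡ : length (Packing.rest P) ≡ e % k
    rest≡ = +-cancelʳ-≡ (e / k * k) _ _ (trans (sym (trans (e≡ P) (cong (λ t → length (Packing.rest P) + t * k) t≡)))
      (m≡m%n+[m/n]*n e k))
  ... | yes big = decomposition P , inj₂ (subst (λ p → k * p < n C r) (sym (length-decomposition P))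
                    (*-cancelˡ-< q _ _ few))
    where
    N = n C r
    result : Σ (Packing k edges) λ P → MatchingFree k (Packing.rest P)
    result = greedy-packing e κ edges ≤-refl (positive edges-size) edges-unique
    P = proj₁ result
    a = length (Packing.copies P)
    l = length (Packing.rest P)
    f = proj₁ (find big)
    f∈ = proj₁ (proj₂ (find big))
    c = length (conflicts f)
    rest∈ : ∀ {s} → s ∈ Packing.rest P → s ∈ edges
    rest∈ s∈ = Perm.∈-resp-↭ (Packing.perm P) (∈-++⁺ʳ (concat (Packing.copies P)) s∈)
    leftover : q * l ≤ κ * N
    leftover = length-bound q κ qr≤n
      (proj₂ (AllPairs-++⁻ (concat (Packing.copies P)) (PermS.Unique-resp-↭ (setoid _) (↭⇒↭ₛ (↭-sym (Packing.perm P))) edges-unique)))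
      (All.tabulate λ s∈ → All.lookup edges-size (rest∈ s∈))
      λ M matching → ≤-pred (proj₂ result M matching)
    e<kc : e < k * c
    e<kc = begin-strict
      e                        ≡⟨ m≡m%n+[m/n]*n e k ⟩
      e % k + e / k * k        <⟨ +-monoˡ-< (e / k * k) (m%n<n e k) ⟩
      suc (e / k) * k          ≤⟨ *-monoˡ-≤ k (proj₂ (proj₂ (find big))) ⟩
      c * k                    ≡⟨ *-comm c k ⟩
      k * c                    ∎
      where open ≤-Reasoning
    instance
      q≢0 : NonZero q
      q≢0 = >-nonZero (≤-trans (≤-trans r>0 (m≤m+n r _)) (≤-trans (m≤m+n _ (κ * κ)) (≤-reflexive (sym q≡))))
    few : q * (k * (a + l)) < q * N
    few = begin-strict
      q * (k * (a + l))              ≡⟨ solve 4 (λ q κ a l → q :* ((con 1 :+ κ) :* (a :+ l)) := q :* (l :+ a :* (con 1 :+ κ)) :+ κ :* (q :* l)) refl q κ a l ⟩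
      q * (l + a * k) + κ * (q * l)  ≡⟨ cong (λ x → q * x + κ * (q * l)) (e≡ P) ⟨
      q * e + κ * (q * l)            <⟨ +-mono-<-≤ (*-monoʳ-< q e<kc) (*-monoʳ-≤ κ leftover) ⟩
      q * (k * c) + κ * (κ * N)      ≡⟨ cong (_+ κ * (κ * N)) (solve 3 (λ q k c → q :* (k :* c) := k :* (q :* c)) refl q k c) ⟩
      k * (q * c) + κ * (κ * N)      ≤⟨ +-monoˡ-≤ _ (*-monoʳ-≤ k (conflicts-bound q qr≤n (All.lookup edges-size f∈))) ⟩
      k * (r * N) + κ * (κ * N)      ≡⟨ solve 4 (λ k r κ N → k :* (r :* N) :+ κ :* (κ :* N) := (k :* r :+ κ :* κ) :* N) refl k r κ N ⟩
      (k * r + κ * κ) * N            ≡⟨ cong (_* N) q≡ ⟨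
      q * N                          ∎
      where
      open ≤-Reasoning
      open +-*-Solver

  phi : ∀ {t} → (D : Decomposition H G) → length (parts D) ≤ minParts e → minParts e ≡ t → IsPhi H G t
  phi D len eq = (D , trans (≤-antisym len (lower D)) eq) , λ D′ → ≤-trans (≤-reflexive (sym eq)) (lower D′)

-- The maximum over all graphs and the extremal graphs

module DecompositionNumber {κ r m n : ℕ} (H : RGraph r m) (kd : KDisjointEdges (suc κ) H) (r>0 : 0 < r)
  {φ : ℕ} (max : PartCount.IsMax κ (n C r) φ) (qr≤n : (suc κ * r + κ * κ) * r ≤ n) where

  N q : ℕ
  N = n C r
  q = suc κ * r + κ * κ

  open PartCount κ
  open Max {N} {φ} max
  open UniformSets r n r>0

  instance
    r≢0 : NonZero r
    r≢0 = >-nonZero r>0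

  k≤q : k ≤ q
  k≤q = ≤-trans (m≤m*n k r) (m≤m+n (k * r) (κ * κ))

  k≤N : k ≤ N
  k≤N = ≤-trans k≤q (q≤nCr q qr≤n (≤-trans (m≤n*m r q {{>-nonZero (≤-trans (s≤s z≤n) k≤q)}}) qr≤n))

  module D (G : RGraph r n) = Decompose H kd r>0 G

  edges# : RGraph r n → ℕ
  edges# G = length (Edges.edges G)
  edges#≤N : ∀ G → edges# G ≤ N
  edges#≤N G = m+n≤o⇒m≤o _ (≤-reflexive (Edges.edges+missing G))

  upper : ∀ G → Σ (Decomposition H G) λ D → length (parts D) ≤ φ
  upper G with D.upper G q refl qr≤n
  ... | D , inj₁ eq  = D , ≤-trans (≤-reflexive eq) (minParts≤φ (edges#≤N G))
  ... | D , inj₂ few = D , <⇒≤ (few⇒<φ few)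

  maximal⇒phi : ∀ G → minParts (edges# G) ≡ φ → IsPhi H G φ
  maximal⇒phi G eq with D.upper G q refl qr≤n
  ... | D , inj₁ len = D.phi G D (≤-reflexive len) eq
  ... | D , inj₂ few = contradiction (≤-trans (≤-reflexive (sym eq)) (D.lower G D)) (<⇒≱ (few⇒<φ few))

  -- A graph that needs `φ` parts cannot have a decomposition of the second kind, so its number of
  -- edges alone already forces `φ` parts.
  phi⇒maximal : ∀ G → IsPhi H G φ → minParts (edges# G) ≡ φ
  phi⇒maximal G (_ , least) with D.upper G q refl qr≤n
  ... | D , inj₁ len = ≤-antisym (minParts≤φ (edges#≤N G)) (≤-trans (least D) (≤-reflexive len))
  ... | D , inj₂ few = contradiction (least D) (<⇒≱ (few⇒<φ few))

  open DecMembership (_≟ˢ_ {n}) using () renaming (_∉?_ to _∉ᴸ?_)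

  family⇒edges# : ∀ {G} → ((ℓ , _) : InFamilyK k G) → edges# G + ℓ ≡ N
  family⇒edges# {G} (ℓ , _ , _ , _ , L , refl , uL , sizes , edge⇔) = Edges.complement G uL
    (λ s∈ → All.lookup sizes s∈ , λ es → proj₂ (Equivalence.to (edge⇔ _) es) s∈)
    (λ {s} c ¬e → decidable-stable (s ∈ᴸ? L) λ s∉ → ¬e (Equivalence.from (edge⇔ s) (c , s∉)))
    where open DecMembership (_≟ˢ_ {n}) using () renaming (_∈?_ to _∈ᴸ?_)

  delete : ∀ ℓ → ℓ < k → ℓ ≤ N → Residue N ℓ → Σ (RGraph r n) (InFamilyK k)
  delete ℓ ℓ<k ℓ≤N res = G , ℓ , ℓ<k , ℓ≤N , res , L ,
      trans (length-take ℓ rSets) (trans (cong (ℓ ⊓_) length-rSets) (m≤n⇒m⊓n≡m ℓ≤N)) ,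
      Unique.take⁺ ℓ rSets-unique , All.tabulate (λ s∈ → ∈-rSets⁻ (subst (_ ∈_) (take++drop≡id ℓ rSets) (∈-++⁺ˡ s∈))) ,
      λ s → mk⇔ (does-true (edge? s)) (true-does (edge? s))
    where
    L = take ℓ rSets
    edge? : ∀ s → Dec (∣ s ∣ ≡ r × s ∉ L)
    edge? s = (∣ s ∣ ≟ r) ×-dec (s ∉ᴸ? L)
    G : RGraph r n
    G = record { edge = λ s → does (edge? s) ; uniform = λ s eq → proj₁ (does-true (edge? s) eq) }

  family⇒maximal : ∀ {G} → InFamilyK k G → minParts (edges# G) ≡ φ
  family⇒maximal {G} fam@(ℓ , ℓ<k , _ , res , _) = minParts-residue ℓ<k (family⇒edges# {G} fam) res

  isPhiN : IsPhiN H n φ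
  isPhiN = (let ℓ , ℓ<k , ℓ≤N , res = residue-exists k≤N
                G , fam = delete ℓ ℓ<k ℓ≤N res
            in G , maximal⇒phi G (family⇒maximal {G} fam)) ,
    λ { G t ((D₀ , _) , least) → ≤-trans (least (proj₁ (upper G))) (proj₂ (upper G)) }

  ⇒extremal : ∀ G → InFamilyK k G ⊎ (N % k ≡ (κ ∸ 1) % k × IsComplete G) → Extremal H G
  ⇒extremal G (inj₁ fam) = φ , isPhiN , maximal⇒phi G (family⇒maximal {G} fam)
  ⇒extremal G (inj₂ (res , complete)) = φ , isPhiN , maximal⇒phi G (trans (cong minParts edges#≡N) (minParts-top res))
    where
    edges#≡N : edges# G ≡ N
    edges#≡N = trans (sym (+-identityʳ _)) (Edges.complement G [] (λ ())
      λ c ¬e → contradiction (Equivalence.from (complete _) c) ¬e)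

  -- The number of edges determines how many r-sets are missing; the missing r-sets themselves serve
  -- as the deleted list, or there are none.
  extremal⇒ : ∀ G → Extremal H G → InFamilyK k G ⊎ (N % k ≡ (κ ∸ 1) % k × IsComplete G)
  extremal⇒ G (t , ((G₀ , phi₀) , max₀) , phi) with extremal-sizes (edges#≤N G) (phi⇒maximal G (subst (IsPhi H G) t≡φ phi))
    where
    t≡φ : t ≡ φ
    t≡φ = ≤-antisym (proj₂ isPhiN G₀ t phi₀) (let G₁ , phi₁ = proj₁ isPhiN in max₀ G₁ φ phi₁)
  ... | inj₁ (ℓ , ℓ<k , e+ℓ , res) = inj₁ (ℓ , ℓ<k , m+n≤o⇒n≤o (edges# G) (≤-reflexive e+ℓ) , res , missing ,
      +-cancelˡ-≡ (edges# G) _ _ (trans edges+missing (sym e+ℓ)) , missing-unique ,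
      All.tabulate (proj₁ ∘ ∈-missing⁻) ,
      λ s → mk⇔ (λ es → uniform G s es , λ s∈ → proj₂ (∈-missing⁻ s∈) es)
                (λ (c , s∉) → decidable-stable (isEdge? s) λ ¬e → s∉ (∈-missing⁺ c ¬e)))
    where open Edges G
  ... | inj₂ (e≡N , res) = inj₂ (res , λ s → mk⇔ (uniform G s)
      (λ c → decidable-stable (isEdge? s) λ ¬e → none (∈-missing⁺ c ¬e)))
    where
    open Edges G
    none : ∀ {s} → s ∉ missing
    none = empty (+-cancelˡ-≡ (edges# G) _ _ (trans edges+missing (trans (sym e≡N) (sym (+-identityʳ _)))))
      where
      empty : ∀ {L : List (Subset n)} → length L ≡ 0 → ∀ {s} → s ∉ L
      empty {[]} _ ()

-- The number q = k (k + r - 2) + 1, without truncated subtraction, satisfies q r ≤ n₀.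
q*r≤n₀ : ∀ κ ρ → (suc κ * (2 + ρ) + κ * κ) * (2 + ρ) ≤ n₀ (suc κ) (2 + ρ)
q*r≤n₀ κ ρ = ≤-trans (m≤m+n (q * r) (suc ρ)) (≤-reflexive
  (trans (sym (cong (_∸ 1) (+-suc (q * r) (suc ρ)))) (cong (_∸ 1) (begin
    q * r + (2 + ρ)
      ≡⟨ solve 2 (λ κ ρ → ((con 1 :+ κ) :* (con 2 :+ ρ) :+ κ :* κ) :* (con 2 :+ ρ) :+ (con 2 :+ ρ)
                       := (con 1 :+ κ) :* (con 2 :+ ρ) :* (con 1 :+ κ :+ ρ) :+ con 2 :* (con 2 :+ ρ)) refl κ ρ ⟩
    k * r * (1 + κ + ρ) + 2 * r
      ≡⟨ cong (λ x → k * r * (x ∸ 1) + 2 * r) (trans (+-suc κ (suc ρ)) (cong suc (+-suc κ ρ))) ⟨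
    k * r * (k + r ∸ 2) + 2 * r ∎))))
  where
  open ≡-Reasoning
  open +-*-Solver
  k = suc κ
  r = 2 + ρ
  q = k * r + κ * κ

theorem1p2 : (k r : ℕ) .{{_ : NonZero k}} → r ≥ 2 →
    ∀ {m} (H : RGraph r m) → KDisjointEdges k H →
    ∀ n → n ≥ n₀ k r →
    IsPhiN H n (phiValue n r k)
    × (∀ (G : RGraph r n) →
    (Extremal H G ⇔ (InFamilyK k G ⊎ ((n C r) % k ≡ (k ∸ 2) % k × IsComplete G))))
theorem1p2 zero    r             {{()}}
theorem1p2 (suc κ) (suc zero)    (s≤s ())
theorem1p2 (suc κ) (suc (suc ρ)) _ H kd n n≥ = isPhiN , λ G → mk⇔ (extremal⇒ G) (⇒extremal G)
  where open DecompositionNumber H kd (s≤s z≤n) (phiValue-IsMax n (2 + ρ) κ) (≤-trans (q*r≤n₀ κ ρ) n≥)
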